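{- For every negative integer $-T$ (that is, for every integer $T\geq 1$) there is a Pisot number of trace $-T$ and degree at most the sum of the first $2T+4$ primes.
   Context: A Pisot number is a real algebraic integer greater than $1$ whose other conjugates over $\mathbb{Q}$ all lie in the open disc $|z|<1$. The degree and trace of an algebraic integer are the degree of its minimal polynomial over $\mathbb{Q}$ and the sum of the zeros of that minimal polynomial, respectively. -}

module Defs where

open import Data.Nat.Base as ℕ using (ℕ; zero; suc; _!)
import Data.Nat.Properties as ℕ
open import Data.Nat.Divisibility using (_∣_; ∣-trans; ∣m+n∣m⇒∣n; m∣m*n; ∣1⇒≡1; m≤n⇒m!∣n!)
open import Data.Nat.ListAction using (sum; product)
open import Data.Nat.Primality using (Prime; prime?; ¬prime[0]; ¬prime[1])
open import Data.Nat.Primality.Factorisation using (PrimeFactorisation; factorise)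
open import Data.Integer.Base as ℤ using (ℤ; +_)
open import Data.Rational.Base as ℚ using (ℚ; 0ℚ; 1ℚ; ½; _/_)
import Data.Rational.Properties as ℚ
open import Data.Rational.Solver using (module +-*-Solver)
open import Algebra.Properties.Ring ℚ.+-*-ring using (x[y-z]≈xy-xz; [y-z]x≈yx-zx)
open import Data.List.Base using ([]; _∷_; map; upTo)
open import Data.List.Relation.Unary.All using ([]; _∷_)
open import Data.Vec.Base as Vec using (Vec; []; _∷_)
open import Data.Product.Base using (Σ; ∃; ∃-syntax; _×_; _,_; proj₁; proj₂)
open import Relation.Nullary using (¬_; yes; no; contradiction)
open import Relation.Binary.PropositionalEquality
  using (_≡_; refl; sym; trans; cong; cong₂; subst; subst₂)

------------------------------------------------------------------------
-- Real numbers: Cauchy sequences of rationals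

Cauchy : (ℕ → ℚ) → Set
Cauchy x = ∀ ε → 0ℚ ℚ.< ε →
  ∃[ N ] (∀ m n → N ℕ.≤ m → N ℕ.≤ n → ℚ.∣ x m ℚ.- x n ∣ ℚ.< ε)

private

  half-pos : ∀ {ε} → 0ℚ ℚ.< ε → 0ℚ ℚ.< ½ ℚ.* ε
  half-pos {ε} 0<ε = subst (ℚ._< ½ ℚ.* ε) (ℚ.*-zeroʳ ½) (ℚ.*-monoʳ-<-pos ½ 0<ε)

  half+half : ∀ ε → ½ ℚ.* ε ℚ.+ ½ ℚ.* ε ≡ ε
  half+half ε = trans (sym (ℚ.*-distribʳ-+ ε ½ ½)) (ℚ.*-identityˡ ε)

  const-cauchy : ∀ q → Cauchy (λ _ → q)
  const-cauchy q ε 0<ε =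
    0 , λ _ _ _ _ → subst (λ r → ℚ.∣ r ∣ ℚ.< ε) (sym (ℚ.+-inverseʳ q)) 0<ε

  +-cauchy : ∀ {x y} → Cauchy x → Cauchy y → Cauchy (λ n → x n ℚ.+ y n)
  +-cauchy {x} {y} cx cy ε 0<ε with cx _ (half-pos 0<ε) | cy _ (half-pos 0<ε)
  ... | M , hx | N , hy = M ℕ.⊔ N , λ m n p q →
    let open ℚ.≤-Reasoning in begin-strict
    ℚ.∣ (x m ℚ.+ y m) ℚ.- (x n ℚ.+ y n) ∣
      ≡⟨ cong ℚ.∣_∣ (rearrange (x m) (y m) (x n) (y n)) ⟩
    ℚ.∣ (x m ℚ.- x n) ℚ.+ (y m ℚ.- y n) ∣
      ≤⟨ ℚ.∣p+q∣≤∣p∣+∣q∣ (x m ℚ.- x n) (y m ℚ.- y n) ⟩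
    ℚ.∣ x m ℚ.- x n ∣ ℚ.+ ℚ.∣ y m ℚ.- y n ∣
      <⟨ ℚ.+-mono-<
           (hx m n (ℕ.m⊔n≤o⇒m≤o M N p) (ℕ.m⊔n≤o⇒m≤o M N q))
           (hy m n (ℕ.m⊔n≤o⇒n≤o M N p) (ℕ.m⊔n≤o⇒n≤o M N q)) ⟩
    ½ ℚ.* ε ℚ.+ ½ ℚ.* ε
      ≡⟨ half+half ε ⟩
    ε ∎
    where
    rearrange : ∀ a b c d → (a ℚ.+ b) ℚ.- (c ℚ.+ d) ≡ (a ℚ.- c) ℚ.+ (b ℚ.- d)
    rearrange = solve 4 (λ a b c d →
      (a :+ b) :- (c :+ d) := (a :- c) :+ (b :- d)) refl
      where open +-*-Solver

  neg-cauchy : ∀ {x} → Cauchy x → Cauchy (λ n → ℚ.- x n)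
  neg-cauchy {x} cx ε 0<ε with cx ε 0<ε
  ... | N , hx = N , λ m n p q →
    subst (ℚ._< ε)
      (trans (sym (ℚ.∣-p∣≡∣p∣ (x m ℚ.- x n)))
             (cong ℚ.∣_∣ (ℚ.neg-distrib-+ (x m) (ℚ.- x n))))
      (hx m n p q)

  eventually-bounded : ∀ {x} → Cauchy x →
    ∃[ B ] (0ℚ ℚ.< B × ∃[ N ] (∀ n → N ℕ.≤ n → ℚ.∣ x n ∣ ℚ.≤ B))
  eventually-bounded {x} cx with cx 1ℚ (ℚ.positive⁻¹ 1ℚ)
  ... | N , hx = 1ℚ ℚ.+ ℚ.∣ x N ∣
    , ℚ.+-mono-<-≤ (ℚ.positive⁻¹ 1ℚ) (ℚ.0≤∣p∣ (x N))
    , N , λ n p → let open ℚ.≤-Reasoning in begin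
      ℚ.∣ x n ∣                        ≡⟨ cong ℚ.∣_∣ (split (x n) (x N)) ⟩
      ℚ.∣ (x n ℚ.- x N) ℚ.+ x N ∣      ≤⟨ ℚ.∣p+q∣≤∣p∣+∣q∣ (x n ℚ.- x N) (x N) ⟩
      ℚ.∣ x n ℚ.- x N ∣ ℚ.+ ℚ.∣ x N ∣  ≤⟨ ℚ.+-monoˡ-≤ ℚ.∣ x N ∣ (ℚ.<⇒≤ (hx n N p ℕ.≤-refl)) ⟩
      1ℚ ℚ.+ ℚ.∣ x N ∣                 ∎
    where
    split : ∀ a b → a ≡ (a ℚ.- b) ℚ.+ b
    split = solve 2 (λ a b → a := (a :- b) :+ b) refl
      where open +-*-Solver

  split-product : ∀ a b c d →
    (a ℚ.* b) ℚ.- (c ℚ.* d) ≡ a ℚ.* (b ℚ.- d) ℚ.+ d ℚ.* (a ℚ.- c)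
  split-product a b c d = trans
    (telescope (a ℚ.* b) (a ℚ.* d) (c ℚ.* d))
    (sym (cong₂ ℚ._+_ (x[y-z]≈xy-xz a b d)
      (trans (ℚ.*-comm d (a ℚ.- c)) ([y-z]x≈yx-zx d a c))))
    where
    telescope : ∀ p q r → p ℚ.- r ≡ (p ℚ.- q) ℚ.+ (q ℚ.- r)
    telescope = solve 3 (λ p q r → p :- r := (p :- q) :+ (q :- r)) refl
      where open +-*-Solver

  product-bound : ∀ {D δ} → 0ℚ ℚ.< D → ∀ u v →
    ℚ.∣ u ∣ ℚ.≤ D → ℚ.∣ v ∣ ℚ.< δ → ℚ.∣ u ℚ.* v ∣ ℚ.< D ℚ.* δ
  product-bound {D} {δ} 0<D u v u≤D v<δ = let open ℚ.≤-Reasoning in begin-strict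
    ℚ.∣ u ℚ.* v ∣       ≡⟨ ℚ.∣p*q∣≡∣p∣*∣q∣ u v ⟩
    ℚ.∣ u ∣ ℚ.* ℚ.∣ v ∣ ≤⟨ ℚ.*-monoʳ-≤-nonNeg ℚ.∣ v ∣ {{ℚ.∣-∣-nonNeg v}} u≤D ⟩
    D ℚ.* ℚ.∣ v ∣       <⟨ ℚ.*-monoʳ-<-pos D {{ℚ.positive 0<D}} v<δ ⟩
    D ℚ.* δ             ∎

  product-close : ∀ {B C δ ε} → 0ℚ ℚ.< B → 0ℚ ℚ.< C → B ℚ.* δ ℚ.+ C ℚ.* δ ≡ ε →
    ∀ a b c d → ℚ.∣ a ∣ ℚ.≤ B → ℚ.∣ d ∣ ℚ.≤ C →
    ℚ.∣ a ℚ.- c ∣ ℚ.< δ → ℚ.∣ b ℚ.- d ∣ ℚ.< δ →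
    ℚ.∣ a ℚ.* b ℚ.- c ℚ.* d ∣ ℚ.< ε
  product-close {B} {C} {δ} {ε} 0<B 0<C Bδ+Cδ≡ε a b c d ∣a∣≤B ∣d∣≤C a~c b~d =
    subst₂ ℚ._<_ (cong ℚ.∣_∣ (sym (split-product a b c d))) Bδ+Cδ≡ε
      (ℚ.≤-<-trans (ℚ.∣p+q∣≤∣p∣+∣q∣ (a ℚ.* (b ℚ.- d)) (d ℚ.* (a ℚ.- c)))
        (ℚ.+-mono-<
          {ℚ.∣ a ℚ.* (b ℚ.- d) ∣} {B ℚ.* δ} {ℚ.∣ d ℚ.* (a ℚ.- c) ∣} {C ℚ.* δ}
          (product-bound {B} {δ} 0<B a (b ℚ.- d) ∣a∣≤B b~d)
          (product-bound {C} {δ} 0<C d (a ℚ.- c) ∣d∣≤C a~c)))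

  divide-up : ∀ {B C ε} → 0ℚ ℚ.< B → 0ℚ ℚ.< C → 0ℚ ℚ.< ε →
    ∃[ δ ] (0ℚ ℚ.< δ × B ℚ.* δ ℚ.+ C ℚ.* δ ≡ ε)
  divide-up {B} {C} {ε} 0<B 0<C 0<ε = ℚ.1/ S ℚ.* ε
    , subst (ℚ._< ℚ.1/ S ℚ.* ε) (ℚ.*-zeroʳ (ℚ.1/ S))
        (ℚ.*-monoʳ-<-pos (ℚ.1/ S) {{ℚ.1/pos⇒pos S}} 0<ε)
    , trans (sym (ℚ.*-distribʳ-+ (ℚ.1/ S ℚ.* ε) B C))
        (trans (sym (ℚ.*-assoc S (ℚ.1/ S) ε))
          (trans (cong (ℚ._* ε) (ℚ.*-inverseʳ S)) (ℚ.*-identityˡ ε)))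
    where
    S : ℚ
    S = B ℚ.+ C

    instance
      S⁺ : ℚ.Positive S
      S⁺ = ℚ.positive (ℚ.+-mono-< 0<B 0<C)

      S≢0 : ℚ.NonZero S
      S≢0 = ℚ.pos⇒nonZero S

  -- Projections instead of with: with-abstraction would normalise ℚ._*_ in the goal.
  *-cauchy : ∀ {x y} → Cauchy x → Cauchy y → Cauchy (λ n → x n ℚ.* y n)
  *-cauchy {x} {y} cx cy ε 0<ε = (K ℕ.⊔ L) ℕ.⊔ (M ℕ.⊔ N) , close
    where
    bounded-x : ∃[ B ] (0ℚ ℚ.< B × ∃[ N ] (∀ n → N ℕ.≤ n → ℚ.∣ x n ∣ ℚ.≤ B))
    bounded-x = eventually-bounded {x} cx

    bounded-y : ∃[ B ] (0ℚ ℚ.< B × ∃[ N ] (∀ n → N ℕ.≤ n → ℚ.∣ y n ∣ ℚ.≤ B))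
    bounded-y = eventually-bounded {y} cy

    B C : ℚ
    B = proj₁ bounded-x
    C = proj₁ bounded-y

    K L : ℕ
    K = proj₁ (proj₂ (proj₂ bounded-x))
    L = proj₁ (proj₂ (proj₂ bounded-y))

    divided : ∃[ δ ] (0ℚ ℚ.< δ × B ℚ.* δ ℚ.+ C ℚ.* δ ≡ ε)
    divided = divide-up {B} {C} {ε} (proj₁ (proj₂ bounded-x)) (proj₁ (proj₂ bounded-y)) 0<ε

    δ : ℚ
    δ = proj₁ divided

    0<δ : 0ℚ ℚ.< δ
    0<δ = proj₁ (proj₂ divided)

    M N : ℕ
    M = proj₁ (cx δ 0<δ)
    N = proj₁ (cy δ 0<δ)

    close : ∀ m n → (K ℕ.⊔ L) ℕ.⊔ (M ℕ.⊔ N) ℕ.≤ m → (K ℕ.⊔ L) ℕ.⊔ (M ℕ.⊔ N) ℕ.≤ n →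
      ℚ.∣ x m ℚ.* y m ℚ.- x n ℚ.* y n ∣ ℚ.< ε
    close m n p q = product-close {B} {C} {δ} {ε}
      (proj₁ (proj₂ bounded-x)) (proj₁ (proj₂ bounded-y)) (proj₂ (proj₂ divided))
      (x m) (y m) (x n) (y n)
      (proj₂ (proj₂ (proj₂ bounded-x)) m (ℕ.m⊔n≤o⇒m≤o K L p₁))
      (proj₂ (proj₂ (proj₂ bounded-y)) n (ℕ.m⊔n≤o⇒n≤o K L q₁))
      (proj₂ (cx δ 0<δ) m n (ℕ.m⊔n≤o⇒m≤o M N p₂) (ℕ.m⊔n≤o⇒m≤o M N q₂))
      (proj₂ (cy δ 0<δ) m n (ℕ.m⊔n≤o⇒n≤o M N p₂) (ℕ.m⊔n≤o⇒n≤o M N q₂))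
      where
      p₁ = ℕ.m⊔n≤o⇒m≤o (K ℕ.⊔ L) (M ℕ.⊔ N) p
      p₂ = ℕ.m⊔n≤o⇒n≤o (K ℕ.⊔ L) (M ℕ.⊔ N) p
      q₁ = ℕ.m⊔n≤o⇒m≤o (K ℕ.⊔ L) (M ℕ.⊔ N) q
      q₂ = ℕ.m⊔n≤o⇒n≤o (K ℕ.⊔ L) (M ℕ.⊔ N) q

record ℝ : Set where
  constructor mkℝ
  field
    seq    : ℕ → ℚ
    cauchy : Cauchy seq

open ℝ public

infix  4 _≈ℝ_ _<ℝ_
infixl 6 _+ℝ_ _-ℝ_
infixl 7 _*ℝ_
infix  8 -ℝ_

_≈ℝ_ : ℝ → ℝ → Set
x ≈ℝ y = ∀ ε → 0ℚ ℚ.< ε → ∃[ N ] (∀ n → N ℕ.≤ n → ℚ.∣ seq x n ℚ.- seq y n ∣ ℚ.< ε)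

_<ℝ_ : ℝ → ℝ → Set
x <ℝ y = ∃[ ε ] (0ℚ ℚ.< ε × ∃[ N ] (∀ n → N ℕ.≤ n → seq x n ℚ.+ ε ℚ.< seq y n))

fromℚ : ℚ → ℝ
fromℚ q = mkℝ (λ _ → q) (const-cauchy q)

0ℝ 1ℝ : ℝ
0ℝ = fromℚ 0ℚ
1ℝ = fromℚ 1ℚ

_+ℝ_ : ℝ → ℝ → ℝ
mkℝ x cx +ℝ mkℝ y cy = mkℝ (λ n → x n ℚ.+ y n) (+-cauchy {x} {y} cx cy)

_*ℝ_ : ℝ → ℝ → ℝ
mkℝ x cx *ℝ mkℝ y cy = mkℝ (λ n → x n ℚ.* y n) (*-cauchy {x} {y} cx cy)

-ℝ_ : ℝ → ℝ
-ℝ mkℝ x cx = mkℝ (λ n → ℚ.- x n) (neg-cauchy {x} cx)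

_-ℝ_ : ℝ → ℝ → ℝ
x -ℝ y = x +ℝ (-ℝ y)

------------------------------------------------------------------------
-- Complex numbers

record ℂ : Set where
  constructor _+i_
  field
    re : ℝ
    im : ℝ

open ℂ public

infix  4 _≈_
infix  5 _+i_
infixl 6 _+_ _-_
infixl 7 _*_

_≈_ : ℂ → ℂ → Set
z ≈ w = re z ≈ℝ re w × im z ≈ℝ im w

_+_ _-_ _*_ : ℂ → ℂ → ℂ
z + w = (re z +ℝ re w) +i (im z +ℝ im w)
z - w = (re z -ℝ re w) +i (im z -ℝ im w)
z * w = (re z *ℝ re w -ℝ im z *ℝ im w) +i (re z *ℝ im w +ℝ im z *ℝ re w)

ℝ→ℂ : ℝ → ℂ
ℝ→ℂ x = x +i 0ℝ

ℚ→ℂ : ℚ → ℂ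
ℚ→ℂ q = ℝ→ℂ (fromℚ q)

ℤ→ℚ : ℤ → ℚ
ℤ→ℚ k = k / 1

0ℂ 1ℂ : ℂ
0ℂ = ℚ→ℂ 0ℚ
1ℂ = ℚ→ℂ 1ℚ

sumℂ productℂ : ∀ {n} → Vec ℂ n → ℂ
sumℂ     = Vec.foldr _ _+_ 0ℂ
productℂ = Vec.foldr _ _*_ 1ℂ

-- |z| < 1, written as |z|² < 1 to avoid the square root.
InOpenUnitDisc : ℂ → Set
InOpenUnitDisc z = re z *ℝ re z +ℝ im z *ℝ im z <ℝ 1ℝ

------------------------------------------------------------------------
-- Monic polynomials

-- c₀ ∷ c₁ ∷ … ∷ c_{d-1} ∷ [] stands for c₀ + c₁ X + … + c_{d-1} X^{d-1} + X^d;
-- the leading coefficient 1 is not stored, so d is exactly the degree.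
Monic : Set → ℕ → Set
Monic A d = Vec A d

eval : ∀ {d} → Monic ℚ d → ℂ → ℂ
eval []      z = 1ℂ
eval (c ∷ p) z = ℚ→ℂ c + z * eval p z

-- zs lists the zeros of p with multiplicity: p = ∏ (X − zᵢ).
ZerosOf : ∀ {d} → Monic ℚ d → Vec ℂ d → Set
ZerosOf p zs = ∀ w → eval p w ≈ productℂ (Vec.map (λ z → w - z) zs)

------------------------------------------------------------------------
-- Algebraic integers, conjugates, degree, trace

IsAlgebraicInteger : ℂ → Set
IsAlgebraicInteger α = ∃[ d ] Σ (Monic ℤ d) λ p → eval (Vec.map ℤ→ℚ p) α ≈ 0ℂ

IsMinimalPolynomial : ∀ {d} → ℂ → Monic ℚ d → Set
IsMinimalPolynomial {d} α p =
  eval p α ≈ 0ℂ × (∀ {e} (q : Monic ℚ e) → eval q α ≈ 0ℂ → d ℕ.≤ e)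

IsConjugate : ℂ → ℂ → Set
IsConjugate α z = ∃[ d ] Σ (Monic ℚ d) λ p → IsMinimalPolynomial α p × eval p z ≈ 0ℂ

HasDegree : ℂ → ℕ → Set
HasDegree α d = Σ (Monic ℚ d) λ p → IsMinimalPolynomial α p

-- By the fundamental theorem of algebra the minimal polynomial has a list zs of
-- zeros, unique up to order, so quantifying over zs just names "the zeros".
HasTrace : ℂ → ℂ → Set
HasTrace α t = ∃[ d ] Σ (Monic ℚ d) λ p →
  IsMinimalPolynomial α p × (∀ zs → ZerosOf p zs → sumℂ zs ≈ t)

IsPisot : ℝ → Set
IsPisot α =
    IsAlgebraicInteger (ℝ→ℂ α)
  × 1ℝ <ℝ α
  × (∀ z → IsConjugate (ℝ→ℂ α) z → ¬ (z ≈ ℝ→ℂ α) → InOpenUnitDisc z)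

------------------------------------------------------------------------
-- The sequence of primes

record NextPrime (n p : ℕ) : Set where
  field
    greater : n ℕ.< p
    isPrime : Prime p
    least   : ∀ {q} → n ℕ.< q → Prime q → p ℕ.≤ q

private

  prime-above : ∀ n → ∃[ p ] (n ℕ.< p × Prime p)
  prime-above n with factorise (suc (n !))
  ... | record { factors = [] ; isFactorisation = eq } =
    contradiction (ℕ.suc-injective eq) (ℕ.m<n⇒n≢0 (ℕ.1≤n! n))
  ... | record { factors = zero ∷ _ ; factorsPrime = pr ∷ _ } =
    contradiction pr ¬prime[0]
  ... | record { factors = p@(suc k) ∷ ps ; isFactorisation = eq ; factorsPrime = pr ∷ _ } =
    p , ℕ.≰⇒> p≰n , pr
    where
    p∣1+n! : p ∣ n ! ℕ.+ 1
    p∣1+n! = subst (p ∣_) (trans (sym eq) (ℕ.+-comm 1 (n !))) (m∣m*n (product ps))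

    p≰n : ¬ (p ℕ.≤ n)
    p≰n p≤n = ¬prime[1] (subst Prime (∣1⇒≡1 p∣1) pr)
      where
      p∣1 : p ∣ 1
      p∣1 = ∣m+n∣m⇒∣n p∣1+n! (∣-trans (m∣m*n (k !)) (m≤n⇒m!∣n! p≤n))

  search : ∀ n k → Prime (k ℕ.+ suc n) → ∃ (NextPrime n)
  search n zero    pr = suc n , record
    { greater = ℕ.n<1+n n ; isPrime = pr ; least = λ n<q _ → n<q }
  search n (suc k) pr with prime? (suc n)
  ... | yes pr′ = suc n , record
    { greater = ℕ.n<1+n n ; isPrime = pr′ ; least = λ n<q _ → n<q }
  ... | no ¬pr with search (suc n) k (subst Prime (sym (ℕ.+-suc k (suc n))) pr)
  ... | p , next = p , record
    { greater = ℕ.<-trans (ℕ.n<1+n n) (NextPrime.greater next)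
    ; isPrime = NextPrime.isPrime next
    ; least   = λ n<q prq → NextPrime.least next
        (ℕ.≤∧≢⇒< n<q (λ { refl → ¬pr prq })) prq
    }

nextPrime : ∀ n → ∃ (NextPrime n)
nextPrime n with prime-above n
... | p , n<p , pr = search n (p ℕ.∸ suc n) (subst Prime (sym (ℕ.m∸n+n≡m n<p)) pr)

-- Zero-based: nthPrime 0 ≡ 2.
nthPrime : ℕ → ℕ
nthPrime zero    = proj₁ (nextPrime 0)
nthPrime (suc n) = proj₁ (nextPrime (nthPrime n))

sumOfFirstPrimes : ℕ → ℕ
sumOfFirstPrimes k = sum (map nthPrime (upTo k))

{-# OPTIONS --safe #-}
module Submission where

-- Let p run through the first k = 2T + 4 primes, let M = T + 3 and [p] = 1 + z + ⋯ + z^(p−1).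
-- The polynomial P = (z − 1)(z − M) ∏ [p] − ∑_p ∏_{q≠p} [q] is monic of degree
-- 2 + ∑ (p − 1) and trace M + 1 − k = −T, and it changes sign between M and M + 1, where it
-- has a root α. For a sequence u with P(S) u = 0, S being the shift, put
-- x = (S − 1) ∏ [p](S) u and y_p = ∏_{q≠p} [q](S) u. Then y_p(n + p) = y_p(n) + x(n) and
-- x(n + 1) = M x(n) + ∑ y_p(n), so that, as k + 2 = 2M, the Lyapunov function
-- V(n) = ∑_p ∑_{j<p} y_p(n + j)² − x(n)² satisfies V(n + 1) = V(n) − (x(n + 1) − x(n))².
-- Moreover V ≥ 0 for solutions without a component along αⁿ. For u(n) = zⁿ, where z ≠ α is
-- a zero of P, this gives (1 − |z|²) V(0) = |z − 1|² |x(0)|² > 0, hence |z| < 1. For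
-- u = q(S) w, where q(α) = 0 and w is an integer solution, it gives (after clearing
-- denominators) a non-increasing sequence V of natural numbers; once V is constant so is x,
-- and then u = 0 because the primes are coprime. So no q of degree less than deg P kills α.

open import Algebra.Bundles using (CommutativeRing)
open import Algebra.Bundles.Raw using (RawRing)
import Algebra.Solver.Ring
open import Algebra.Solver.Ring.AlmostCommutativeRing
  using (fromCommutativeRing; _-Raw-AlmostCommutative⟶_)
open import Algebra.Structures using (IsCommutativeRing)
open import Data.Empty using (⊥)
open import Data.Integer.Base as ℤ using (ℤ; +_; -[1+_])
import Data.Integer.Properties as ℤ
open import Data.Integer.Solver using (module +-*-Solver)
open import Data.List.Base as List using (List; []; _∷_; length; upTo)
import Data.List.Properties as List
open import Data.List.Relation.Unary.All as All using (All; []; _∷_)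
import Data.List.Relation.Unary.All.Properties as All
open import Data.List.Relation.Unary.AllPairs using (AllPairs; []; _∷_)
import Data.List.Relation.Unary.AllPairs.Properties as AllPairs
open import Data.Maybe.Base using (Maybe; just; nothing)
open import Data.Nat.Base as ℕ using (ℕ; zero; suc; z≤n; s≤s; _≤_)
open import Data.Nat.Coprimality as Coprimality using (Coprime; coprime-Bézout; prime⇒coprime)
open import Data.Nat.GCD using (module Bézout)
open import Data.Nat.ListAction using (sum)
open import Data.Nat.Primality using (Prime; prime⇒nonTrivial)
import Data.Nat.Properties as ℕ
import Data.Nat.Solver as ℕSolver
open import Data.Product.Base using (Σ; ∃-syntax; _×_; _,_; proj₁; proj₂)
open import Data.Rational.Base as ℚ using (ℚ; 0ℚ; 1ℚ; ½; mkℚ; toℚᵘ)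
import Data.Rational.Properties as ℚ
open import Data.Rational.Unnormalised.Base as ℚᵘ using (mkℚᵘ; *≡*)
import Data.Rational.Unnormalised.Properties as ℚᵘ
open import Data.Sum.Base using (_⊎_; inj₁; inj₂)
open import Data.Vec.Base as Vec using (Vec; []; _∷_)
open import Function.Base using (_∘_; id)
open import Level using (0ℓ)
open import Relation.Binary.PropositionalEquality as ≡ using (_≡_; _≢_)
import Relation.Binary.Reasoning.Setoid
open import Relation.Binary.Structures using (IsEquivalence)
open import Relation.Nullary using (¬_; Dec; yes; no; contradiction)
open import Relation.Nullary.Decidable using (decidable-stable)

-- Since (z - 1)[p] = z^p - 1, the equation P(z) = 0 is z - M = ∑ 1/(z^p - 1) with the denominators
-- cleared, and y_p is x divided by S^p - 1. The change of V is a negative perfect square precisely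
-- when k + 2 = 2M; with M + 1 - k = -T this forces M = T + 3 and k = 2T + 4. A common factor of [p]
-- and [q] would divide P and put zeros on the unit circle, so the p are pairwise coprime, and the
-- first k primes are the choice with the smallest sum.
--
-- V has a single minus sign, so V ≥ 0 away from the expanding direction is a Cauchy-Schwarz
-- inequality; an explicit sum of squares proves it. Minimality of P would usually come from the
-- norm of a factor, a product over all its zeros; the descent on V needs no zero other than α.
-- Signs and equalities of real numbers cannot be decided, so inequalities first appear as
-- identities over an arbitrary commutative ring, which are then read in ℤ, ℚ, ℝ or ℂ, and
-- positivity is carried by an explicit lower bound.

record ℤ-Algebra : Set₁ where
  field
    commutativeRing : CommutativeRing 0ℓ 0ℓ
  open CommutativeRing commutativeRing public
  field
    ι      : ℤ → Carrier
    ι-+    : ∀ i j → ι (i ℤ.+ j) ≈ ι i + ι j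
    ι-*    : ∀ i j → ι (i ℤ.* j) ≈ ι i * ι j
    ι-neg  : ∀ i → ι (ℤ.- i) ≈ - ι i
    ι-0    : ι (+ 0) ≈ 0#
    ι-1    : ι (+ 1) ≈ 1#

-- Sequences over a commutative ring

-- Coefficients are normalised in ℤ, where equality is decidable; constants of ℝ or ℂ could not be
-- compared.
module IntegerSolver (A : ℤ-Algebra) where
  open ℤ-Algebra A

  private
    ℤ-rawRing : RawRing 0ℓ 0ℓ
    ℤ-rawRing = record
      { Carrier = ℤ ; _≈_ = _≡_ ; _+_ = ℤ._+_ ; _*_ = ℤ._*_
      ; -_ = ℤ.-_ ; 0# = + 0 ; 1# = + 1 }

    -- Agrees with ι, but gives the constants 0 and 1 of the solver their usual form.
    κ : ℤ → Carrier
    κ (+ 0)         = 0#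
    κ (+ 1)         = 1#
    κ i             = ι i

    κ≈ι : ∀ i → κ i ≈ ι i
    κ≈ι (+ 0)           = sym ι-0
    κ≈ι (+ 1)           = sym ι-1
    κ≈ι (+ suc (suc _)) = refl
    κ≈ι -[1+ _ ]        = refl

    κ-morphism : ℤ-rawRing -Raw-AlmostCommutative⟶ fromCommutativeRing commutativeRing
    κ-morphism = record
      { ⟦_⟧    = κ
      ; +-homo = λ i j → trans (κ≈ι (i ℤ.+ j))
          (trans (ι-+ i j) (sym (+-cong (κ≈ι i) (κ≈ι j))))
      ; *-homo = λ i j → trans (κ≈ι (i ℤ.* j))
          (trans (ι-* i j) (sym (*-cong (κ≈ι i) (κ≈ι j))))
      ; -‿homo = λ i → trans (κ≈ι (ℤ.- i)) (trans (ι-neg i) (sym (-‿cong (κ≈ι i))))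
      ; 0-homo = refl
      ; 1-homo = refl
      }

    κ-decide : ∀ i j → Maybe (κ i ≈ κ j)
    κ-decide i j with i ℤ.≟ j
    ... | yes eq = just (reflexive (≡.cong κ eq))
    ... | no _   = nothing

  open Algebra.Solver.Ring ℤ-rawRing (fromCommutativeRing commutativeRing) κ-morphism
    κ-decide public

  :0 :1 :2 : ∀ {n} → Polynomial n
  :0 = con (+ 0)
  :1 = con (+ 1)
  :2 = con (+ 2)

module Shift (A : ℤ-Algebra) where
  open ℤ-Algebra A
  open IntegerSolver A
  open Relation.Binary.Reasoning.Setoid setoid

  Seq : Set
  Seq = ℕ → Carrier

  infix 4 _≋_
  _≋_ : Seq → Seq → Set
  u ≋ v = ∀ n → u n ≈ v n

  -- Linearity and commutation with the shift are what carries geometric sequences to geometric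
  -- ones, and what lets an operator commute with `geo` and `act` without any multiplication of
  -- polynomials.
  record Linear (O : Seq → Seq) : Set where
    field
      resp  : ∀ {u v} → u ≋ v → O u ≋ O v
      add   : ∀ u v → O (λ n → u n + v n) ≋ (λ n → O u n + O v n)
      scale : ∀ c u → O (λ n → c * u n) ≋ (λ n → c * O u n)
      shift : ∀ u → O (u ∘ suc) ≋ O u ∘ suc

    null : ∀ {u} → (∀ n → u n ≈ 0#) → ∀ n → O u n ≈ 0#
    null {u} u≈0 n = begin
      O u n                 ≈⟨ resp (λ m → trans (u≈0 m) (sym (zeroˡ (u m)))) n ⟩
      O (λ m → 0# * u m) n  ≈⟨ scale 0# u n ⟩
      0# * O u n            ≈⟨ zeroˡ _ ⟩
      0#                    ∎

    combine : ∀ c d u v → O (λ n → c * u n + d * v n) ≋ (λ n → c * O u n + d * O v n)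
    combine c d u v n = trans (add _ _ n) (+-cong (scale c u n) (scale d v n))

  open Linear public

  ∘-linear : ∀ {O O′} → Linear O → Linear O′ → Linear (O ∘ O′)
  ∘-linear l l′ = record
    { resp  = λ u≋v → resp l (resp l′ u≋v)
    ; add   = λ u v n → trans (resp l (add l′ u v) n) (add l _ _ n)
    ; scale = λ c u n → trans (resp l (scale l′ c u) n) (scale l c _ n)
    ; shift = λ u n → trans (resp l (shift l′ u) n) (shift l _ n)
    }

  +-linear : ∀ {O O′} → Linear O → Linear O′ → Linear (λ u n → O u n + O′ u n)
  +-linear l l′ = record
    { resp  = λ u≋v n → +-cong (resp l u≋v n) (resp l′ u≋v n)
    ; add   = λ u v n → trans (+-cong (add l u v n) (add l′ u v n))
        (solve 4 (λ a b c d → (a :+ b) :+ (c :+ d) := (a :+ c) :+ (b :+ d)) refl _ _ _ _)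
    ; scale = λ c u n → trans (+-cong (scale l c u n) (scale l′ c u n)) (sym (distribˡ c _ _))
    ; shift = λ u n → +-cong (shift l u n) (shift l′ u n)
    }

  *-linear : ∀ {O} c → Linear O → Linear (λ u n → c * O u n)
  *-linear c l = record
    { resp  = λ u≋v n → *-congˡ (resp l u≋v n)
    ; add   = λ u v n → trans (*-congˡ (add l u v n)) (distribˡ c _ _)
    ; scale = λ d u n → trans (*-congˡ (scale l d u n))
        (solve 3 (λ c d a → c :* (d :* a) := d :* (c :* a)) refl c d _)
    ; shift = λ u n → *-congˡ (shift l u n)
    }

  −-linear : ∀ {O O′} → Linear O → Linear O′ → Linear (λ u n → O u n - O′ u n)
  −-linear l l′ = record
    { resp  = λ u≋v n → +-cong (resp l u≋v n) (-‿cong (resp l′ u≋v n))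
    ; add   = λ u v n → trans (+-cong (add l u v n) (-‿cong (add l′ u v n)))
        (solve 4 (λ a b c d → (a :+ b) :- (c :+ d) := (a :- c) :+ (b :- d)) refl _ _ _ _)
    ; scale = λ c u n → trans (+-cong (scale l c u n) (-‿cong (scale l′ c u n)))
        (solve 3 (λ c a b → c :* a :- c :* b := c :* (a :- b)) refl c _ _)
    ; shift = λ u n → +-cong (shift l u n) (-‿cong (shift l′ u n))
    }

  id-linear : Linear (λ u → u)
  id-linear = record
    { resp = λ u≋v → u≋v ; add = λ _ _ _ → refl ; scale = λ _ _ _ → refl ; shift = λ _ _ → refl }

  0-linear : Linear (λ _ _ → 0#)
  0-linear = record
    { resp = λ _ _ → refl ; add = λ _ _ _ → sym (+-identityˡ 0#)
    ; scale = λ c _ _ → sym (zeroʳ c) ; shift = λ _ _ → refl }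

  suc-linear : Linear (_∘ suc)
  suc-linear = record
    { resp = λ u≋v n → u≋v (suc n) ; add = λ _ _ _ → refl
    ; scale = λ _ _ _ → refl ; shift = λ _ _ → refl }

  -- The leading coefficient t is separate: it is 1 for monic polynomials, and a common denominator
  -- N once a rational polynomial has been cleared of fractions.
  act : ∀ {d} → Vec Carrier d → Carrier → Seq → Seq
  act []      t u n = t * u n
  act (c ∷ p) t u n = c * u n + act p t u (suc n)

  act-linear : ∀ {d} (p : Vec Carrier d) t → Linear (act p t)
  act-linear []      t = *-linear t id-linear
  act-linear (c ∷ p) t = +-linear (*-linear c id-linear) (∘-linear suc-linear (act-linear p t))

  -- Window sums: `geo p` is the action of 1 + S + ⋯ + S^(p−1), S being the shift.
  geo : ℕ → Seq → Seq
  geo zero    u n = 0#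
  geo (suc p) u n = u n + geo p u (suc n)

  geo-linear : ∀ p → Linear (geo p)
  geo-linear zero    = 0-linear
  geo-linear (suc p) = +-linear id-linear (∘-linear suc-linear (geo-linear p))

  linear-geo : ∀ {O} → Linear O → ∀ p u → O (geo p u) ≋ geo p (O u)
  linear-geo l zero    u n = null l (λ _ → refl) n
  linear-geo l (suc p) u n = begin
    _ ≈⟨ add l u (geo p u ∘ suc) n ⟩
    _ ≈⟨ +-congˡ (trans (shift l (geo p u) n) (linear-geo l p u (suc n))) ⟩
    _ ∎

  linear-act : ∀ {O} → Linear O → ∀ {d} (p : Vec Carrier d) t u → O (act p t u) ≋ act p t (O u)
  linear-act l []      t u n = scale l t u n
  linear-act l (c ∷ p) t u n = begin
    _ ≈⟨ add l (λ m → c * u m) (act p t u ∘ suc) n ⟩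
    _ ≈⟨ +-cong (scale l c u n) (trans (shift l (act p t u) n) (linear-act l p t u (suc n))) ⟩
    _ ∎

  -- This is S^p - 1 = (S - 1)[p], arranged without subtraction.
  geo-telescope : ∀ p u n → u (p ℕ.+ n) + geo p u n ≈ u n + geo p u (suc n)
  geo-telescope zero    u n = refl
  geo-telescope (suc p) u n = begin
    u (suc p ℕ.+ n) + (u n + geo p u (suc n))
      ≡⟨ ≡.cong (λ m → u m + (u n + geo p u (suc n))) (≡.sym (ℕ.+-suc p n)) ⟩
    u (p ℕ.+ suc n) + (u n + geo p u (suc n))
      ≈⟨ solve 3 (λ a b c → a :+ (b :+ c) := b :+ (a :+ c)) refl _ _ _ ⟩
    u n + (u (p ℕ.+ suc n) + geo p u (suc n))
      ≈⟨ +-congˡ (geo-telescope p u (suc n)) ⟩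
    u n + (u (suc n) + geo p u (suc (suc n))) ∎

  geo-snoc : ∀ p u n → geo (suc p) u n ≈ geo p u n + u (p ℕ.+ n)
  geo-snoc p u n = trans (sym (geo-telescope p u n)) (+-comm _ _)

  -- For a list p₁, …, p_k: `prod` is the action of ∏ [pᵢ], `cofactors` that of
  -- ∑ᵢ ∏_{j≠i} [pⱼ], and `diff` that of (S − 1) ∏ [pᵢ], where [p] = 1 + S + ⋯ + S^(p−1).
  prod : List ℕ → Seq → Seq
  prod []       u = u
  prod (p ∷ ps) u = prod ps (geo p u)

  cofactors : List ℕ → Seq → Seq
  cofactors []       u n = 0#
  cofactors (p ∷ ps) u n = prod ps u n + cofactors ps (geo p u) n

  diff : List ℕ → Seq → Seq
  diff ps u n = prod ps u (suc n) - prod ps u n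

  prod-linear : ∀ ps → Linear (prod ps)
  prod-linear []       = id-linear
  prod-linear (p ∷ ps) = ∘-linear (prod-linear ps) (geo-linear p)

  cofactors-linear : ∀ ps → Linear (cofactors ps)
  cofactors-linear []       = 0-linear
  cofactors-linear (p ∷ ps) =
    +-linear (prod-linear ps) (∘-linear (cofactors-linear ps) (geo-linear p))

  diff-linear : ∀ ps → Linear (diff ps)
  diff-linear ps =
    −-linear (∘-linear suc-linear (prod-linear ps)) (prod-linear ps)

  -- For the head p of the list, `prod ps u` is y_p and `diff (p ∷ ps) u` is x, so this is the
  -- relation y_p(n + p) = y_p(n) + x(n).
  diff-∷ : ∀ p ps u n → prod ps u (p ℕ.+ n) ≈ prod ps u n + diff (p ∷ ps) u n
  diff-∷ p ps u n = begin
    y (p ℕ.+ n)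
      ≈⟨ solve 2 (λ a b → a := (a :+ b) :- b) refl _ _ ⟩
    (y (p ℕ.+ n) + geo p y n) - geo p y n
      ≈⟨ +-congʳ (geo-telescope p y n) ⟩
    (y n + geo p y (suc n)) - geo p y n
      ≈⟨ +-assoc _ _ _ ⟩
    y n + (geo p y (suc n) - geo p y n)
      ≈⟨ +-congˡ (+-cong (sym (eq (suc n))) (-‿cong (sym (eq n)))) ⟩
    y n + diff (p ∷ ps) u n ∎
    where
    y = prod ps u
    eq = linear-geo (prod-linear ps) p u

  -- The energy, its change under the shift, and the pairing of two sequences

  square : Seq → Seq
  square u n = u n * u n

  -- Handing `geo p u` to the tail restores the factor [p] in every later cofactor, so that each
  -- prime q of the list contributes its window ∑_{j<q} y_q(n + j)².
  energy : List ℕ → Seq → Seq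
  energy []       u n = 0#
  energy (p ∷ ps) u n = geo p (square (prod ps u)) n + energy ps (geo p u) n

  -- Each cofactor sequence y satisfies y (n + p) = y n + diff ps u n, so that its
  -- window of squares changes by (y + diff)² − y².
  energy-step : ∀ ps u n → energy ps u (suc n) ≈
    energy ps u n + (ι (+ 2) * (diff ps u n * cofactors ps u n)
                    + ι (+ length ps) * square (diff ps u) n)
  energy-step [] u n = begin
    0#
      ≈⟨ solve 1 (λ x → :0 :=
           :0 :+ (:2 :* (x :* :0) :+ :0 :* (x :* x))) refl x ⟩
    0# + (ι (+ 2) * (x * 0#) + 0# * (x * x))
      ≈⟨ +-congˡ (+-congˡ (*-congʳ (sym ι-0))) ⟩
    0# + (ι (+ 2) * (x * 0#) + ι (+ 0) * (x * x)) ∎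
    where x = diff [] u n
  energy-step (p ∷ ps) u n = begin
    geo p (square y) (suc n) + energy ps v (suc n)
      ≈⟨ solve 3 (λ a b c → a :+ b := ((c :+ a) :- c) :+ b) refl _ _ (square y n) ⟩
    ((square y n + geo p (square y) (suc n)) - square y n) + energy ps v (suc n)
      ≈⟨ +-cong (+-congʳ (sym (geo-telescope p (square y) n))) (energy-step ps v n) ⟩
    ((square y (p ℕ.+ n) + geo p (square y) n) - square y n)
      + (energy ps v n + (ι (+ 2) * (x * b) + k * (x * x)))
      ≈⟨ +-congʳ (+-congʳ (+-congʳ (*-cong (diff-∷ p ps u n) (diff-∷ p ps u n)))) ⟩
    (((y n + x) * (y n + x) + geo p (square y) n) - square y n)
      + (energy ps v n + (ι (+ 2) * (x * b) + k * (x * x)))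
      ≈⟨ solve 6 (λ y x e e′ b k →
           (((y :+ x) :* (y :+ x) :+ e) :- y :* y)
             :+ (e′ :+ (:2 :* (x :* b) :+ k :* (x :* x)))
           := (e :+ e′) :+ (:2 :* (x :* (y :+ b)) :+ (:1 :+ k) :* (x :* x)))
           refl (y n) x _ _ b k ⟩
    (geo p (square y) n + energy ps v n)
      + (ι (+ 2) * (x * (y n + b)) + (1# + k) * (x * x))
      ≈⟨ +-congˡ (+-congˡ (*-congʳ (trans (+-congʳ (sym ι-1)) (sym (ι-+ (+ 1) (+ length ps)))))) ⟩
    (geo p (square y) n + energy ps v n)
      + (ι (+ 2) * (x * (y n + b)) + ι (+ suc (length ps)) * (x * x)) ∎
    where
    v = geo p u
    y = prod ps u
    x = diff (p ∷ ps) u n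
    b = cofactors ps v n
    k = ι (+ length ps)

  -- convolve p u₀ u n = ∑_{j<p} u₀ (p − 1 − j) · u (n + j)
  convolve : ℕ → Seq → Seq → Seq
  convolve zero    u₀ u n = 0#
  convolve (suc p) u₀ u n = u₀ p * u n + convolve p u₀ u (suc n)

  convolve-linear : ∀ p u₀ → Linear (convolve p u₀)
  convolve-linear zero    u₀ = 0-linear
  convolve-linear (suc p) u₀ =
    +-linear (*-linear (u₀ p) id-linear) (∘-linear suc-linear (convolve-linear p u₀))

  Geometric : Carrier → Seq → Set
  Geometric a u = ∀ n → u (suc n) ≈ a * u n

  linear-geometric : ∀ {O a u} → Linear O → Geometric a u → Geometric a (O u)
  linear-geometric {a = a} {u} l g n =
    trans (sym (shift l u n)) (trans (resp l g n) (scale l a u n))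

  -- Multiplication by a raises the index of u₀ by one, so both sides equal the longer sum ∑_{j≤p}
  -- u₀(p - j) u(n + j): the left one splits off j = 0, the right one j = p.
  convolve-step : ∀ {a u₀} → Geometric a u₀ → ∀ p u n →
    convolve p u₀ u (suc n) + u₀ p * u n ≈ a * convolve p u₀ u n + u₀ 0 * u (p ℕ.+ n)
  convolve-step {a} {u₀} g zero u n =
    solve 3 (λ a u₀ u → :0 :+ u₀ :* u := a :* :0 :+ u₀ :* u) refl a _ _
  convolve-step {a} {u₀} g (suc p) u n = begin
    (u₀ p * u (suc n) + convolve p u₀ u (suc (suc n))) + u₀ (suc p) * u n
      ≈⟨ +-cong (+-comm _ _) (*-congʳ (g p)) ⟩
    (convolve p u₀ u (suc (suc n)) + u₀ p * u (suc n)) + a * u₀ p * u n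
      ≈⟨ +-congʳ (convolve-step g p u (suc n)) ⟩
    (a * convolve p u₀ u (suc n) + u₀ 0 * u (p ℕ.+ suc n)) + a * u₀ p * u n
      ≡⟨ ≡.cong (λ m → (a * convolve p u₀ u (suc n) + u₀ 0 * u m) + a * u₀ p * u n) (ℕ.+-suc p n) ⟩
    (a * convolve p u₀ u (suc n) + u₀ 0 * u (suc p ℕ.+ n)) + a * u₀ p * u n
      ≈⟨ solve 5 (λ a c e w x → (a :* c :+ e) :+ a :* w :* x := a :* (w :* x :+ c) :+ e)
           refl a _ _ _ _ ⟩
    a * (u₀ p * u n + convolve p u₀ u (suc n)) + u₀ 0 * u (suc p ℕ.+ n) ∎

  convolves : List ℕ → Seq → Seq → Seq
  convolves []       u₀ u n = 0#
  convolves (p ∷ ps) u₀ u n =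
    convolve p (prod ps u₀) (prod ps u) n + convolves ps (geo p u₀) (geo p u) n

  convolves-linear : ∀ ps u₀ → Linear (convolves ps u₀)
  convolves-linear []       u₀ = 0-linear
  convolves-linear (p ∷ ps) u₀ =
    +-linear (∘-linear (convolve-linear p (prod ps u₀)) (prod-linear ps))
             (∘-linear (convolves-linear ps (geo p u₀)) (geo-linear p))

  -- Sum of `convolve-step` over the list. The boundary values y₀(p) = y₀(0) + x₀ and y(n + p) =
  -- y(n) + x(n) differ from y₀(0) and y(n) by terms independent of p; the products y₀(0) y(n)
  -- cancel, and only the cofactor sums remain.
  convolves-step : ∀ {a u₀} ps → Geometric a u₀ → ∀ u n →
    convolves ps u₀ u (suc n) + diff ps u₀ 0 * cofactors ps u n
      ≈ a * convolves ps u₀ u n + cofactors ps u₀ 0 * diff ps u n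
  convolves-step {a} {u₀} [] g u n =
    solve 3 (λ a x₀ x → :0 :+ x₀ :* :0 := a :* :0 :+ :0 :* x)
      refl a _ _
  convolves-step {a} {u₀} (p ∷ ps) g u n = begin
    (convolve p y₀ y (suc n) + convolves ps v₀ v (suc n)) + x₀ * (y n + cofactors ps v n)
      ≈⟨ solve 6 (λ c d x₀ y y₀ b →
           (c :+ d) :+ x₀ :* (y :+ b)
           := ((c :+ (y₀ :+ x₀) :* y) :- y₀ :* y) :+ (d :+ x₀ :* b)) refl _ _ x₀ (y n) (y₀ 0) _ ⟩
    ((convolve p y₀ y (suc n) + (y₀ 0 + x₀) * y n) - y₀ 0 * y n)
      + (convolves ps v₀ v (suc n) + x₀ * cofactors ps v n)
      ≈⟨ +-cong (+-congʳ (+-congˡ (*-congʳ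
           (trans (sym (diff-∷ p ps u₀ 0)) (reflexive (≡.cong y₀ (ℕ.+-identityʳ p)))))))
           (convolves-step ps (linear-geometric (geo-linear p) g) v n) ⟩
    ((convolve p y₀ y (suc n) + y₀ p * y n) - y₀ 0 * y n)
      + (a * convolves ps v₀ v n + cofactors ps v₀ 0 * x)
      ≈⟨ +-congʳ (+-congʳ (trans (convolve-step (linear-geometric (prod-linear ps) g) p y n)
           (+-congˡ (*-congˡ (diff-∷ p ps u n))))) ⟩
    ((a * convolve p y₀ y n + y₀ 0 * (y n + x)) - y₀ 0 * y n)
      + (a * convolves ps v₀ v n + cofactors ps v₀ 0 * x)
      ≈⟨ solve 7 (λ a c d y₀ y x b₀ →
           ((a :* c :+ y₀ :* (y :+ x)) :- y₀ :* y) :+ (a :* d :+ b₀ :* x)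
           := a :* (c :+ d) :+ (y₀ :+ b₀) :* x) refl a _ _ (y₀ 0) (y n) x _ ⟩
    a * (convolve p y₀ y n + convolves ps v₀ v n) + (y₀ 0 + cofactors ps v₀ 0) * x ∎
    where
    v₀ = geo p u₀
    v  = geo p u
    y₀ = prod ps u₀
    y  = prod ps u
    x₀ = diff (p ∷ ps) u₀ 0
    x  = diff (p ∷ ps) u n

  convolveSquares : ℕ → Carrier → Carrier → Seq → Seq → Seq
  convolveSquares zero    l m u₀ u n = 0#
  convolveSquares (suc p) l m u₀ u n =
    (l * u₀ p + m * u n) * (l * u₀ p + m * u n) + convolveSquares p l m u₀ u (suc n)

  -- In an ordered ring the left side is non-negative for all l and m, so this is Cauchy-Schwarz for
  -- window sums in a form free of division. The window of u₀ is traversed backwards, which does not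
  -- affect its sum of squares.
  convolveSquares-expand : ∀ p l m u₀ u n → convolveSquares p l m u₀ u n ≈
    (l * l) * geo p (square u₀) 0 + (ι (+ 2) * (l * m) * convolve p u₀ u n
      + (m * m) * geo p (square u) n)
  convolveSquares-expand zero l m u₀ u n =
    solve 2 (λ l m → :0 := l :* l :* :0 :+
      (:2 :* (l :* m) :* :0 :+ m :* m :* :0)) refl l m
  convolveSquares-expand (suc p) l m u₀ u n = begin
    (l * u₀ p + m * u n) * (l * u₀ p + m * u n) + convolveSquares p l m u₀ u (suc n)
      ≈⟨ +-congˡ (convolveSquares-expand p l m u₀ u (suc n)) ⟩
    (l * u₀ p + m * u n) * (l * u₀ p + m * u n) +
      ((l * l) * geo p (square u₀) 0 + (ι (+ 2) * (l * m) * convolve p u₀ u (suc n)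
        + (m * m) * geo p (square u) (suc n)))
      ≈⟨ solve 7 (λ l m w x g c h →
           (l :* w :+ m :* x) :* (l :* w :+ m :* x) :+
             (l :* l :* g :+ (:2 :* (l :* m) :* c :+ m :* m :* h))
           := l :* l :* (g :+ w :* w) :+
             (:2 :* (l :* m) :* (w :* x :+ c) :+ m :* m :* (x :* x :+ h)))
           refl l m (u₀ p) (u n) _ _ _ ⟩
    (l * l) * (geo p (square u₀) 0 + square u₀ p) +
      (ι (+ 2) * (l * m) * (u₀ p * u n + convolve p u₀ u (suc n))
        + (m * m) * (square u n + geo p (square u) (suc n)))
      -- `geo` grows at its first term, the backward window of u₀ at its last; `geo-snoc` reconciles
      -- them.
      ≈⟨ +-congʳ (*-congˡ (trans
           (+-congˡ (reflexive (≡.cong (square u₀) (≡.sym (ℕ.+-identityʳ p)))))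
           (sym (geo-snoc p (square u₀) 0)))) ⟩
    (l * l) * geo (suc p) (square u₀) 0 + (ι (+ 2) * (l * m) * convolve (suc p) u₀ u n
      + (m * m) * geo (suc p) (square u) n) ∎

  convolvesSquares : List ℕ → Carrier → Carrier → Seq → Seq → Seq
  convolvesSquares []       l m u₀ u n = 0#
  convolvesSquares (p ∷ ps) l m u₀ u n =
    convolveSquares p l m (prod ps u₀) (prod ps u) n
      + convolvesSquares ps l m (geo p u₀) (geo p u) n

  convolvesSquares-expand : ∀ ps l m u₀ u n → convolvesSquares ps l m u₀ u n ≈
    (l * l) * energy ps u₀ 0 + (ι (+ 2) * (l * m) * convolves ps u₀ u n
      + (m * m) * energy ps u n)
  convolvesSquares-expand [] l m u₀ u n =
    solve 2 (λ l m → :0 := l :* l :* :0 :+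
      (:2 :* (l :* m) :* :0 :+ m :* m :* :0)) refl l m
  convolvesSquares-expand (p ∷ ps) l m u₀ u n = begin
    convolveSquares p l m (prod ps u₀) (prod ps u) n
      + convolvesSquares ps l m (geo p u₀) (geo p u) n
      ≈⟨ +-cong (convolveSquares-expand p l m (prod ps u₀) (prod ps u) n)
                (convolvesSquares-expand ps l m (geo p u₀) (geo p u) n) ⟩
    _ ≈⟨ solve 8 (λ l m g c h g′ c′ h′ →
           (l :* l :* g :+ (:2 :* (l :* m) :* c :+ m :* m :* h)) :+
           (l :* l :* g′ :+ (:2 :* (l :* m) :* c′ :+ m :* m :* h′))
           := l :* l :* (g :+ g′) :+
             (:2 :* (l :* m) :* (c :+ c′) :+ m :* m :* (h :+ h′)))
           refl l m _ _ _ _ _ _ ⟩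
    _ ∎

  -- Solutions of the recurrence: Lyapunov function and component along an eigenvector

  module Recurrence (ps : List ℕ) (M : ℤ) (k+2≡2M : + length ps ℤ.+ + 2 ≡ + 2 ℤ.* M) where

    Recurrent : Seq → Set
    Recurrent u = ∀ n → diff ps u (suc n) ≈ ι M * diff ps u n + cofactors ps u n

    -- Replacing ∑ y_p(n) by x(n + 1) - M x(n) in `energy-step` leaves the coefficient k - 2M = -2
    -- at x(n)²; here the number of primes is tied to M.
    energy-drift : ∀ {u} → Recurrent u → ∀ n →
      energy ps u (suc n) + ι (+ 2) * square (diff ps u) n
        ≈ energy ps u n + ι (+ 2) * (diff ps u n * diff ps u (suc n))
    energy-drift {u} rec n = begin
      energy ps u (suc n) + ι (+ 2) * (x * x)
        ≈⟨ +-congʳ (energy-step ps u n) ⟩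
      (e + (ι (+ 2) * (x * b) + ι (+ length ps) * (x * x))) + ι (+ 2) * (x * x)
        ≈⟨ solve 4 (λ e x b k →
             (e :+ (:2 :* (x :* b) :+ k :* (x :* x))) :+ :2 :* (x :* x)
             := e :+ (:2 :* (x :* b) :+ (k :+ :2) :* (x :* x)))
             refl e x b _ ⟩
      e + (ι (+ 2) * (x * b) + (ι (+ length ps) + ι (+ 2)) * (x * x))
        ≈⟨ +-congˡ (+-congˡ (*-congʳ (trans (sym (ι-+ (+ length ps) (+ 2)))
             (trans (reflexive (≡.cong ι k+2≡2M)) (ι-* (+ 2) M))))) ⟩
      e + (ι (+ 2) * (x * b) + (ι (+ 2) * ι M) * (x * x))
        ≈⟨ solve 4 (λ e x b m →
             e :+ (:2 :* (x :* b) :+ (:2 :* m) :* (x :* x))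
             := e :+ :2 :* (x :* (m :* x :+ b))) refl e x b (ι M) ⟩
      e + ι (+ 2) * (x * (ι M * x + b))
        ≈⟨ +-congˡ (*-congˡ (*-congˡ (sym (rec n)))) ⟩
      e + ι (+ 2) * (x * diff ps u (suc n)) ∎
      where
      x = diff ps u n
      b = cofactors ps u n
      e = energy ps u n

    lyapunov : Seq → Seq
    lyapunov u n = energy ps u n - square (diff ps u) n

    lyapunov-drift : ∀ {u} → Recurrent u → ∀ n →
      lyapunov u (suc n) ≈
        lyapunov u n - (diff ps u (suc n) - diff ps u n) * (diff ps u (suc n) - diff ps u n)
    lyapunov-drift {u} rec n = begin
      energy ps u (suc n) - x′ * x′
        ≈⟨ solve 3 (λ e x x′ → e :- x′ :* x′ :=
             (e :+ :2 :* (x :* x)) :- (x′ :* x′ :+ :2 :* (x :* x))) refl _ x x′ ⟩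
      (energy ps u (suc n) + ι (+ 2) * (x * x)) - (x′ * x′ + ι (+ 2) * (x * x))
        ≈⟨ +-congʳ (energy-drift rec n) ⟩
      (energy ps u n + ι (+ 2) * (x * x′)) - (x′ * x′ + ι (+ 2) * (x * x))
        ≈⟨ solve 3 (λ e x x′ →
             (e :+ :2 :* (x :* x′)) :- (x′ :* x′ :+ :2 :* (x :* x))
             := (e :- x :* x) :- (x′ :- x) :* (x′ :- x)) refl _ x x′ ⟩
      (energy ps u n - x * x) - (x′ - x) * (x′ - x) ∎
      where
      x  = diff ps u n
      x′ = diff ps u (suc n)

    -- Up to a factor, the coefficient of u₀ in the expansion of a solution u with
    -- respect to the eigenvectors of the recurrence.
    component : Seq → Seq → Seq
    component u₀ u n = diff ps u₀ 0 * diff ps u n + convolves ps u₀ u n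

    component-linear : ∀ u₀ → Linear (component u₀)
    component-linear u₀ =
      +-linear (*-linear (diff ps u₀ 0) (diff-linear ps)) (convolves-linear ps u₀)

    -- The recurrence of u supplies the term x₀ b that completes `convolves-step`; the remainder (M
    -- x₀ + b₀) x is a x₀ x by the recurrence of u₀ itself.
    component-geometric : ∀ {a u₀ u} → Geometric a u₀ → Recurrent u₀ → Recurrent u →
      Geometric a (component u₀ u)
    component-geometric {a} {u₀} {u} g rec₀ rec n = begin
      x₀ * diff ps u (suc n) + c′
        ≈⟨ +-congʳ (*-congˡ (rec n)) ⟩
      x₀ * (ι M * x + b) + c′
        ≈⟨ solve 5 (λ x₀ x b c′ m → x₀ :* (m :* x :+ b) :+ c′
             := x₀ :* m :* x :+ (c′ :+ x₀ :* b)) refl x₀ x b c′ (ι M) ⟩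
      x₀ * ι M * x + (c′ + x₀ * b)
        ≈⟨ +-congˡ (convolves-step ps g u n) ⟩
      x₀ * ι M * x + (a * c + b₀ * x)
        ≈⟨ solve 6 (λ a x₀ x b₀ c m → x₀ :* m :* x :+ (a :* c :+ b₀ :* x)
             := (m :* x₀ :+ b₀) :* x :+ a :* c) refl a x₀ x b₀ c (ι M) ⟩
      (ι M * x₀ + b₀) * x + a * c
        ≈⟨ +-congʳ (*-congʳ (trans (sym (rec₀ 0)) (linear-geometric (diff-linear ps) g 0))) ⟩
      (a * x₀) * x + a * c
        ≈⟨ solve 4 (λ a x₀ x c → (a :* x₀) :* x :+ a :* c := a :* (x₀ :* x :+ c)) refl a x₀ x c ⟩
      a * (x₀ * x + c) ∎
      where
      x₀ = diff ps u₀ 0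
      b₀ = cofactors ps u₀ 0
      x  = diff ps u n
      b  = cofactors ps u n
      c  = convolves ps u₀ u n
      c′ = convolves ps u₀ u (suc n)

    -- The choice of l and m makes the quadratic l² E₀ + 2 l m C + m² E minimal.
    component-bound : ∀ {a u₀ u} → Geometric a u₀ → Recurrent u₀ →
      ∀ n → component u₀ u n ≈ 0# →
      (a - 1#) * convolvesSquares ps ((a + 1#) * diff ps u n) (ι (+ 2) * diff ps u₀ 0) u₀ u n
        ≈ ((a - 1#) * (ι (+ 2) * square (diff ps u₀) 0))
            * (ι (+ 2) * energy ps u n - (a + 1#) * square (diff ps u) n)
    component-bound {a} {u₀} {u} g rec₀ n comp≈0 = begin
      (a - 1#) * convolvesSquares ps l m u₀ u n
        ≈⟨ *-congˡ (convolvesSquares-expand ps l m u₀ u n) ⟩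
      (a - 1#) * ((l * l) * e₀ + (ι (+ 2) * (l * m) * c + (m * m) * e))
        -- The cross term c is written as (x₀ x + c) - x₀ x, so that the vanishing component
        -- replaces it by - x₀ x.
        ≈⟨ solve 6 (λ a e₀ e c x x₀ →
             let l = (a :+ :1) :* x
                 m = :2 :* x₀
                 t = a :- :1 in
             t :* (l :* l :* e₀ :+ (:2 :* (l :* m) :* c :+ m :* m :* e))
             := (a :+ :1) :* (x :* x) :* ((a :* a :- :1) :* e₀)
                :+ (t :* :2 :* (l :* m) :* ((x₀ :* x :+ c) :- x₀ :* x)
                   :+ t :* (m :* m) :* e)) refl a e₀ e c x x₀ ⟩
      (a + 1#) * (x * x) * ((a * a - 1#) * e₀)
        + ((a - 1#) * ι (+ 2) * (l * m) * ((x₀ * x + c) - x₀ * x) + (a - 1#) * (m * m) * e)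
        ≈⟨ +-cong (*-congˡ energy₀) (+-congʳ (*-congˡ (+-congʳ comp≈0))) ⟩
      (a + 1#) * (x * x) * (ι (+ 2) * ((a - 1#) * (x₀ * x₀)))
        + ((a - 1#) * ι (+ 2) * (l * m) * (0# - x₀ * x) + (a - 1#) * (m * m) * e)
        ≈⟨ solve 4 (λ a e x x₀ →
             let l = (a :+ :1) :* x
                 m = :2 :* x₀
                 t = a :- :1 in
             (a :+ :1) :* (x :* x) :* (:2 :* (t :* (x₀ :* x₀)))
                :+ (t :* :2 :* (l :* m) :* (:0 :- x₀ :* x) :+ t :* (m :* m) :* e)
             := (t :* (:2 :* (x₀ :* x₀)))
                :* (:2 :* e :- (a :+ :1) :* (x :* x))) refl a e x x₀ ⟩
      ((a - 1#) * (ι (+ 2) * (x₀ * x₀))) * (ι (+ 2) * e - (a + 1#) * (x * x)) ∎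
      where
      x₀ = diff ps u₀ 0
      x  = diff ps u n
      l  = (a + 1#) * x
      m  = ι (+ 2) * x₀
      c  = convolves ps u₀ u n
      e₀ = energy ps u₀ 0
      e  = energy ps u n

      square-geometric : ∀ {v} → Geometric a v → Geometric (a * a) (square v)
      square-geometric g n = trans (*-cong (g n) (g n))
        (solve 2 (λ a x → (a :* x) :* (a :* x) := (a :* a) :* (x :* x)) refl a _)

      energy-geometric : ∀ qs {v} → Geometric a v → Geometric (a * a) (energy qs v)
      energy-geometric []       g n = sym (zeroʳ (a * a))
      energy-geometric (q ∷ qs) g n = trans
        (+-cong (linear-geometric (geo-linear q)
                   (square-geometric (linear-geometric (prod-linear qs) g)) n)
                (energy-geometric qs (linear-geometric (geo-linear q) g) n))
        (sym (distribˡ _ _ _))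

      -- The energy of the eigenvector is multiplied by a² in one step, and `energy-drift` computes
      -- the same step; up to the factor a - 1, which a ring cannot cancel, (a + 1) e₀ = 2 x₀². With
      -- c = - x₀ x the quadratic is therefore least at l / m = x₀ x / e₀ = (a + 1) x / (2 x₀),
      -- whence the values of l and m.
      energy₀ : (a * a - 1#) * e₀ ≈ ι (+ 2) * ((a - 1#) * (x₀ * x₀))
      energy₀ = begin
        (a * a - 1#) * e₀
          ≈⟨ solve 3 (λ a e x → (a :* a :- :1) :* e
               := ((a :* a :* e) :+ :2 :* (x :* x)) :- (e :+ :2 :* (x :* x)))
               refl a e₀ x₀ ⟩
        (a * a * e₀ + ι (+ 2) * (x₀ * x₀)) - (e₀ + ι (+ 2) * (x₀ * x₀))
          ≈⟨ +-congʳ (trans (+-congʳ (sym (energy-geometric ps g 0))) (energy-drift rec₀ 0)) ⟩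
        (e₀ + ι (+ 2) * (x₀ * diff ps u₀ 1)) - (e₀ + ι (+ 2) * (x₀ * x₀))
          ≈⟨ +-congʳ (+-congˡ (*-congˡ (*-congˡ (linear-geometric (diff-linear ps) g 0)))) ⟩
        (e₀ + ι (+ 2) * (x₀ * (a * x₀))) - (e₀ + ι (+ 2) * (x₀ * x₀))
          ≈⟨ solve 3 (λ a e x → (e :+ :2 :* (x :* (a :* x))) :- (e :+ :2 :* (x :* x))
               := :2 :* ((a :- :1) :* (x :* x))) refl a e₀ x₀ ⟩
        ι (+ 2) * ((a - 1#) * (x₀ * x₀)) ∎

  -- (c n , s n) are the real and imaginary parts of a complex geometric sequence.
  record Rotating (x y : Carrier) (c s : Seq) : Set where
    field
      real : ∀ n → c (suc n) ≈ x * c n - y * s n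
      imag : ∀ n → s (suc n) ≈ x * s n + y * c n

  open Rotating public

  linear-rotating : ∀ {O x y c s} → Linear O → Rotating x y c s → Rotating x y (O c) (O s)
  linear-rotating {O} {x} {y} {c} {s} l r = record
    { real = λ n → begin
        O c (suc n)                    ≈⟨ sym (shift l c n) ⟩
        O (c ∘ suc) n                  ≈⟨ resp l (λ m → trans (real r m) (+-congˡ neg*)) n ⟩
        O (λ m → x * c m + (- y) * s m) n ≈⟨ combine l x (- y) c s n ⟩
        x * O c n + (- y) * O s n      ≈⟨ +-congˡ (sym neg*) ⟩
        x * O c n - y * O s n          ∎
    ; imag = λ n → trans (sym (shift l s n)) (trans (resp l (imag r) n) (combine l x y s c n))
    }
    where
    neg* : ∀ {a} → - (y * a) ≈ (- y) * a
    neg* {a} = solve 2 (λ y a → :- (y :* a) := (:- y) :* a) refl y a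

  module _ {x y : Carrier} where

    square-rotating : ∀ {c s} → Rotating x y c s →
      Geometric (x * x + y * y) (λ n → square c n + square s n)
    square-rotating {c} {s} r n = trans
      (+-cong (*-cong (real r n) (real r n)) (*-cong (imag r n) (imag r n)))
      (solve 4 (λ x y c s →
        (x :* c :- y :* s) :* (x :* c :- y :* s) :+ (x :* s :+ y :* c) :* (x :* s :+ y :* c)
        := (x :* x :+ y :* y) :* (c :* c :+ s :* s)) refl x y (c n) (s n))

    -- Neither part of a complex geometric sequence is geometric, but the sum of their energies is
    -- Hermitian and so is scaled by |z|².
    energy-rotating : ∀ ps {c s} → Rotating x y c s →
      Geometric (x * x + y * y) (λ n → energy ps c n + energy ps s n)
    energy-rotating []       r n = sym (trans (*-congˡ (+-identityˡ 0#)) (trans (zeroʳ _) (sym (+-identityˡ 0#))))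
    energy-rotating (p ∷ ps) {c} {s} r n = begin
      (geo p (square c′) (suc n) + energy ps (geo p c) (suc n))
        + (geo p (square s′) (suc n) + energy ps (geo p s) (suc n))
        ≈⟨ interchange ⟩
      (geo p (square c′) (suc n) + geo p (square s′) (suc n))
        + (energy ps (geo p c) (suc n) + energy ps (geo p s) (suc n))
        ≈⟨ +-cong (trans (sym (add (geo-linear p) _ _ (suc n)))
                     (trans (linear-geometric (geo-linear p) (square-rotating r′) n)
                            (*-congˡ (add (geo-linear p) _ _ n))))
                  (energy-rotating ps (linear-rotating (geo-linear p) r) n) ⟩
      (x * x + y * y) * (geo p (square c′) n + geo p (square s′) n)
        + (x * x + y * y) * (energy ps (geo p c) n + energy ps (geo p s) n)
        ≈⟨ trans (sym (distribˡ _ _ _)) (*-congˡ interchange) ⟩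
      (x * x + y * y) * ((geo p (square c′) n + energy ps (geo p c) n)
        + (geo p (square s′) n + energy ps (geo p s) n)) ∎
      where
      c′ = prod ps c
      s′ = prod ps s
      r′ = linear-rotating (prod-linear ps) r
      interchange : ∀ {a b c d} → (a + b) + (c + d) ≈ (a + c) + (b + d)
      interchange = solve 4 (λ a b c d → (a :+ b) :+ (c :+ d) := (a :+ c) :+ (b :+ d)) refl _ _ _ _

    module _ (ps : List ℕ) (M : ℤ) (k+2≡2M : + length ps ℤ.+ + 2 ≡ + 2 ℤ.* M) where
      open Recurrence ps M k+2≡2M

      -- The energy after one step is known twice: it is |z|² times the initial one, and it is given
      -- by `energy-drift`. Comparison of the two values leaves |z - 1|² |x(0)|².
      lyapunov-rotating : ∀ {c s} → Rotating x y c s → Recurrent c → Recurrent s →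
        (lyapunov c 0 + lyapunov s 0) * (1# - (x * x + y * y))
          ≈ ((x - 1#) * (x - 1#) + y * y)
              * (square (diff ps c) 0 + square (diff ps s) 0)
      lyapunov-rotating {c} {s} r rc rs = begin
        ((ec - xc * xc) + (es - xs * xs)) * (1# - (x * x + y * y))
          ≈⟨ solve 6 (λ x y ec es xc xs →
               ((ec :- xc :* xc) :+ (es :- xs :* xs)) :* (:1 :- (x :* x :+ y :* y))
               := ((ec :+ es) :- (x :* x :+ y :* y) :* (ec :+ es))
                  :- (:1 :- (x :* x :+ y :* y)) :* (xc :* xc :+ xs :* xs))
               refl x y ec es xc xs ⟩
        ((ec + es) - (x * x + y * y) * (ec + es))
          - (1# - (x * x + y * y)) * (xc * xc + xs * xs)
          ≈⟨ +-congʳ (+-congˡ (-‿cong (sym (energy-rotating ps r 0)))) ⟩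
        ((ec + es) - (energy ps c 1 + energy ps s 1))
          - (1# - (x * x + y * y)) * (xc * xc + xs * xs)
          ≈⟨ solve 8 (λ x y ec es xc xs ec′ es′ →
               ((ec :+ es) :- (ec′ :+ es′))
                 :- (:1 :- (x :* x :+ y :* y)) :* (xc :* xc :+ xs :* xs)
               := ((ec :+ es) :- ((ec′ :+ :2 :* (xc :* xc)) :+ (es′ :+ :2 :* (xs :* xs))))
                 :+ (:1 :+ (x :* x :+ y :* y)) :* (xc :* xc :+ xs :* xs))
               refl x y ec es xc xs _ _ ⟩
        ((ec + es) - ((energy ps c 1 + ι (+ 2) * (xc * xc)) + (energy ps s 1 + ι (+ 2) * (xs * xs))))
          + (1# + (x * x + y * y)) * (xc * xc + xs * xs)
          ≈⟨ +-congʳ (+-congˡ (-‿cong (+-cong (drift rc real′) (drift rs imag′)))) ⟩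
        ((ec + es) - ((ec + ι (+ 2) * (xc * (x * xc - y * xs))) + (es + ι (+ 2) * (xs * (x * xs + y * xc)))))
          + (1# + (x * x + y * y)) * (xc * xc + xs * xs)
          ≈⟨ solve 6 (λ x y ec es xc xs →
               ((ec :+ es) :- ((ec :+ :2 :* (xc :* (x :* xc :- y :* xs)))
                              :+ (es :+ :2 :* (xs :* (x :* xs :+ y :* xc)))))
                 :+ (:1 :+ (x :* x :+ y :* y)) :* (xc :* xc :+ xs :* xs)
               := ((x :- :1) :* (x :- :1) :+ y :* y) :* (xc :* xc :+ xs :* xs))
               refl x y ec es xc xs ⟩
        ((x - 1#) * (x - 1#) + y * y) * (xc * xc + xs * xs) ∎
        where
        ec = energy ps c 0
        es = energy ps s 0
        xc = diff ps c 0
        xs = diff ps s 0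
        real′ = real (linear-rotating (diff-linear ps) r) 0
        imag′ = imag (linear-rotating (diff-linear ps) r) 0
        drift : ∀ {u v} → Recurrent u → diff ps u 1 ≈ v →
          energy ps u 1 + ι (+ 2) * (diff ps u 0 * diff ps u 0)
            ≈ energy ps u 0 + ι (+ 2) * (diff ps u 0 * v)
        drift rec eq = trans (energy-drift rec 0) (+-congˡ (*-congˡ (*-congˡ eq)))

      -- One step multiplies the component by a, because it is an eigenfunctional, and by z, because
      -- it is linear. Hence (z - a) times the component is 0, and multiplication by the conjugate
      -- of z - a makes the factor real.
      component-rotating : ∀ {a u₀ c s} → Geometric a u₀ → Recurrent u₀ →
        Rotating x y c s → Recurrent c → Recurrent s →
        ((x - a) * (x - a) + y * y) * component u₀ c 0 ≈ 0# ×
        ((x - a) * (x - a) + y * y) * component u₀ s 0 ≈ 0#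
      component-rotating {a} {u₀} {c} {s} g rec₀ r rc rs =
        vanish p q ,
        -- The imaginary part satisfies the equations of the real part with - y in place of y.
        trans (*-congʳ (+-congˡ (solve 1 (λ y → y :* y := (:- y) :* (:- y)) refl y)))
          (vanish (trans q (solve 4 (λ x y u v → x :* v :+ y :* u := x :* v :- (:- y) :* u) refl x y lc ls))
                  (trans p (solve 4 (λ x y u v → x :* u :- y :* v := x :* u :+ (:- y) :* v) refl x y lc ls)))
        where
        lc = component u₀ c 0
        ls = component u₀ s 0
        r′ = linear-rotating (component-linear u₀) r

        p : a * lc ≈ x * lc - y * ls
        p = trans (sym (component-geometric g rec₀ rc 0)) (real r′ 0)

        q : a * ls ≈ x * ls + y * lc
        q = trans (sym (component-geometric g rec₀ rs 0)) (imag r′ 0)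

        vanish : ∀ {y u v} → a * u ≈ x * u - y * v → a * v ≈ x * v + y * u →
          ((x - a) * (x - a) + y * y) * u ≈ 0#
        vanish {y} {u} {v} p q = begin
          ((x - a) * (x - a) + y * y) * u
            ≈⟨ solve 5 (λ x y a u v → ((x :- a) :* (x :- a) :+ y :* y) :* u
                 := ((x :- a) :* ((x :* u :- y :* v) :- a :* u)
                    :+ y :* ((x :* v :+ y :* u) :- a :* v))) refl x y a u v ⟩
          (x - a) * ((x * u - y * v) - a * u) + y * ((x * v + y * u) - a * v)
            ≈⟨ +-cong (*-congˡ (+-congʳ (sym p))) (*-congˡ (+-congʳ (sym q))) ⟩
          (x - a) * (a * u - a * u) + y * (a * v - a * v)
            ≈⟨ solve 4 (λ x y p q → x :* (p :- p) :+ y :* (q :- q) := :0) refl _ _ _ _ ⟩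
          0# ∎

-- Polynomials

-- A vector of length d stands for a monic polynomial of degree d, as in Defs; lists
-- are polynomials with all their coefficients.
addLow : ∀ {d} → List ℤ → Vec ℤ d → Vec ℤ d
addLow []       p       = p
-- A default value: surplus coefficients would disturb the leading 1, and the lemmas about `addLow`
-- exclude them by a bound on the length.
addLow (x ∷ xs) []      = []
addLow (x ∷ xs) (c ∷ p) = x ℤ.+ c ∷ addLow xs p

coefficients : ∀ {d} → Vec ℤ d → List ℤ
coefficients []      = + 1 ∷ []
coefficients (c ∷ p) = c ∷ coefficients p

length-coefficients : ∀ {d} (p : Vec ℤ d) → length (coefficients p) ≡ suc d
length-coefficients []      = ≡.refl
length-coefficients (c ∷ p) = ≡.cong suc (length-coefficients p)

negatives : List ℤ → List ℤ
negatives = List.map (λ x → ℤ.- x)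

-- Multiplication by 1 + X + ⋯ + X^m.
mulGeo : ∀ m {d} → Vec ℤ d → Vec ℤ (m ℕ.+ d)
mulGeo zero    p = p
mulGeo (suc m) p = addLow (coefficients p) (+ 0 ∷ mulGeo m p)

degree : List ℕ → ℕ → ℕ
degree []       d = d
degree (p ∷ ps) d = degree ps (ℕ.pred p ℕ.+ d)

-- f ∏ [pᵢ] − g ∑ᵢ ∏_{j≠i} [pⱼ]
starPolynomial : ∀ ps {d e} → Vec ℤ d → Vec ℤ e → Vec ℤ (degree ps d)
starPolynomial []       f g = f
-- With ∏ and ∑ formed over the tail, f [p] ∏ - g (∏ + [p] ∑) = (f [p] - g) ∏ - (g [p]) ∑.
starPolynomial (p ∷ ps) f g = starPolynomial ps
  (addLow (negatives (coefficients g)) (mulGeo (ℕ.pred p) f)) (mulGeo (ℕ.pred p) g)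

degree-sum : ∀ {ps} d → All (1 ℕ.≤_) ps → degree ps d ℕ.+ length ps ≡ d ℕ.+ sum ps
degree-sum d [] = ≡.refl
degree-sum {suc p ∷ ps} d (s≤s z≤n ∷ 1≤ps) = begin
  degree ps (p ℕ.+ d) ℕ.+ suc (length ps)   ≡⟨ ℕ.+-suc _ _ ⟩
  suc (degree ps (p ℕ.+ d) ℕ.+ length ps)   ≡⟨ ≡.cong suc (degree-sum (p ℕ.+ d) 1≤ps) ⟩
  suc (p ℕ.+ d ℕ.+ sum ps)                  ≡⟨ ≡.cong (λ x → suc (x ℕ.+ sum ps)) (ℕ.+-comm p d) ⟩
  suc (d ℕ.+ p ℕ.+ sum ps)                  ≡⟨ ≡.cong suc (ℕ.+-assoc d p (sum ps)) ⟩
  suc (d ℕ.+ (p ℕ.+ sum ps))                ≡⟨ ℕ.+-suc d _ ⟨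
  d ℕ.+ suc (p ℕ.+ sum ps)                  ∎
  where open ≡.≡-Reasoning

-- The coefficient below the leading one (0 in degree 0).
second : ∀ {d} → Vec ℤ d → ℤ
second []          = + 0
second (c ∷ [])    = c
second (_ ∷ c ∷ p) = second (c ∷ p)

second-addLow : ∀ {d} xs (p : Vec ℤ d) → length xs ℕ.< d → second (addLow xs p) ≡ second p
second-addLow []            p               _         = ≡.refl
second-addLow (x ∷ [])      (c ∷ c′ ∷ p)    _         = ≡.refl
second-addLow (x ∷ x′ ∷ xs) (c ∷ c′ ∷ p)    (s≤s lt)  = second-addLow (x′ ∷ xs) (c′ ∷ p) lt
second-addLow (x ∷ [])      (c ∷ [])        (s≤s ())
second-addLow (x ∷ x′ ∷ xs) (c ∷ [])        (s≤s ())

second-∷ : ∀ {d} c (p : Vec ℤ (suc d)) → second (c ∷ p) ≡ second p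
second-∷ c (_ ∷ _) = ≡.refl

-- The leading 1 of p lands just below the leading term of y + X p.
second-addLow-coefficients : ∀ {d} y (p : Vec ℤ d) →
  second (addLow (coefficients p) (y ∷ p)) ≡ + 1 ℤ.+ second (y ∷ p)
second-addLow-coefficients y []      = ≡.refl
second-addLow-coefficients y (x ∷ p) =
  ≡.trans (second-∷ (x ℤ.+ y) (addLow (coefficients p) (x ∷ p))) (second-addLow-coefficients x p)

second-0∷ : ∀ {d} (p : Vec ℤ d) → second (+ 0 ∷ p) ≡ second p
second-0∷ []      = ≡.refl
second-0∷ (_ ∷ _) = ≡.refl

second-mulGeo : ∀ m {d} (p : Vec ℤ d) → second (mulGeo (suc m) p) ≡ + 1 ℤ.+ second p
second-mulGeo zero    p =
  ≡.trans (second-addLow-coefficients (+ 0) p) (≡.cong (ℤ._+_ (+ 1)) (second-0∷ p))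
second-mulGeo (suc m) {d} p = ≡.trans
  (second-addLow (coefficients p) _
    (≡.subst (ℕ._< suc (suc m ℕ.+ d)) (≡.sym (length-coefficients p)) (s≤s (s≤s (ℕ.m≤n+m d m)))))
  (≡.trans (second-0∷ (mulGeo (suc m) p)) (second-mulGeo m p))

length-negatives-coefficients : ∀ {d} (p : Vec ℤ d) →
  length (negatives (coefficients p)) ≡ suc d
length-negatives-coefficients p =
  ≡.trans (List.length-map (λ x → ℤ.- x) (coefficients p)) (length-coefficients p)

-- Each factor [p] with p ≥ 2 adds 1. The subtracted g never reaches this coefficient, because its
-- degree is below that of f and f is multiplied by a factor of positive degree before g is
-- subtracted.
second-starPolynomial : ∀ {ps d e} (f : Vec ℤ d) (g : Vec ℤ e) → e ℕ.< d → All (2 ℕ.≤_) ps →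
  second (starPolynomial ps f g) ≡ + length ps ℤ.+ second f
second-starPolynomial f g e<d [] = ≡.sym (ℤ.+-identityˡ (second f))
second-starPolynomial {suc (suc m) ∷ ps} {d} {e} f g e<d (s≤s (s≤s z≤n) ∷ 2≤ps) = begin
  second (starPolynomial ps f′ g′)
    ≡⟨ second-starPolynomial f′ g′ (ℕ.+-monoʳ-< (suc m) e<d) 2≤ps ⟩
  + length ps ℤ.+ second f′
    ≡⟨ ≡.cong (ℤ._+_ (+ length ps)) (≡.trans
         (second-addLow (negatives (coefficients g)) (mulGeo (suc m) f)
           (≡.subst (ℕ._< suc m ℕ.+ d) (≡.sym (length-negatives-coefficients g))
             (s≤s (ℕ.≤-trans e<d (ℕ.m≤n+m d m)))))
         (second-mulGeo m f)) ⟩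
  + length ps ℤ.+ (+ 1 ℤ.+ second f)
    ≡⟨ ≡.sym (ℤ.+-assoc (+ length ps) (+ 1) (second f)) ⟩
  + (length ps ℕ.+ 1) ℤ.+ second f
    ≡⟨ ≡.cong (λ n → + n ℤ.+ second f) (ℕ.+-comm (length ps) 1) ⟩
  + suc (length ps) ℤ.+ second f ∎
  where
  open ≡.≡-Reasoning
  f′ = addLow (negatives (coefficients g)) (mulGeo (suc m) f)
  g′ = mulGeo (suc m) g

module PolynomialAction (A : ℤ-Algebra) where
  open ℤ-Algebra A
  open IntegerSolver A
  open Shift A
  open Relation.Binary.Reasoning.Setoid setoid

  monicAct : ∀ {d} → Vec ℤ d → Seq → Seq
  monicAct p = act (Vec.map ι p) 1#

  monicAct-linear : ∀ {d} (p : Vec ℤ d) → Linear (monicAct p)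
  monicAct-linear p = act-linear (Vec.map ι p) 1#

  listAct : List ℤ → Seq → Seq
  listAct []       u n = 0#
  listAct (x ∷ xs) u n = ι x * u n + listAct xs u (suc n)

  listAct-coefficients : ∀ {d} (p : Vec ℤ d) u n →
    listAct (coefficients p) u n ≈ monicAct p u n
  listAct-coefficients []      u n = trans (+-identityʳ _) (*-congʳ ι-1)
  listAct-coefficients (c ∷ p) u n = +-congˡ (listAct-coefficients p u (suc n))

  listAct-negatives : ∀ xs u n → listAct (negatives xs) u n ≈ - listAct xs u n
  listAct-negatives []       u n = solve 0 (:0 := :- :0) refl
  listAct-negatives (x ∷ xs) u n = trans
    (+-cong (*-congʳ (ι-neg x)) (listAct-negatives xs u (suc n)))
    (solve 3 (λ x u l → (:- x) :* u :+ (:- l) := :- (x :* u :+ l)) refl _ _ _)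

  monicAct-addLow : ∀ {d} xs (p : Vec ℤ d) → length xs ℕ.≤ d → ∀ u n →
    monicAct (addLow xs p) u n ≈ listAct xs u n + monicAct p u n
  monicAct-addLow []       p       _        u n = sym (+-identityˡ _)
  monicAct-addLow (x ∷ xs) (c ∷ p) (s≤s le) u n = trans
    (+-cong (*-congʳ (ι-+ x c)) (monicAct-addLow xs p le u (suc n)))
    (solve 5 (λ x c u l m → (x :+ c) :* u :+ (l :+ m) := (x :* u :+ l) :+ (c :* u :+ m))
      refl _ _ _ _ _)

  monicAct-mulGeo : ∀ m {d} (p : Vec ℤ d) u n →
    monicAct (mulGeo m p) u n ≈ geo (suc m) (monicAct p u) n
  monicAct-mulGeo zero    p u n = sym (+-identityʳ _)
  monicAct-mulGeo (suc m) {d} p u n = begin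
    monicAct (addLow (coefficients p) (+ 0 ∷ mulGeo m p)) u n
      ≈⟨ monicAct-addLow (coefficients p) (+ 0 ∷ mulGeo m p)
           (ℕ.≤-trans (ℕ.≤-reflexive (length-coefficients p)) (s≤s (ℕ.m≤n+m d m))) u n ⟩
    listAct (coefficients p) u n + (ι (+ 0) * u n + monicAct (mulGeo m p) u (suc n))
      ≈⟨ +-cong (listAct-coefficients p u n) (trans
           (+-cong (trans (*-congʳ ι-0) (zeroˡ (u n))) (monicAct-mulGeo m p u (suc n)))
           (+-identityˡ _)) ⟩
    monicAct p u n + geo (suc m) (monicAct p u) (suc n) ∎

  starPolynomial-act : ∀ {ps d e} (f : Vec ℤ d) (g : Vec ℤ e) → e ℕ.< d → All (1 ℕ.≤_) ps →
    ∀ u n → monicAct (starPolynomial ps f g) u n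
      ≈ monicAct f (prod ps u) n - monicAct g (cofactors ps u) n
  starPolynomial-act f g e<d [] u n = begin
    monicAct f u n
      ≈⟨ solve 1 (λ x → x := x :- :0) refl _ ⟩
    monicAct f u n - 0#
      ≈⟨ +-congˡ (-‿cong (sym (null (monicAct-linear g) (λ _ → refl) n))) ⟩
    monicAct f u n - monicAct g (λ _ → 0#) n ∎
  starPolynomial-act {suc m ∷ ps} {d} {e} f g e<d (s≤s z≤n ∷ 1≤ps) u n = begin
    monicAct (starPolynomial ps f′ g′) u n
      ≈⟨ starPolynomial-act f′ g′ (ℕ.+-monoʳ-< m e<d) 1≤ps u n ⟩
    monicAct f′ (prod ps u) n - monicAct g′ (cofactors ps u) n
      ≈⟨ +-cong (monicAct-addLow (negatives (coefficients g)) (mulGeo m f)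
                   (ℕ.≤-trans (ℕ.≤-reflexive (length-negatives-coefficients g))
                     (ℕ.≤-trans e<d (ℕ.m≤n+m d m))) (prod ps u) n)
                (-‿cong (monicAct-mulGeo m g (cofactors ps u) n)) ⟩
    (listAct (negatives (coefficients g)) (prod ps u) n + monicAct (mulGeo m f) (prod ps u) n)
      - geo (suc m) (monicAct g (cofactors ps u)) n
      ≈⟨ +-cong (+-cong
           (trans (listAct-negatives (coefficients g) (prod ps u) n)
             (-‿cong (listAct-coefficients g (prod ps u) n)))
           (trans (monicAct-mulGeo m f (prod ps u) n)
             (sym (linear-geo (∘-linear (monicAct-linear f) (prod-linear ps)) (suc m) u n))))
           (-‿cong (sym (linear-geo (∘-linear (monicAct-linear g) (cofactors-linear ps))
             (suc m) u n))) ⟩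
    (- monicAct g (prod ps u) n + monicAct f (prod ps (geo (suc m) u)) n)
      - monicAct g (cofactors ps (geo (suc m) u)) n
      ≈⟨ solve 3 (λ a b c → (:- a :+ b) :- c := b :- (a :+ c)) refl _ _ _ ⟩
    monicAct f (prod ps (geo (suc m) u)) n
      - (monicAct g (prod ps u) n + monicAct g (cofactors ps (geo (suc m) u)) n)
      ≈⟨ +-congˡ (-‿cong (sym (add (monicAct-linear g) _ _ n))) ⟩
    monicAct f (prod (suc m ∷ ps) u) n - monicAct g (cofactors (suc m ∷ ps) u) n ∎
    where
    f′ = addLow (negatives (coefficients g)) (mulGeo m f)
    g′ = mulGeo m g

-- (X − 1) (X − M) ∏ [pᵢ] − ∑ᵢ ∏_{j≠i} [pⱼ]
pisotPolynomial : ∀ ps → ℤ → Vec ℤ (degree ps 2)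
pisotPolynomial ps M = starPolynomial ps (M ∷ ℤ.- (M ℤ.+ + 1) ∷ []) []

module PisotPolynomial (A : ℤ-Algebra) where
  open ℤ-Algebra A
  open IntegerSolver A
  open Shift A
  open PolynomialAction A
  open Relation.Binary.Reasoning.Setoid setoid

  pisotPolynomial-act : ∀ {ps} M → All (1 ℕ.≤_) ps → ∀ u n →
    monicAct (pisotPolynomial ps M) u n
      ≈ diff ps u (suc n) - (ι M * diff ps u n + cofactors ps u n)
  pisotPolynomial-act {ps} M 1≤ps u n = begin
    monicAct (pisotPolynomial ps M) u n
      ≈⟨ starPolynomial-act {ps} (M ∷ ℤ.- (M ℤ.+ + 1) ∷ []) [] (s≤s z≤n) 1≤ps u n ⟩
    (ι M * y n + (ι (ℤ.- (M ℤ.+ + 1)) * y (suc n) + 1# * y (suc (suc n)))) - 1# * b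
      ≈⟨ +-congʳ (+-congˡ (+-congʳ (*-congʳ (trans (ι-neg _) (-‿cong
           (trans (ι-+ M (+ 1)) (+-congˡ ι-1))))))) ⟩
    (ι M * y n + (- (ι M + 1#) * y (suc n) + 1# * y (suc (suc n)))) - 1# * b
      ≈⟨ solve 5 (λ m y y′ y″ b →
           (m :* y :+ ((:- (m :+ :1)) :* y′ :+ :1 :* y″)) :- :1 :* b
           := (y″ :- y′) :- (m :* (y′ :- y) :+ b)) refl (ι M) _ _ _ _ ⟩
    (y (suc (suc n)) - y (suc n)) - (ι M * (y (suc n) - y n) + b) ∎
    where
    y = prod ps u
    b = cofactors ps u n

-- Evaluation and coprimality

prodAt1 : List ℕ → ℕ
prodAt1 []       = 1
prodAt1 (p ∷ ps) = p ℕ.* prodAt1 ps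

cofactorsAt1 : List ℕ → ℕ
cofactorsAt1 []       = 0
cofactorsAt1 (p ∷ ps) = prodAt1 ps ℕ.+ p ℕ.* cofactorsAt1 ps

prodAt1-positive : ∀ {ps} → All (1 ℕ.≤_) ps → 1 ℕ.≤ prodAt1 ps
prodAt1-positive []           = s≤s z≤n
prodAt1-positive (1≤p ∷ 1≤ps) = ℕ.*-mono-≤ 1≤p (prodAt1-positive 1≤ps)

cofactorsAt1-positive : ∀ {p ps} → All (1 ℕ.≤_) (p ∷ ps) → 1 ℕ.≤ cofactorsAt1 (p ∷ ps)
cofactorsAt1-positive (_ ∷ 1≤ps) = ℕ.≤-trans (prodAt1-positive 1≤ps) (ℕ.m≤m+n _ _)

module Values (A : ℤ-Algebra) (z : ℤ-Algebra.Carrier A) where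
  open ℤ-Algebra A
  open IntegerSolver A
  open Shift A
  open Relation.Binary.Reasoning.Setoid setoid

  power : ℕ → Carrier
  power zero    = 1#
  power (suc n) = z * power n

  geoValue : ℕ → Carrier
  geoValue zero    = 0#
  geoValue (suc p) = 1# + z * geoValue p

  prodValue : List ℕ → Carrier
  prodValue []       = 1#
  prodValue (p ∷ ps) = geoValue p * prodValue ps

  cofactorsValue : List ℕ → Carrier
  cofactorsValue []       = 0#
  cofactorsValue (p ∷ ps) = prodValue ps + geoValue p * cofactorsValue ps

  geo-value : ∀ {u} → Geometric z u → ∀ p n → geo p u n ≈ geoValue p * u n
  geo-value g zero    n = sym (zeroˡ _)
  geo-value g (suc p) n = trans
    (+-congˡ (trans (geo-value g p (suc n)) (*-congˡ (g n))))
    (solve 3 (λ z u v → u :+ v :* (z :* u) := (:1 :+ z :* v) :* u) refl z _ _)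

  prod-value : ∀ {u} → Geometric z u → ∀ ps n → prod ps u n ≈ prodValue ps * u n
  prod-value g []       n = sym (*-identityˡ _)
  prod-value g (p ∷ ps) n = trans
    (prod-value (linear-geometric (geo-linear p) g) ps n)
    (trans (*-congˡ (geo-value g p n))
      (solve 3 (λ a b u → a :* (b :* u) := (b :* a) :* u) refl _ _ _))

  cofactors-value : ∀ {u} → Geometric z u → ∀ ps n →
    cofactors ps u n ≈ cofactorsValue ps * u n
  cofactors-value g []       n = sym (zeroˡ _)
  cofactors-value g (p ∷ ps) n = trans
    (+-cong (prod-value g ps n) (trans
      (cofactors-value (linear-geometric (geo-linear p) g) ps n) (*-congˡ (geo-value g p n))))
    (solve 4 (λ a b c u → a :* u :+ b :* (c :* u) := (a :+ c :* b) :* u) refl _ _ _ _)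

  diff-value : ∀ {u} → Geometric z u → ∀ ps n → diff ps u n ≈ (z - 1#) * prodValue ps * u n
  diff-value g ps n = trans
    (+-cong (trans (prod-value g ps (suc n)) (*-congˡ (g n))) (-‿cong (prod-value g ps n)))
    (solve 3 (λ z a u → a :* (z :* u) :- a :* u := (z :- :1) :* a :* u) refl z _ _)

  geoValue-+ : ∀ m n → geoValue (m ℕ.+ n) ≈ geoValue m + power m * geoValue n
  geoValue-+ zero    n = solve 1 (λ x → x := :0 :+ :1 :* x) refl _
  geoValue-+ (suc m) n = trans (+-congˡ (*-congˡ (geoValue-+ m n)))
    (solve 4 (λ z a b c → :1 :+ z :* (a :+ b :* c)
      := (:1 :+ z :* a) :+ z :* b :* c) refl z _ _ _)

  geoValue-* : ∀ x m → ∃[ c ] geoValue (x ℕ.* m) ≈ c * geoValue m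
  geoValue-* zero    m = 0# , sym (zeroˡ _)
  geoValue-* (suc x) m with geoValue-* x m
  ... | c , eq = 1# + power m * c , trans (geoValue-+ m (x ℕ.* m)) (trans (+-congˡ (*-congˡ eq))
    (solve 3 (λ a b c → a :+ b :* (c :* a) := (:1 :+ b :* c) :* a) refl _ _ c))

  Comaximal : Carrier → Carrier → Set
  Comaximal a b = ∃[ s ] ∃[ t ] s * a + t * b ≈ 1#

  -- [1 + yn] = 1 + z [yn], where [yn] and [1 + yn] = [xm] are multiples of [n] and [m].
  geoValue-comaximal : ∀ {m n} → Coprime m n → Comaximal (geoValue m) (geoValue n)
  geoValue-comaximal {m} {n} coprime with coprime-Bézout coprime
  ... | Bézout.+- x y eq =
    let c , c-eq = geoValue-* x m
        d , d-eq = geoValue-* y n in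
    c , - (z * d) , (begin
      c * geoValue m + - (z * d) * geoValue n
        ≈⟨ solve 4 (λ z a d b → a :+ (:- (z :* d)) :* b := a :- z :* (d :* b)) refl z _ d _ ⟩
      c * geoValue m - z * (d * geoValue n)
        ≈⟨ +-cong (sym c-eq) (-‿cong (*-congˡ (sym d-eq))) ⟩
      geoValue (x ℕ.* m) - z * geoValue (y ℕ.* n)
        ≡⟨ ≡.cong (λ k → geoValue k - z * geoValue (y ℕ.* n)) (≡.sym eq) ⟩
      (1# + z * geoValue (y ℕ.* n)) - z * geoValue (y ℕ.* n)
        ≈⟨ solve 1 (λ a → (:1 :+ a) :- a := :1) refl _ ⟩
      1# ∎)
  ... | Bézout.-+ x y eq =
    let c , c-eq = geoValue-* x m
        d , d-eq = geoValue-* y n in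
    - (z * c) , d , (begin
      - (z * c) * geoValue m + d * geoValue n
        ≈⟨ solve 4 (λ z c a b → (:- (z :* c)) :* a :+ b := b :- z :* (c :* a)) refl z c _ _ ⟩
      d * geoValue n - z * (c * geoValue m)
        ≈⟨ +-cong (sym d-eq) (-‿cong (*-congˡ (sym c-eq))) ⟩
      geoValue (y ℕ.* n) - z * geoValue (x ℕ.* m)
        ≡⟨ ≡.cong (λ k → geoValue k - z * geoValue (x ℕ.* m)) (≡.sym eq) ⟩
      (1# + z * geoValue (x ℕ.* m)) - z * geoValue (x ℕ.* m)
        ≈⟨ solve 1 (λ a → (:1 :+ a) :- a := :1) refl _ ⟩
      1# ∎)

  prodValue-comaximal : ∀ {p ps} → All (Coprime p) ps → Comaximal (geoValue p) (prodValue ps)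
  prodValue-comaximal [] = 0# , 1# ,
    solve 1 (λ a → :0 :* a :+ :1 :* :1 := :1) refl _
  prodValue-comaximal {p} {q ∷ ps} (coprime ∷ coprimes) =
    let s , t , eq   = geoValue-comaximal coprime
        s′ , t′ , eq′ = prodValue-comaximal coprimes
        a = geoValue p
        b = geoValue q
        c = prodValue ps in
    s * (s′ * a + t′ * c) + t * b * s′ , t * t′ , (begin
      (s * (s′ * a + t′ * c) + t * b * s′) * a + t * t′ * (b * c)
        ≈⟨ solve 7 (λ s t s′ t′ a b c →
             (s :* (s′ :* a :+ t′ :* c) :+ t :* b :* s′) :* a :+ t :* t′ :* (b :* c)
             := (s :* a :+ t :* b) :* (s′ :* a :+ t′ :* c)) refl s t s′ t′ a b c ⟩
      (s * a + t * b) * (s′ * a + t′ * c)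
        ≈⟨ *-cong eq eq′ ⟩
      1# * 1#
        ≈⟨ *-identityˡ 1# ⟩
      1# ∎)

  -- The cofactor sum is invertible modulo the product. With a = [p](z), and c and b the product and
  -- cofactor sum of the tail, s (c + a b) = t a c shows that c divides s a, by induction, and that
  -- a divides s c. Expanding s = s (x a + y c)² leaves multiples of s a², s a c and s c², and each
  -- of them is a multiple of a c.
  prodValue-divides : ∀ {ps} → AllPairs Coprime ps → ∀ s t →
    s * cofactorsValue ps ≈ t * prodValue ps → ∃[ v ] v * prodValue ps ≈ s
  prodValue-divides [] s t eq = s , *-identityʳ s
  prodValue-divides {p ∷ ps} (coprimes ∷ pairs) s t eq =
    let x , y , xa+yc≈1 = prodValue-comaximal coprimes
        v , vc≈sa = prodValue-divides pairs (s * a) (t * a - s) sab≈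
    in (x * x * v + ι (+ 2) * (x * y * s) + y * y * (t * c - s * b)) , (begin
      (x * x * v + ι (+ 2) * (x * y * s) + y * y * (t * c - s * b)) * (a * c)
        ≈⟨ solve 8 (λ x y v s t a b c →
             (x :* x :* v :+ :2 :* (x :* y :* s) :+ y :* y :* (t :* c :- s :* b)) :* (a :* c)
             := x :* x :* a :* (v :* c) :+ :2 :* (x :* y :* s) :* (a :* c)
                :+ y :* y :* c :* (t :* (a :* c) :- s :* a :* b)) refl x y v s t a b c ⟩
      x * x * a * (v * c) + ι (+ 2) * (x * y * s) * (a * c) + y * y * c * (t * (a * c) - s * a * b)
        ≈⟨ +-cong (+-congʳ (*-congˡ vc≈sa)) (*-congˡ (+-congʳ (sym eq))) ⟩
      x * x * a * (s * a) + ι (+ 2) * (x * y * s) * (a * c)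
        + y * y * c * (s * (c + a * b) - s * a * b)
        ≈⟨ solve 6 (λ x y s a b c →
             x :* x :* a :* (s :* a) :+ :2 :* (x :* y :* s) :* (a :* c)
               :+ y :* y :* c :* (s :* (c :+ a :* b) :- s :* a :* b)
             := s :* ((x :* a :+ y :* c) :* (x :* a :+ y :* c))) refl x y s a b c ⟩
      s * ((x * a + y * c) * (x * a + y * c))
        ≈⟨ *-congˡ (*-cong xa+yc≈1 xa+yc≈1) ⟩
      s * (1# * 1#)
        ≈⟨ solve 1 (λ s → s :* (:1 :* :1) := s) refl s ⟩
      s ∎)
    where
    a = geoValue p
    b = cofactorsValue ps
    c = prodValue ps
    sab≈ : s * a * b ≈ (t * a - s) * c
    sab≈ = begin
      s * a * b
        ≈⟨ solve 4 (λ s a b c → s :* a :* b := s :* (c :+ a :* b) :- s :* c) refl s a b c ⟩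
      s * (c + a * b) - s * c
        ≈⟨ +-congʳ eq ⟩
      t * (a * c) - s * c
        ≈⟨ solve 4 (λ s t a c → t :* (a :* c) :- s :* c := (t :* a :- s) :* c) refl s t a c ⟩
      (t * a - s) * c ∎

  infix 4 _≡₁_
  _≡₁_ : Carrier → Carrier → Set
  a ≡₁ b = ∃[ h ] a ≈ b + (z - 1#) * h

  ≡₁-+ : ∀ {a b c d} → a ≡₁ b → c ≡₁ d → a + c ≡₁ b + d
  ≡₁-+ {b = b} {d = d} (h , eq) (k , eq′) = h + k , trans (+-cong eq eq′)
    (solve 5 (λ z b d h k → (b :+ z :* h) :+ (d :+ z :* k) := (b :+ d) :+ z :* (h :+ k))
      refl _ b d h k)

  ≡₁-* : ∀ {a b c d} → a ≡₁ b → c ≡₁ d → a * c ≡₁ b * d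
  ≡₁-* {b = b} {d = d} (h , eq) (k , eq′) = h * d + b * k + (z - 1#) * h * k , trans (*-cong eq eq′)
    (solve 5 (λ z b d h k → (b :+ z :* h) :* (d :+ z :* k)
      := b :* d :+ z :* (h :* d :+ b :* k :+ z :* h :* k)) refl _ b d h k)

  ≡₁-refl : ∀ {a b} → a ≈ b → a ≡₁ b
  ≡₁-refl eq = 0# , trans eq (solve 2 (λ z b → b := b :+ z :* :0) refl _ _)

  ≡₁-respʳ : ∀ {a b c} → b ≈ c → a ≡₁ b → a ≡₁ c
  ≡₁-respʳ eq (h , eq′) = h , trans eq′ (+-congʳ eq)

  geoValue-at1 : ∀ p → geoValue p ≡₁ ι (+ p)
  geoValue-at1 zero    = ≡₁-refl (sym ι-0)
  geoValue-at1 (suc p) = ≡₁-respʳ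
    (trans (+-cong (sym ι-1) (*-identityˡ _)) (sym (ι-+ (+ 1) (+ p))))
    (≡₁-+ (≡₁-refl refl) (≡₁-* (1# , solve 1 (λ z → z := :1 :+ (z :- :1) :* :1) refl z)
      (geoValue-at1 p)))

  ι-*ℕ : ∀ m n → ι (+ m) * ι (+ n) ≈ ι (+ (m ℕ.* n))
  ι-*ℕ m n = trans (sym (ι-* (+ m) (+ n))) (reflexive (≡.cong ι (≡.sym (ℤ.pos-* m n))))

  prodValue-at1 : ∀ ps → prodValue ps ≡₁ ι (+ prodAt1 ps)
  prodValue-at1 []       = ≡₁-refl (sym ι-1)
  prodValue-at1 (p ∷ ps) = ≡₁-respʳ (ι-*ℕ p (prodAt1 ps)) (≡₁-* (geoValue-at1 p) (prodValue-at1 ps))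

  cofactorsValue-at1 : ∀ ps → cofactorsValue ps ≡₁ ι (+ cofactorsAt1 ps)
  cofactorsValue-at1 []       = ≡₁-refl (sym ι-0)
  cofactorsValue-at1 (p ∷ ps) = ≡₁-respʳ
    (trans (+-congˡ (ι-*ℕ p _)) (sym (ι-+ _ _)))
    (≡₁-+ (prodValue-at1 ps) (≡₁-* (geoValue-at1 p) (cofactorsValue-at1 ps)))

  -- The cofactors generate the unit ideal together with ∏ [pᵢ](z), and they are
  -- congruent to the integer cofactorsAt1 ps modulo z − 1.
  root-bound : ∀ {ps} → AllPairs Coprime ps → ∀ c →
    (z - 1#) * c * prodValue ps ≈ cofactorsValue ps →
    ∃[ w ] w * ((z - 1#) * ((z - 1#) * prodValue ps))
      ≈ ι (+ cofactorsAt1 ps) * ι (+ cofactorsAt1 ps)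
  root-bound {ps} pairs c root =
    -- With s = 1 the divisibility says that the product is a unit at the zero.
    let v , vp≈1 = prodValue-divides pairs 1# ((z - 1#) * c) (trans (*-identityˡ _) (sym root))
        h , at1  = cofactorsValue-at1 ps
        p = prodValue ps
        N = ι (+ cofactorsAt1 ps)
        -- The relation of the zero and the congruence modulo z - 1 combine to (z - 1) g = N, so z -
        -- 1 divides an integer.
        g = c * p - h
        gz≈N : (z - 1#) * g ≈ N
        gz≈N = begin
          (z - 1#) * (c * p - h)
            ≈⟨ solve 4 (λ z c p h → z :* (c :* p :- h) := z :* c :* p :- z :* h) refl _ c p h ⟩
          (z - 1#) * c * p - (z - 1#) * h
            ≈⟨ +-congʳ (trans root at1) ⟩
          (N + (z - 1#) * h) - (z - 1#) * h
            ≈⟨ solve 2 (λ a b → (a :+ b) :- b := a) refl _ _ ⟩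
          N ∎
    in g * g * v , (begin
      g * g * v * ((z - 1#) * ((z - 1#) * p))
        ≈⟨ solve 4 (λ g v z p → g :* g :* v :* (z :* (z :* p)) := (z :* g) :* (z :* g) :* (v :* p))
             refl g v _ p ⟩
      ((z - 1#) * g) * ((z - 1#) * g) * (v * p)
        ≈⟨ *-cong (*-cong gz≈N gz≈N) vp≈1 ⟩
      N * N * 1#
        ≈⟨ *-identityʳ _ ⟩
      N * N ∎)

ℤ-algebra : ℤ-Algebra
ℤ-algebra = record
  { commutativeRing = ℤ.+-*-commutativeRing
  ; ι = λ i → i ; ι-+ = λ _ _ → ≡.refl ; ι-* = λ _ _ → ≡.refl ; ι-neg = λ _ → ≡.refl
  ; ι-0 = ≡.refl ; ι-1 = ≡.refl }

-- Integer sequences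

module IntegerSequences where
  open Shift ℤ-algebra
  open ≡ using (refl; sym; trans; cong; cong₂; subst)
  open ≡.≡-Reasoning

  Zero : Seq → Set
  Zero u = ∀ n → u n ≡ + 0

  Periodic : ℕ → Seq → Set
  Periodic p u = ∀ n → u (p ℕ.+ n) ≡ u n

  geo-zero⇒periodic : ∀ p {u} → Zero (geo p u) → Periodic p u
  geo-zero⇒periodic p {u} z n = begin
    u (p ℕ.+ n)                ≡⟨ sym (ℤ.+-identityʳ _) ⟩
    u (p ℕ.+ n) ℤ.+ + 0        ≡⟨ cong (ℤ._+_ (u (p ℕ.+ n))) (sym (z n)) ⟩
    u (p ℕ.+ n) ℤ.+ geo p u n  ≡⟨ geo-telescope p u n ⟩
    u n ℤ.+ geo p u (suc n)    ≡⟨ cong (ℤ._+_ (u n)) (z (suc n)) ⟩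
    u n ℤ.+ + 0                ≡⟨ ℤ.+-identityʳ _ ⟩
    u n                        ∎

  periodic-* : ∀ {p u} x → Periodic p u → Periodic (x ℕ.* p) u
  periodic-* zero    per n = refl
  periodic-* {p} {u} (suc x) per n = begin
    u (p ℕ.+ x ℕ.* p ℕ.+ n)    ≡⟨ cong u (ℕ.+-assoc p (x ℕ.* p) n) ⟩
    u (p ℕ.+ (x ℕ.* p ℕ.+ n))  ≡⟨ per (x ℕ.* p ℕ.+ n) ⟩
    u (x ℕ.* p ℕ.+ n)          ≡⟨ periodic-* x per n ⟩
    u n                        ∎

  periodic-coprime : ∀ {p q u} → Coprime p q → Periodic p u → Periodic q u → Periodic 1 u
  periodic-coprime {p} {q} {u} coprime per per′ n with coprime-Bézout coprime
  ... | Bézout.+- x y eq = begin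
    u (1 ℕ.+ n)                     ≡⟨ sym (periodic-* y per′ (1 ℕ.+ n)) ⟩
    u (y ℕ.* q ℕ.+ (1 ℕ.+ n))       ≡⟨ cong u (ℕ.+-suc (y ℕ.* q) n) ⟩
    u (1 ℕ.+ y ℕ.* q ℕ.+ n)         ≡⟨ cong (λ m → u (m ℕ.+ n)) eq ⟩
    u (x ℕ.* p ℕ.+ n)               ≡⟨ periodic-* x per n ⟩
    u n                             ∎
  ... | Bézout.-+ x y eq = begin
    u (1 ℕ.+ n)                     ≡⟨ sym (periodic-* x per (1 ℕ.+ n)) ⟩
    u (x ℕ.* p ℕ.+ (1 ℕ.+ n))       ≡⟨ cong u (ℕ.+-suc (x ℕ.* p) n) ⟩
    u (1 ℕ.+ x ℕ.* p ℕ.+ n)         ≡⟨ cong (λ m → u (m ℕ.+ n)) eq ⟩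
    u (y ℕ.* q ℕ.+ n)               ≡⟨ periodic-* y per′ n ⟩
    u n                             ∎

  private
    module At1 = Values ℤ-algebra (+ 1)

  -- At z = 1 the modulus z - 1 is 0, so the congruences of `Values` become equalities.
  at1 : ∀ a b → a At1.≡₁ b → a ≡ b
  at1 a b (h , eq) = trans eq (ℤ.+-identityʳ b)

  periodic⇒geometric : ∀ {u} → Periodic 1 u → Geometric (+ 1) u
  periodic⇒geometric {u} per n = trans (per n) (sym (ℤ.*-identityˡ (u n)))

  cancel : ∀ {m} i → 1 ℕ.≤ m → + m ℤ.* i ≡ + 0 → i ≡ + 0
  cancel {suc m} i (s≤s z≤n) eq with ℤ.i*j≡0⇒i≡0∨j≡0 (+ suc m) eq
  ... | inj₂ i≡0 = i≡0

  -- The kernels of [p] and [q] consist of sequences with periods p and q; coprime periods make u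
  -- constant, and [p] multiplies a constant by p.
  geo-kernels : ∀ {p q u} → 1 ℕ.≤ p → Coprime p q → Zero (geo p u) → Zero (geo q u) → Zero u
  geo-kernels {p} {q} {u} 1≤p coprime zp zq n = cancel (u n) 1≤p (begin
    + p ℤ.* u n                ≡⟨ cong (ℤ._* u n) (sym (at1 (At1.geoValue p) (+ p) (At1.geoValue-at1 p))) ⟩
    At1.geoValue p ℤ.* u n     ≡⟨ sym (At1.geo-value constant p n) ⟩
    geo p u n                  ≡⟨ zp n ⟩
    + 0                        ∎)
    where
    constant = periodic⇒geometric
      (periodic-coprime coprime (geo-zero⇒periodic p zp) (geo-zero⇒periodic q zq))

  geo-prod-kernels : ∀ {p ps u} → 1 ℕ.≤ p → All (Coprime p) ps →
    Zero (geo p u) → Zero (prod ps u) → Zero u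
  geo-prod-kernels 1≤p [] zp zps = zps
  geo-prod-kernels {p} {q ∷ ps} {u} 1≤p (coprime ∷ coprimes) zp zps =
    geo-kernels 1≤p coprime zp (geo-prod-kernels 1≤p coprimes
      (λ n → trans (sym (linear-geo (geo-linear q) p u n)) (null (geo-linear q) zp n)) zps)

  -- Modulo [p] the cofactor sum reduces to the single cofactor of p, which is coprime to [p]. For w
  -- = [p] u the induction hypothesis gives [p] w = 0, and the product of the tail kills w as well,
  -- so w = 0. Then the cofactor sum of u is just that product applied to u, and u = 0 in the same
  -- way.
  prod-cofactors-kernels : ∀ {ps u} → All (1 ℕ.≤_) ps → AllPairs Coprime ps →
    Zero (prod ps u) → Zero (cofactors ps u) → Zero u
  prod-cofactors-kernels [] [] zp zc = zp
  prod-cofactors-kernels {p ∷ ps} {u} (1≤p ∷ 1≤ps) (coprimes ∷ pairs) zp zc =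
    geo-prod-kernels 1≤p coprimes w≡0 λ n → begin
      prod ps u n                            ≡⟨ sym (ℤ.+-identityʳ _) ⟩
      prod ps u n ℤ.+ + 0                    ≡⟨ cong (ℤ._+_ (prod ps u n)) (sym (null (cofactors-linear ps) w≡0 n)) ⟩
      prod ps u n ℤ.+ cofactors ps w n       ≡⟨ zc n ⟩
      + 0                                    ∎
    where
    w = geo p u
    w≡0 : Zero w
    w≡0 = geo-prod-kernels 1≤p coprimes
      (prod-cofactors-kernels 1≤ps pairs
        (λ n → trans (linear-geo (prod-linear ps) p w n) (null (geo-linear p) zp n))
        (λ n → begin
          cofactors ps (geo p w) n
            ≡⟨ sym (ℤ.+-identityˡ _) ⟩
          + 0 ℤ.+ cofactors ps (geo p w) n
            ≡⟨ cong (ℤ._+ cofactors ps (geo p w) n) (sym (zp n)) ⟩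
          prod ps w n ℤ.+ cofactors ps (geo p w) n
            ≡⟨ linear-geo (cofactors-linear (p ∷ ps)) p u n ⟩
          geo p (cofactors (p ∷ ps) u) n
            ≡⟨ null (geo-linear p) zc n ⟩
          + 0 ∎))
      zp

  Δ : Seq → Seq
  Δ u n = u (suc n) ℤ.- u n

  Δ-linear : Linear Δ
  Δ-linear = −-linear suc-linear id-linear

  linear-Δ : ∀ {O} → Linear O → ∀ u n → O (Δ u) n ≡ Δ (O u) n
  linear-Δ {O} l u n = begin
    O (λ m → u (suc m) ℤ.- u m) n
      ≡⟨ resp l (λ m → lem (u (suc m)) (u m)) n ⟩
    O (λ m → + 1 ℤ.* u (suc m) ℤ.+ (ℤ.- + 1) ℤ.* u m) n
      ≡⟨ combine l (+ 1) (ℤ.- + 1) (u ∘ suc) u n ⟩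
    + 1 ℤ.* O (u ∘ suc) n ℤ.+ (ℤ.- + 1) ℤ.* O u n
      ≡⟨ sym (lem (O (u ∘ suc) n) (O u n)) ⟩
    O (u ∘ suc) n ℤ.- O u n
      ≡⟨ cong (ℤ._- O u n) (shift l u n) ⟩
    O u (suc n) ℤ.- O u n ∎
    where
    lem : ∀ a b → a ℤ.- b ≡ + 1 ℤ.* a ℤ.+ (ℤ.- + 1) ℤ.* b
    lem = solve 2 (λ a b → a :- b := con (+ 1) :* a :+ con (ℤ.- + 1) :* b) refl
      where open +-*-Solver

  Δ-zero⇒constant : ∀ {u} → Zero (Δ u) → Geometric (+ 1) u
  Δ-zero⇒constant {u} z n = trans (ℤ.i-j≡0⇒i≡j _ _ (z n)) (sym (ℤ.*-identityˡ (u n)))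

  constant-Δ : ∀ {u} → (∀ n → u (suc n) ≡ u n) → Zero (Δ u)
  constant-Δ {u} c n = trans (cong (ℤ._- u n) (c n)) (ℤ.+-inverseʳ (u n))

  tail : ℕ → Seq → Seq
  tail N u n = u (N ℕ.+ n)

  linear-tail : ∀ {O} → Linear O → ∀ N u n → O (tail N u) n ≡ tail N (O u) n
  linear-tail l zero    u n = refl
  linear-tail l (suc N) u n = trans (linear-tail l N (u ∘ suc) n) (shift l u (N ℕ.+ n))

  -- On a sequence supported at 0 a polynomial in the shift acts through its constant coefficient,
  -- which is 1 for [p]; `prod-impulse` and `cofactors-impulse` use the same principle.
  geo-impulse : ∀ {p t} → 1 ℕ.≤ p → Zero (t ∘ suc) → geo p t 0 ≡ t 0
  geo-impulse {suc p} {t} (s≤s z≤n) z = begin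
    t 0 ℤ.+ geo p t 1           ≡⟨ cong (ℤ._+_ (t 0)) (sym (shift (geo-linear p) t 0)) ⟩
    t 0 ℤ.+ geo p (t ∘ suc) 0   ≡⟨ cong (ℤ._+_ (t 0)) (null (geo-linear p) z 0) ⟩
    t 0 ℤ.+ + 0                 ≡⟨ ℤ.+-identityʳ (t 0) ⟩
    t 0                         ∎

  linear-impulse : ∀ {O t} → Linear O → Zero (t ∘ suc) → Zero (O t ∘ suc)
  linear-impulse {t = t} l z n = trans (sym (shift l t n)) (null l z n)

  prod-impulse : ∀ {ps t} → All (1 ℕ.≤_) ps → Zero (t ∘ suc) → prod ps t 0 ≡ t 0
  prod-impulse [] z = refl
  prod-impulse {p ∷ ps} (1≤p ∷ 1≤ps) z =
    trans (prod-impulse 1≤ps (linear-impulse (geo-linear p) z)) (geo-impulse 1≤p z)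

  cofactors-impulse : ∀ {ps t} → All (1 ℕ.≤_) ps → Zero (t ∘ suc) →
    cofactors ps t 0 ≡ + length ps ℤ.* t 0
  cofactors-impulse {t = t} [] z = refl
  cofactors-impulse {p ∷ ps} {t} (1≤p ∷ 1≤ps) z = begin
    prod ps t 0 ℤ.+ cofactors ps (geo p t) 0
      ≡⟨ cong₂ ℤ._+_ (prod-impulse 1≤ps z)
           (trans (cofactors-impulse 1≤ps (linear-impulse (geo-linear p) z))
             (cong (ℤ._*_ (+ length ps)) (geo-impulse 1≤p z))) ⟩
    t 0 ℤ.+ + length ps ℤ.* t 0
      ≡⟨ solve 2 (λ t k → t :+ k :* t := (con (+ 1) :+ k) :* t) refl (t 0) (+ length ps) ⟩
    + suc (length ps) ℤ.* t 0 ∎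
    where open +-*-Solver

  module Descent
    {p₁ : ℕ} {ps′ : List ℕ} (M : ℤ)
    (k+2≡2M : + length (p₁ ∷ ps′) ℤ.+ + 2 ≡ + 2 ℤ.* M)
    (1≤ps : All (1 ℕ.≤_) (p₁ ∷ ps′)) (coprime : AllPairs Coprime (p₁ ∷ ps′))
    (k≢M : + length (p₁ ∷ ps′) ≢ M) where

    ps : List ℕ
    ps = p₁ ∷ ps′

    open Recurrence ps M k+2≡2M

    recurrent-tail : ∀ {u} N → Recurrent u → Recurrent (tail N u)
    recurrent-tail {u} N rec n = begin
      diff ps (tail N u) (suc n)
        ≡⟨ linear-tail (diff-linear ps) N u (suc n) ⟩
      diff ps u (N ℕ.+ suc n)
        ≡⟨ cong (diff ps u) (ℕ.+-suc N n) ⟩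
      diff ps u (suc (N ℕ.+ n))
        ≡⟨ rec (N ℕ.+ n) ⟩
      M ℤ.* diff ps u (N ℕ.+ n) ℤ.+ cofactors ps u (N ℕ.+ n)
        ≡⟨ cong₂ (λ a b → M ℤ.* a ℤ.+ b) (sym (linear-tail (diff-linear ps) N u n))
             (sym (linear-tail (cofactors-linear ps) N u n)) ⟩
      M ℤ.* diff ps (tail N u) n ℤ.+ cofactors ps (tail N u) n ∎

    -- If only u 0 could be non-zero, the recurrence would reduce to (k - M) u(0) = 0; M - k is the
    -- constant coefficient of P and is not 0.
    zero-backwards : ∀ {u} → Recurrent u → Zero (u ∘ suc) → Zero u
    zero-backwards rec z (suc n) = z n
    zero-backwards {u} rec z zero with ℤ.i*j≡0⇒i≡0∨j≡0 (+ length ps ℤ.- M) {u 0} (begin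
      (+ length ps ℤ.- M) ℤ.* u 0
        ≡⟨ solve 3 (λ k m t → (k :- m) :* t := m :* (con (+ 0) :- t) :+ k :* t) refl
             (+ length ps) M (u 0) ⟩
      M ℤ.* (+ 0 ℤ.- u 0) ℤ.+ + length ps ℤ.* u 0
        ≡⟨ sym (cong₂ (λ a b → M ℤ.* a ℤ.+ b)
             (cong₂ ℤ._-_ (linear-impulse (prod-linear ps) z 0) (prod-impulse 1≤ps z))
             (cofactors-impulse 1≤ps z)) ⟩
      M ℤ.* diff ps u 0 ℤ.+ cofactors ps u 0
        ≡⟨ sym (rec 0) ⟩
      diff ps u 1
        ≡⟨ linear-impulse (diff-linear ps) z 0 ⟩
      + 0 ∎)
      where open +-*-Solver
    ... | inj₁ k-M≡0 = contradiction (ℤ.i-j≡0⇒i≡j _ _ k-M≡0) k≢M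
    ... | inj₂ u₀≡0  = u₀≡0

    zero-tail : ∀ {u} N → Recurrent u → Zero (tail N u) → Zero u
    zero-tail zero    rec z = z
    zero-tail (suc N) rec z =
      zero-backwards rec (zero-tail N (recurrent-tail 1 rec) z)

    constant⇒zero : ∀ {u} → Geometric (+ 1) u → Zero (cofactors ps u) → Zero u
    constant⇒zero {u} g z n = cancel (u n) (cofactorsAt1-positive 1≤ps) (begin
      + cofactorsAt1 ps ℤ.* u n          ≡⟨ cong (ℤ._* u n) (sym (at1 (At1.cofactorsValue ps) (+ cofactorsAt1 ps) (At1.cofactorsValue-at1 ps))) ⟩
      At1.cofactorsValue ps ℤ.* u n      ≡⟨ sym (At1.cofactors-value g ps n) ⟩
      cofactors ps u n                   ≡⟨ z n ⟩
      + 0                                ∎)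

    -- When x is constant, so is the cofactor sum x(n + 1) - M x(n). Thus the product and the
    -- cofactor sum both kill Δ²u, which vanishes by coprimality. Twice then, for Δu and for u, a
    -- constant sequence killed by the cofactor sum is 0, as the value of that sum at 1 is positive.
    constant-diff⇒zero : ∀ {u} → Recurrent u →
      (∀ n → diff ps u (suc n) ≡ diff ps u n) → Zero u
    constant-diff⇒zero {u} rec const =
      constant⇒zero u-constant λ n → begin
        cofactors ps u n
          ≡⟨ cofactors≡ n ⟩
        diff ps u n ℤ.- M ℤ.* diff ps u n
          ≡⟨ cong (λ d → d ℤ.- M ℤ.* d) (trans (sym (linear-Δ (prod-linear ps) u n))
               (null (prod-linear ps) Δu≡0 n)) ⟩
        + 0 ℤ.- M ℤ.* + 0
          ≡⟨ cong (ℤ._-_ (+ 0)) (ℤ.*-zeroʳ M) ⟩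
        + 0 ∎
      where
      cofactors≡ : ∀ n → cofactors ps u n ≡ diff ps u n ℤ.- M ℤ.* diff ps u n
      cofactors≡ n = begin
        cofactors ps u n
          ≡⟨ solve 2 (λ b m → b := (m :+ b) :- m) refl _ (M ℤ.* diff ps u n) ⟩
        (M ℤ.* diff ps u n ℤ.+ cofactors ps u n) ℤ.- M ℤ.* diff ps u n
          ≡⟨ cong (ℤ._- M ℤ.* diff ps u n) (trans (sym (rec n)) (const n)) ⟩
        diff ps u n ℤ.- M ℤ.* diff ps u n ∎
        where open +-*-Solver

      cofactors-Δ : Zero (cofactors ps (Δ u))
      cofactors-Δ n = trans (linear-Δ (cofactors-linear ps) u n)
        (constant-Δ {cofactors ps u} (λ m → trans (cofactors≡ (suc m))
          (trans (cong (λ d → d ℤ.- M ℤ.* d) (const m)) (sym (cofactors≡ m)))) n)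

      ΔΔu≡0 : Zero (Δ (Δ u))
      ΔΔu≡0 = prod-cofactors-kernels 1≤ps coprime
        (λ n → trans (linear-Δ (prod-linear ps) (Δ u) n)
          (constant-Δ {prod ps (Δ u)} (λ m → trans (linear-Δ (prod-linear ps) u (suc m))
            (trans (const m) (sym (linear-Δ (prod-linear ps) u m)))) n))
        (λ n → trans (linear-Δ (cofactors-linear ps) (Δ u) n)
          (null Δ-linear cofactors-Δ n))

      Δu≡0 : Zero (Δ u)
      Δu≡0 = constant⇒zero (Δ-zero⇒constant ΔΔu≡0) cofactors-Δ

      u-constant : Geometric (+ 1) u
      u-constant = Δ-zero⇒constant Δu≡0

    square-nonneg : ∀ i → + 0 ℤ.≤ i ℤ.* i
    square-nonneg (+ n)    = subst (+ 0 ℤ.≤_) (ℤ.pos-* n n) (ℤ.+≤+ z≤n)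
    square-nonneg -[1+ n ] = ℤ.+≤+ z≤n

    square-pos : ∀ {i} → i ≢ + 0 → + 1 ℤ.≤ i ℤ.* i
    square-pos {+ zero}   i≢0 = contradiction refl i≢0
    square-pos {+ suc n}  _   = ℤ.+≤+ (s≤s z≤n)
    square-pos { -[1+ n ]} _  = ℤ.+≤+ (s≤s z≤n)

    lyapunov-antitone : ∀ {u} → Recurrent u → ∀ N n → lyapunov u (N ℕ.+ n) ℤ.≤ lyapunov u N
    lyapunov-antitone {u} rec N zero =
      ℤ.≤-reflexive (cong (lyapunov u) (ℕ.+-identityʳ N))
    lyapunov-antitone {u} rec N (suc n) = ℤ.≤-trans
      (ℤ.≤-reflexive (trans (cong (lyapunov u) (ℕ.+-suc N n)) (lyapunov-drift rec (N ℕ.+ n))))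
      (ℤ.≤-trans (ℤ.+-monoʳ-≤ (lyapunov u (N ℕ.+ n)) (ℤ.neg-mono-≤ (square-nonneg (Δ (diff ps u) (N ℕ.+ n)))))
        (ℤ.≤-trans (ℤ.≤-reflexive (ℤ.+-identityʳ _)) (lyapunov-antitone rec N n)))

    -- The integer-valued Lyapunov function cannot decrease forever, and once it is
    -- constant so is diff ps u.
    lyapunov-nonneg⇒zero : ∀ {u} → Recurrent u → (∀ n → + 0 ℤ.≤ lyapunov u n) → Zero u
    lyapunov-nonneg⇒zero {u} rec nonneg n =
      -- Whether x ever changes again cannot be decided, so the descent only refutes u n ≠ 0;
      -- decidable equality in ℤ removes the double negation.
      decidable-stable (u n ℤ.≟ + 0) λ u≢0 → descend ℤ.∣ lyapunov u 0 ∣ 0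
        (ℤ.≤-reflexive (sym (ℤ.0≤i⇒+∣i∣≡i (nonneg 0)))) (λ z → u≢0 (z n))
      where
      descend : ∀ v N → lyapunov u N ℤ.≤ + v → ¬ Zero u → ⊥
      step : ∀ v N → lyapunov u N ℤ.≤ + v → ¬ Zero u →
        ∀ n → diff ps u (suc (N ℕ.+ n)) ≢ diff ps u (N ℕ.+ n) → ⊥

      descend v N bound ¬zero = ¬zero (zero-tail N rec (constant-diff⇒zero (recurrent-tail N rec)
        λ n → trans (linear-tail (diff-linear ps) N u (suc n))
          (trans (cong (diff ps u) (ℕ.+-suc N n))
            (trans (decidable-stable (_ ℤ.≟ _) (step v N bound ¬zero n))
              (sym (linear-tail (diff-linear ps) N u n))))))

      step v N bound ¬zero n changes = continue v (ℤ.≤-trans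
        (ℤ.≤-reflexive (lyapunov-drift rec (N ℕ.+ n)))
        (ℤ.+-mono-≤ (ℤ.≤-trans (lyapunov-antitone rec N n) bound)
          (ℤ.neg-mono-≤ (square-pos (λ eq → changes (ℤ.i-j≡0⇒i≡j _ _ eq))))))
        where
        continue : ∀ v → lyapunov u (suc (N ℕ.+ n)) ℤ.≤ + v ℤ.- + 1 → ⊥
        continue zero    le with ℤ.≤-trans (nonneg (suc (N ℕ.+ n))) le
        ... | ()
        continue (suc v) le = descend v (suc (N ℕ.+ n)) le ¬zero

-- The sum of the zeros

module Vieta (A : ℤ-Algebra) where
  open ℤ-Algebra A
  open IntegerSolver A
  open Relation.Binary.Reasoning.Setoid setoid

  Δ : (ℕ → Carrier) → ℕ → Carrier
  Δ f k = f (suc k) - f k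

  -- f agrees on ℕ with a polynomial t Xⁿ + (lower terms): its n-th difference is n! t.
  Leading : ℕ → Carrier → (ℕ → Carrier) → Set
  Leading zero    t f = ∀ k → f k ≈ t
  Leading (suc n) t f = Leading n (ι (+ suc n) * t) (Δ f)

  leading-resp : ∀ n {s t f g} → s ≈ t → (∀ k → f k ≈ g k) → Leading n s f → Leading n t g
  leading-resp zero    s≈t f≈g l k = trans (sym (f≈g k)) (trans (l k) s≈t)
  leading-resp (suc n) s≈t f≈g l = leading-resp n (*-congˡ s≈t)
    (λ k → +-cong (f≈g (suc k)) (-‿cong (f≈g k))) l

  leading-+ : ∀ n {s t f g} → Leading n s f → Leading n t g →
    Leading n (s + t) (λ k → f k + g k)
  leading-+ zero    l l′ k = +-cong (l k) (l′ k)
  leading-+ (suc n) l l′ = leading-resp n (sym (distribˡ _ _ _))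
    (λ k → solve 4 (λ a b c d → (a :- b) :+ (c :- d) := (a :+ c) :- (b :+ d)) refl _ _ _ _)
    (leading-+ n l l′)

  leading-* : ∀ n c {t f} → Leading n t f → Leading n (c * t) (λ k → c * f k)
  leading-* zero    c l k = *-congˡ (l k)
  leading-* (suc n) c l = leading-resp n
    (solve 3 (λ c m t → c :* (m :* t) := m :* (c :* t)) refl c _ _)
    (λ k → solve 3 (λ c a b → c :* (a :- b) := c :* a :- c :* b) refl c _ _)
    (leading-* n c l)

  leading-suc : ∀ n {t f} → Leading n t f → Leading n t (f ∘ suc)
  leading-suc zero    l k = l (suc k)
  leading-suc (suc n) l = leading-suc n l

  leading-Δ : ∀ n {t f} → Leading n t f → Leading n 0# (Δ f)
  leading-Δ zero    l k = trans (+-cong (l (suc k)) (-‿cong (l k))) (-‿inverseʳ _)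
  leading-Δ (suc n) l = leading-resp n (sym (zeroʳ _)) (λ _ → refl) (leading-Δ n l)

  leading-lift : ∀ n {t f} → Leading n t f → Leading (suc n) 0# f
  leading-lift n l = leading-resp n (sym (zeroʳ _)) (λ _ → refl) (leading-Δ n l)

  leading-const : ∀ n c → Leading (suc n) 0# (λ _ → c)
  leading-const zero    c = leading-lift 0 λ _ → refl
  leading-const (suc n) c = leading-lift (suc n) (leading-const n c)

  ι-suc : ∀ n → ι (+ suc n) ≈ 1# + ι (+ n)
  ι-suc n = trans (ι-+ (+ 1) (+ n)) (+-congʳ ι-1)

  -- Multiplication by X obeys the product rule Δ(k f(k)) = k Δf(k) + f(k + 1); the two leading
  -- coefficients add up to the new degree times t.
  leading-index : ∀ n {t f} → Leading n t f → Leading (suc n) t (λ k → ι (+ k) * f k)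
  leading-index zero {t} {f} l k = begin
    ι (+ suc k) * f (suc k) - ι (+ k) * f k
      ≈⟨ +-cong (*-cong (ι-suc k) (l (suc k))) (-‿cong (*-congˡ (l k))) ⟩
    (1# + ι (+ k)) * t - ι (+ k) * t
      ≈⟨ solve 2 (λ k t → (:1 :+ k) :* t :- k :* t := :1 :* t) refl _ t ⟩
    1# * t
      ≈⟨ *-congʳ (sym ι-1) ⟩
    ι (+ 1) * t ∎
  leading-index (suc n) {t} {f} l = leading-resp (suc n)
    (trans (solve 2 (λ m t → m :* t :+ t := (:1 :+ m) :* t) refl _ t)
      (*-congʳ (sym (ι-suc (suc n)))))
    (λ k → trans
      (solve 3 (λ k f f′ → k :* (f′ :- f) :+ f′ := (:1 :+ k) :* f′ :- k :* f) refl _ _ _)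
      (+-congʳ (*-congʳ (sym (ι-suc k)))))
    (leading-+ (suc n) (leading-index n l) (leading-suc (suc n) l))

  evaluate : ∀ {d} → Vec ℤ d → Carrier → Carrier
  evaluate []      w = 1#
  evaluate (c ∷ p) w = ι c + w * evaluate p w

  fromRoots : ∀ {d} → Vec Carrier d → Carrier → Carrier
  fromRoots []       w = 1#
  fromRoots (z ∷ zs) w = (w - z) * fromRoots zs w

  sumRoots : ∀ {d} → Vec Carrier d → Carrier
  sumRoots []       = 0#
  sumRoots (z ∷ zs) = z + sumRoots zs

  power : ℕ → Carrier → Carrier
  power zero    w = 1#
  power (suc n) w = w * power n w

  -- Subtracting the top power makes the second coefficient the leading one, which `Leading` can
  -- detect.
  evaluate-second : ∀ {d} (p : Vec ℤ (suc d)) →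
    Leading d (ι (second p)) (λ k → evaluate p (ι (+ k)) - power (suc d) (ι (+ k)))
  evaluate-second (c ∷ [])    k =
    solve 2 (λ c k → (c :+ k :* :1) :- k :* :1 := c) refl _ _
  evaluate-second {suc d} (c ∷ p@(_ ∷ _)) = leading-resp (suc d) (+-identityˡ _)
    (λ k → solve 4 (λ c k e w → c :+ k :* (e :- w) := (c :+ k :* e) :- k :* w) refl _ _ _ _)
    (leading-+ (suc d) (leading-const d (ι c)) (leading-index d (evaluate-second p)))

  fromRoots-monic : ∀ {d} (zs : Vec Carrier d) → Leading d 1# (λ k → fromRoots zs (ι (+ k)))
  fromRoots-monic []           k = refl
  fromRoots-monic {suc d} (z ∷ zs) = leading-resp (suc d)
    (+-identityʳ 1#)
    (λ k → solve 3 (λ k z q → k :* q :+ (:- z) :* q := (k :- z) :* q) refl _ z _)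
    (leading-+ (suc d) (leading-index d (fromRoots-monic zs))
      (leading-lift d (leading-* d (- z) (fromRoots-monic zs))))

  fromRoots-second : ∀ {d} (zs : Vec Carrier (suc d)) →
    Leading d (- sumRoots zs) (λ k → fromRoots zs (ι (+ k)) - power (suc d) (ι (+ k)))
  fromRoots-second (z ∷ []) k =
    solve 2 (λ z k → (k :- z) :* :1 :- k :* :1 := :- (z :+ :0)) refl z _
  fromRoots-second {suc d} (z ∷ zs@(_ ∷ _)) = leading-resp (suc d)
    (solve 2 (λ z s → :- s :+ (:- z) :* :1 := :- (z :+ s)) refl z _)
    (λ k → solve 4 (λ k z q w → k :* (q :- w) :+ (:- z) :* q := (k :- z) :* q :- k :* w)
      refl _ z _ _)
    (leading-+ (suc d) (leading-index d (fromRoots-second zs))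
      (leading-* (suc d) (- z) (fromRoots-monic zs)))

  module _ (torsion-free : ∀ n {t} → ι (+ suc n) * t ≈ 0# → t ≈ 0#) where

    leading-0 : ∀ n {t f} → (∀ k → f k ≈ 0#) → Leading n t f → t ≈ 0#
    leading-0 zero    f≈0 l = trans (sym (l 0)) (f≈0 0)
    leading-0 (suc n) f≈0 l = torsion-free n (leading-0 n
      (λ k → trans (+-cong (f≈0 (suc k)) (-‿cong (f≈0 k))) (-‿inverseʳ 0#)) l)

    -- The hypothesis compares values, not coefficients. Sampling at the natural numbers and
    -- differencing d - 1 times isolates (d - 1)! times the difference of the second coefficients,
    -- and torsion-freeness removes the factorial.
    vieta : ∀ {d} (p : Vec ℤ d) → 0 ℕ.< d → (zs : Vec Carrier d) →
      (∀ w → evaluate p w ≈ fromRoots zs w) →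
      sumRoots zs ≈ - ι (second p)
    vieta {suc d} p _ zs eq = begin
      sumRoots zs
        ≈⟨ solve 2 (λ s c → s := (c :+ (:- :1) :* (:- s)) :- c) refl _ (ι (second p)) ⟩
      (ι (second p) + (- 1#) * (- sumRoots zs)) - ι (second p)
        ≈⟨ +-congʳ (leading-0 d
             (λ k → trans (+-congʳ (+-congʳ (eq (ι (+ k)))))
               (solve 2 (λ q w → (q :- w) :+ (:- :1) :* (q :- w) := :0) refl _ _))
             (leading-+ d (evaluate-second p) (leading-* d (- 1#) (fromRoots-second {d} zs)))) ⟩
      0# - ι (second p)
        ≈⟨ +-identityˡ _ ⟩
      - ι (second p) ∎

module PisotValues (A : ℤ-Algebra) where
  open ℤ-Algebra A
  open IntegerSolver A
  open Shift A
  open PolynomialAction A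
  open PisotPolynomial A
  open Vieta A using (evaluate)
  open Relation.Binary.Reasoning.Setoid setoid

  evaluate-cong : ∀ {d} (p : Vec ℤ d) {w z} → w ≈ z → evaluate p w ≈ evaluate p z
  evaluate-cong []      w≈z = refl
  evaluate-cong (c ∷ p) w≈z = +-congˡ (*-cong w≈z (evaluate-cong p w≈z))

  monicAct-geometric : ∀ {d} (p : Vec ℤ d) {w u} → Geometric w u → ∀ n →
    monicAct p u n ≈ evaluate p w * u n
  monicAct-geometric []      g n = refl
  monicAct-geometric (c ∷ p) {w} {u} g n = trans
    (+-congˡ (trans (monicAct-geometric p g (suc n)) (*-congˡ (g n))))
    (solve 4 (λ c e w u → c :* u :+ e :* (w :* u) := (c :+ w :* e) :* u) refl _ _ w _)

  root-recurrent : ∀ {ps} M → All (1 ℕ.≤_) ps → ∀ {w u} → Geometric w u →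
    evaluate (pisotPolynomial ps M) w ≈ 0# →
    ∀ n → diff ps u (suc n) ≈ ι M * diff ps u n + cofactors ps u n
  root-recurrent {ps} M 1≤ps {w} {u} g root n = begin
    diff ps u (suc n)
      ≈⟨ solve 2 (λ a b → a := (a :- b) :+ b) refl _ r ⟩
    (diff ps u (suc n) - r) + r
      ≈⟨ +-congʳ (sym (pisotPolynomial-act M 1≤ps u n)) ⟩
    monicAct (pisotPolynomial ps M) u n + r
      ≈⟨ +-congʳ (trans (monicAct-geometric (pisotPolynomial ps M) g n)
           (trans (*-congʳ root) (zeroˡ _))) ⟩
    0# + r
      ≈⟨ +-identityˡ r ⟩
    r ∎
    where r = ι M * diff ps u n + cofactors ps u n

  module _ (z : Carrier) where
    open Values A z

    power-geometric : Geometric z power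
    power-geometric n = refl

    evaluate-pisot : ∀ {ps} M → All (1 ℕ.≤_) ps → evaluate (pisotPolynomial ps M) z
      ≈ (z - 1#) * (z - ι M) * prodValue ps - cofactorsValue ps
    evaluate-pisot {ps} M 1≤ps = begin
      evaluate (pisotPolynomial ps M) z
        ≈⟨ sym (*-identityʳ _) ⟩
      evaluate (pisotPolynomial ps M) z * 1#
        ≈⟨ sym (monicAct-geometric (pisotPolynomial ps M) power-geometric 0) ⟩
      monicAct (pisotPolynomial ps M) power 0
        ≈⟨ pisotPolynomial-act M 1≤ps power 0 ⟩
      diff ps power 1 - (ι M * diff ps power 0 + cofactors ps power 0)
        ≈⟨ +-cong (diff-value power-geometric ps 1) (-‿cong (+-cong
             (*-congˡ (diff-value power-geometric ps 0)) (cofactors-value power-geometric ps 0))) ⟩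
      (z - 1#) * prodValue ps * (z * 1#)
        - (ι M * ((z - 1#) * prodValue ps * 1#) + cofactorsValue ps * 1#)
        ≈⟨ solve 4 (λ z m p c →
             (z :- :1) :* p :* (z :* :1)
               :- (m :* ((z :- :1) :* p :* :1) :+ c :* :1)
             := (z :- :1) :* (z :- m) :* p :- c) refl z (ι M) _ _ ⟩
      (z - 1#) * (z - ι M) * prodValue ps - cofactorsValue ps ∎

    root-values : ∀ {ps} M → All (1 ℕ.≤_) ps → evaluate (pisotPolynomial ps M) z ≈ 0# →
      (z - 1#) * (z - ι M) * prodValue ps ≈ cofactorsValue ps
    root-values {ps} M 1≤ps root = begin
      r                                ≈⟨ solve 2 (λ r c → r := (r :- c) :+ c) refl r c ⟩
      (r - c) + c                      ≈⟨ +-congʳ (trans (sym (evaluate-pisot {ps} M 1≤ps)) root) ⟩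
      0# + c                           ≈⟨ +-identityˡ c ⟩
      c                                ∎
      where
      r = (z - 1#) * (z - ι M) * prodValue ps
      c = cofactorsValue ps

    -- A divisor of a positive integer is bounded away from 0; this makes |z - 1|² |x(0)|² positive
    -- with an explicit bound, without any division.
    root-unit : ∀ {ps} M → All (1 ℕ.≤_) ps → AllPairs Coprime ps →
      evaluate (pisotPolynomial ps M) z ≈ 0# →
      ∃[ w ] w * ((z - 1#) * diff ps power 0) ≈ ι (+ cofactorsAt1 ps) * ι (+ cofactorsAt1 ps)
    root-unit {ps} M 1≤ps pairs root =
      let w , eq = root-bound pairs (z - ι M) (root-values M 1≤ps root) in
      w , trans (*-congˡ (*-congˡ (trans (diff-value power-geometric ps 0) (*-identityʳ _)))) eq

-- Zeros in an ordered algebra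

-- Modelled on constructive ℝ, where neither predicate is the negation of the other; `pos-cancel`
-- and `¬pos⇒≈0` take the place of case distinctions on the sign.
record OrderedAlgebra : Set₁ where
  field algebra : ℤ-Algebra
  open ℤ-Algebra algebra public
  field
    NonNeg Pos    : Carrier → Set
    nonNeg-resp   : ∀ {x y} → x ≈ y → NonNeg x → NonNeg y
    nonNeg-0      : NonNeg 0#
    nonNeg-+      : ∀ {x y} → NonNeg x → NonNeg y → NonNeg (x + y)
    nonNeg-square : ∀ x → NonNeg (x * x)
    nonNeg-*      : ∀ {x y} → Pos x → NonNeg y → NonNeg (x * y)
    nonNeg-cancel : ∀ {x y} → Pos x → NonNeg (x * y) → NonNeg y
    nonNeg-antisym : ∀ {x} → NonNeg x → NonNeg (- x) → x ≈ 0#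
    square≈0      : ∀ {x} → NonNeg (- (x * x)) → x ≈ 0#
    pos⇒nonNeg    : ∀ {x} → Pos x → NonNeg x
    pos-resp      : ∀ {x y} → x ≈ y → Pos x → Pos y
    ¬pos-0        : ¬ Pos 0#
    pos-1         : Pos 1#
    pos-+-nonNeg  : ∀ {x y} → Pos x → NonNeg y → Pos (x + y)
    pos-*         : ∀ {x y} → Pos x → Pos y → Pos (x * y)
    pos-cancel    : ∀ {x y} → NonNeg x → Pos (x * y) → Pos y
    ¬pos⇒≈0       : ∀ {x} → ¬ Pos (x * x) → x ≈ 0#

module Ordered (O : OrderedAlgebra) where
  open OrderedAlgebra O
  open IntegerSolver algebra
  open Shift algebra
  open Relation.Binary.Reasoning.Setoid setoid

  pos-ι : ∀ n → Pos (ι (+ suc n))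
  pos-ι zero    = pos-resp (sym ι-1) pos-1
  pos-ι (suc n) = pos-resp (trans (+-congʳ (sym ι-1)) (sym (ι-+ (+ 1) (+ suc n))))
    (pos-+-nonNeg pos-1 (pos⇒nonNeg (pos-ι n)))

  convolveSquares-nonneg : ∀ p l m u₀ u n → NonNeg (convolveSquares p l m u₀ u n)
  convolveSquares-nonneg zero    l m u₀ u n = nonNeg-0
  convolveSquares-nonneg (suc p) l m u₀ u n =
    nonNeg-+ (nonNeg-square _) (convolveSquares-nonneg p l m u₀ u (suc n))

  convolvesSquares-nonneg : ∀ ps l m u₀ u n → NonNeg (convolvesSquares ps l m u₀ u n)
  convolvesSquares-nonneg []       l m u₀ u n = nonNeg-0
  convolvesSquares-nonneg (p ∷ ps) l m u₀ u n = nonNeg-+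
    (convolveSquares-nonneg p l m (prod ps u₀) (prod ps u) n)
    (convolvesSquares-nonneg ps l m (geo p u₀) (geo p u) n)

  module _ {a : Carrier} (1<a : Pos (a - 1#)) where
    open Values algebra a

    pos-base : Pos a
    pos-base = pos-resp (solve 1 (λ a → (a :- :1) :+ :1 := a) refl a)
      (pos-+-nonNeg 1<a (pos⇒nonNeg pos-1))

    nonNeg-geoValue : ∀ p → NonNeg (geoValue p)
    nonNeg-geoValue zero    = nonNeg-0
    nonNeg-geoValue (suc p) = nonNeg-+ (pos⇒nonNeg pos-1) (nonNeg-* pos-base (nonNeg-geoValue p))

    pos-prodValue : ∀ {ps} → All (1 ℕ.≤_) ps → Pos (prodValue ps)
    pos-prodValue [] = pos-1
    pos-prodValue {suc p ∷ ps} (s≤s z≤n ∷ 1≤ps) =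
      pos-* (pos-+-nonNeg pos-1 (nonNeg-* pos-base (nonNeg-geoValue p))) (pos-prodValue 1≤ps)

    module _ (ps : List ℕ) (M : ℤ) (k+2≡2M : + length ps ℤ.+ + 2 ≡ + 2 ℤ.* M)
      (1≤ps : All (1 ℕ.≤_) ps) where
      open Recurrence ps M k+2≡2M

      -- By `component-bound` and cancellation of positive factors, 2 E ≥ (a + 1) x²; adding (a - 1)
      -- x² ≥ 0 gives 2 (E - x²) ≥ 0.
      lyapunov-nonneg : Recurrent power →
        ∀ {u n} → component power u n ≈ 0# → NonNeg (lyapunov u n)
      lyapunov-nonneg rec₀ {u} {n} comp≈0 = nonNeg-cancel (pos-ι 1)
        (nonNeg-resp
          (solve 3 (λ e a x → (:2 :* e :- (a :+ :1) :* (x :* x))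
               :+ (a :- :1) :* (x :* x)
             := :2 :* (e :- x :* x)) refl _ a (diff ps u n))
          (nonNeg-+
            (nonNeg-cancel
              (pos-* 1<a (pos-* (pos-ι 1) (pos-* pos-x₀ pos-x₀)))
              (nonNeg-resp (component-bound (power-geometric algebra a) rec₀ n comp≈0)
                (nonNeg-* 1<a (convolvesSquares-nonneg ps _ _ power u n))))
            (nonNeg-* 1<a (nonNeg-square (diff ps u n)))))
        where
        open PisotValues
        pos-x₀ : Pos (diff ps power 0)
        pos-x₀ = pos-resp (sym (diff-value (power-geometric algebra a) ps 0))
          (pos-* (pos-* 1<a (pos-prodValue 1≤ps)) pos-1)

-- Transport of sequences along additive maps and along ℤ → A

module AdditiveMap (A B : ℤ-Algebra) where
  private
    module A = ℤ-Algebra A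
    module S = Shift A
  open Shift B
  open ℤ-Algebra B

  -- Only additivity is assumed because real and imaginary part are not multiplicative; integer
  -- scalars enter separately through `f-ι`.
  module Along (f : A.Carrier → Carrier) (f-0 : f A.0# ≈ 0#)
    (f-+ : ∀ x y → f (x A.+ y) ≈ f x + f y) (f-neg : ∀ x → f (A.- x) ≈ - f x) where

    map-minus : ∀ x y → f (x A.- y) ≈ f x - f y
    map-minus x y = trans (f-+ x (A.- y)) (+-congˡ (f-neg y))

    map-geo : ∀ p u n → f (S.geo p u n) ≈ geo p (f ∘ u) n
    map-geo zero    u n = f-0
    map-geo (suc p) u n = trans (f-+ (u n) (S.geo p u (suc n))) (+-congˡ (map-geo p u (suc n)))

    map-prod : ∀ ps u n → f (S.prod ps u n) ≈ prod ps (f ∘ u) n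
    map-prod []       u n = refl
    map-prod (p ∷ ps) u n = trans (map-prod ps (S.geo p u) n) (resp (prod-linear ps) (map-geo p u) n)

    map-cofactors : ∀ ps u n → f (S.cofactors ps u n) ≈ cofactors ps (f ∘ u) n
    map-cofactors []       u n = f-0
    map-cofactors (p ∷ ps) u n = trans
      (f-+ (S.prod ps u n) (S.cofactors ps (S.geo p u) n))
      (+-cong (map-prod ps u n)
        (trans (map-cofactors ps (S.geo p u) n) (resp (cofactors-linear ps) (map-geo p u) n)))

    map-diff : ∀ ps u n → f (S.diff ps u n) ≈ diff ps (f ∘ u) n
    map-diff ps u n = trans (map-minus (S.prod ps u (suc n)) (S.prod ps u n))
      (+-cong (map-prod ps u (suc n)) (-‿cong (map-prod ps u n)))

    module _ (f-cong : ∀ {x y} → x A.≈ y → f x ≈ f y) (f-ι : ∀ i x → f (A.ι i A.* x) ≈ ι i * f x) where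

      map-recurrent : ∀ ps M {u} →
        (∀ n → S.diff ps u (suc n) A.≈ A.ι M A.* S.diff ps u n A.+ S.cofactors ps u n) →
        ∀ n → diff ps (f ∘ u) (suc n) ≈ ι M * diff ps (f ∘ u) n + cofactors ps (f ∘ u) n
      map-recurrent ps M {u} rec n = trans (sym (map-diff ps u (suc n))) (trans (f-cong (rec n))
        (trans (f-+ (A.ι M A.* S.diff ps u n) (S.cofactors ps u n))
          (+-cong (trans (f-ι M (S.diff ps u n)) (*-congˡ (map-diff ps u n))) (map-cofactors ps u n))))

module Embedding (A : ℤ-Algebra) where
  open ℤ-Algebra A
  open Shift A
  open AdditiveMap.Along ℤ-algebra A ι ι-0 ι-+ ι-neg public
    renaming ( map-minus to ι-minus; map-geo to ι-geo; map-prod to ι-prod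
             ; map-cofactors to ι-cofactors; map-diff to ι-diff )
  private
    module ℤS = Shift ℤ-algebra

  energy-cong : ∀ ps {u v} → u ≋ v → energy ps u ≋ energy ps v
  energy-cong []       u≋v n = refl
  energy-cong (p ∷ ps) u≋v n = +-cong
    (resp (geo-linear p) (λ m → *-cong (resp (prod-linear ps) u≋v m) (resp (prod-linear ps) u≋v m)) n)
    (energy-cong ps (resp (geo-linear p) u≋v) n)

  ι-energy : ∀ ps u n → ι (ℤS.energy ps u n) ≈ energy ps (ι ∘ u) n
  ι-energy []       u n = ι-0
  ι-energy (p ∷ ps) u n = trans (ι-+ (ℤS.geo p (ℤS.square y) n) _) (+-cong
    (trans (ι-geo p (ℤS.square y) n)
      (resp (geo-linear p) (λ m → trans (ι-* (y m) (y m)) (*-cong (ι-prod ps u m) (ι-prod ps u m))) n))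
    (trans (ι-energy ps (ℤS.geo p u) n) (energy-cong ps (ι-geo p u) n)))
    where y = ℤS.prod ps u

  ι-act : ∀ {d} (p : Vec ℤ d) t u n → ι (ℤS.act p t u n) ≈ act (Vec.map ι p) (ι t) (ι ∘ u) n
  ι-act []      t u n = ι-* t (u n)
  ι-act (c ∷ p) t u n = trans (ι-+ (c ℤ.* u n) _)
    (+-cong (ι-* c (u n)) (ι-act p t u (suc n)))

  evaluateAt : ∀ {d} → Vec Carrier d → Carrier → Carrier → Carrier
  evaluateAt []      t a = t
  evaluateAt (c ∷ p) t a = c + a * evaluateAt p t a

  act-geometric : ∀ {d} (p : Vec Carrier d) t {a u} → Geometric a u → ∀ n →
    act p t u n ≈ evaluateAt p t a * u n
  act-geometric []      t g n = refl
  act-geometric (c ∷ p) t {a} {u} g n = trans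
    (+-congˡ (trans (act-geometric p t g (suc n)) (*-congˡ (g n))))
    (solve 4 (λ c e a u → c :* u :+ e :* (a :* u) := (c :+ a :* e) :* u) refl _ _ a _)
    where open IntegerSolver A

  module _ (ps : List ℕ) (M : ℤ) (k+2≡2M : + length ps ℤ.+ + 2 ≡ + 2 ℤ.* M) where
    open Recurrence ps M k+2≡2M
    private
      module ℤR = ℤS.Recurrence ps M k+2≡2M

    ι-recurrent : ∀ {u} → ℤR.Recurrent u → Recurrent (ι ∘ u)
    ι-recurrent {u} =
      map-recurrent (λ i≡j → reflexive (≡.cong ι i≡j)) ι-* ps M {u}

    ι-lyapunov : ∀ u n → ι (ℤR.lyapunov u n) ≈ lyapunov (ι ∘ u) n
    ι-lyapunov u n = trans (ι-minus (ℤS.energy ps u n) (ℤS.square (ℤS.diff ps u) n)) (+-cong (ι-energy ps u n)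
      (-‿cong (trans (ι-* (ℤS.diff ps u n) (ℤS.diff ps u n)) (*-cong (ι-diff ps u n) (ι-diff ps u n)))))

-- Integer solutions with prescribed initial values

module IntegerRecurrence where
  open Shift ℤ-algebra
  open PolynomialAction ℤ-algebra
  open ≡ using (refl; sym; trans; cong; cong₂)

  δ : ℕ → ℕ → ℤ
  δ zero    zero    = + 1
  δ zero    (suc _) = + 0
  δ (suc d) zero    = + 0
  δ (suc d) (suc j) = δ d j

  act-δ : ∀ {d} (p : Vec ℤ d) t → act p t (δ d) 0 ≡ t
  act-δ []          t = ℤ.*-identityʳ t
  act-δ {suc d} (c ∷ p) t = trans
    (cong₂ ℤ._+_ (ℤ.*-zeroʳ c) (trans (sym (shift (act-linear p t) (δ (suc d)) 0)) (act-δ p t)))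
    (ℤ.+-identityˡ t)

  δ-< : ∀ {d j} → j ℕ.< d → δ d j ≡ + 0
  δ-< {suc d} {zero}  _         = refl
  δ-< {suc d} {suc j} (s≤s j<d) = δ-< j<d

  act-local : ∀ {d} (p : Vec ℤ d) t {u v} n m → (∀ j → j ℕ.≤ d → u (j ℕ.+ n) ≡ v (j ℕ.+ m)) →
    act p t u n ≡ act p t v m
  act-local []      t n m eq = cong (t ℤ.*_) (eq 0 z≤n)
  act-local {suc d} (c ∷ p) t {u} {v} n m eq = cong₂ ℤ._+_ (cong (c ℤ.*_) (eq 0 z≤n))
    (act-local p t (suc n) (suc m) λ j j≤d → trans (cong u (ℕ.+-suc j n))
      (trans (eq (suc j) (s≤s j≤d)) (cong v (sym (ℕ.+-suc j m)))))

  module _ {d : ℕ} (p : Vec ℤ d) where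

    -- As p is monic, adding a multiple of `δ d` changes its value at 0 by exactly that multiple, so
    -- the entry at d can be corrected within ℤ.
    amend : Seq → Seq
    amend s j = s j ℤ.+ (ℤ.- monicAct p s 0) ℤ.* δ d j

    amend-annihilated : ∀ s → monicAct p (amend s) 0 ≡ + 0
    amend-annihilated s = begin
      monicAct p (amend s) 0
        ≡⟨ add (monicAct-linear p) s (λ j → (ℤ.- monicAct p s 0) ℤ.* δ d j) 0 ⟩
      monicAct p s 0 ℤ.+ monicAct p (λ j → (ℤ.- monicAct p s 0) ℤ.* δ d j) 0
        ≡⟨ cong (ℤ._+_ (monicAct p s 0)) (trans (scale (monicAct-linear p) (ℤ.- monicAct p s 0) (δ d) 0)
             (trans (cong (ℤ._*_ (ℤ.- monicAct p s 0)) (act-δ (Vec.map (λ i → i) p) (+ 1)))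
               (ℤ.*-identityʳ (ℤ.- monicAct p s 0)))) ⟩
      monicAct p s 0 ℤ.- monicAct p s 0
        ≡⟨ ℤ.+-inverseʳ (monicAct p s 0) ⟩
      + 0 ∎
      where open ≡.≡-Reasoning

    amend-< : ∀ s {j} → j ℕ.< d → amend s j ≡ s j
    amend-< s {j} j<d = trans
      (cong (λ x → s j ℤ.+ (ℤ.- monicAct p s 0) ℤ.* x) (δ-< j<d))
      (trans (cong (ℤ._+_ (s j)) (ℤ.*-zeroʳ (ℤ.- monicAct p s 0))) (ℤ.+-identityʳ (s j)))

    -- Only the first d entries of a state matter; each step computes the entry at d from them and
    -- shifts.
    state : Seq → ℕ → Seq
    state s zero    = s
    state s (suc n) = amend (state s n) ∘ suc

    solution : Seq → Seq
    solution s n = state s n 0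

    state-solution : ∀ s n {j} → j ℕ.< d → state s n j ≡ solution s (j ℕ.+ n)
    state-solution s n {zero}  _     = refl
    state-solution s n {suc j} 1+j<d = begin
      state s n (suc j)          ≡⟨ sym (amend-< (state s n) 1+j<d) ⟩
      state s (suc n) j          ≡⟨ state-solution s (suc n) (ℕ.<-trans (ℕ.n<1+n j) 1+j<d) ⟩
      solution s (j ℕ.+ suc n)   ≡⟨ cong (solution s) (ℕ.+-suc j n) ⟩
      solution s (suc j ℕ.+ n)   ∎
      where open ≡.≡-Reasoning

    solution-initial : ∀ s {j} → j ℕ.< d → solution s j ≡ s j
    solution-initial s {j} j<d = trans (cong (solution s) (sym (ℕ.+-identityʳ j)))
      (sym (state-solution s 0 j<d))

  solution-annihilated : ∀ {d} (p : Vec ℤ d) → 0 ℕ.< d → ∀ s n →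
    monicAct p (solution p s) n ≡ + 0
  solution-annihilated {suc d} p _ s n = trans
    (act-local (Vec.map (λ i → i) p) (+ 1) n 0 matches) (amend-annihilated p (state p s n))
    where
    matches : ∀ j → j ℕ.≤ suc d → solution p s (j ℕ.+ n) ≡ amend p (state p s n) (j ℕ.+ 0)
    matches zero    _         = sym (amend-< p (state p s n) (s≤s z≤n))
    matches (suc j) (s≤s j≤d) = trans (cong (solution p s) (sym (ℕ.+-suc j n)))
      (trans (sym (state-solution p s (suc n) (s≤s j≤d)))
        (cong (amend p (state p s n)) (sym (ℕ.+-identityʳ (suc j)))))

-- The other zeros, and the minimal degree of a polynomial killing the large zero

module Roots (O : OrderedAlgebra) where
  open OrderedAlgebra O

  module AtRoot
    {p₁ : ℕ} {ps′ : List ℕ} (M : ℤ)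
    (k+2≡2M : + length (p₁ ∷ ps′) ℤ.+ + 2 ≡ + 2 ℤ.* M)
    (1≤ps : All (1 ℕ.≤_) (p₁ ∷ ps′)) {a : Carrier} (1<a : Pos (a - 1#))
    (root : Vieta.evaluate algebra (pisotPolynomial (p₁ ∷ ps′) M) a ≈ 0#) where

    private
      ps : List ℕ
      ps = p₁ ∷ ps′

    open IntegerSolver algebra
    open Shift algebra
    open Recurrence ps M k+2≡2M
    open Values algebra a using (power)
    open Ordered O
    open PisotValues algebra
    open Relation.Binary.Reasoning.Setoid setoid

    power-recurrent : Recurrent power
    power-recurrent = root-recurrent M 1≤ps (power-geometric a) root

    annihilated⇒nonNeg : ∀ {w l} → w * l ≈ 0# → Pos (l * l) → NonNeg w
    annihilated⇒nonNeg {w} {l} wl≈0 pos = nonNeg-cancel pos (nonNeg-resp (sym (begin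
      l * l * w    ≈⟨ solve 2 (λ l w → l :* l :* w := l :* (w :* l)) refl l w ⟩
      l * (w * l)  ≈⟨ trans (*-congˡ wl≈0) (zeroʳ l) ⟩
      0#           ∎)) nonNeg-0)

    annihilated⇒0 : ∀ {w l} → w * l ≈ 0# → Pos (l * l) → w ≈ 0#
    annihilated⇒0 {w} {l} wl≈0 pos = nonNeg-antisym (annihilated⇒nonNeg wl≈0 pos)
      (annihilated⇒nonNeg (begin
        - w * l    ≈⟨ solve 2 (λ w l → (:- w) :* l := :- (w :* l)) refl w l ⟩
        - (w * l)  ≈⟨ -‿cong wl≈0 ⟩
        - 0#       ≈⟨ solve 0 (:- :0 := :0) refl ⟩
        0#         ∎) pos)

    module _ {x y : Carrier} {c s : Seq} (rotating : Rotating x y c s)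
      (c-recurrent : Recurrent c) (s-recurrent : Recurrent s) (z≉a : ¬ (x ≈ a × y ≈ 0#)) where

      distance≉0 : ¬ ((x - a) * (x - a) + y * y ≈ 0#)
      distance≉0 w≈0 = z≉a
        ( (begin
            x            ≈⟨ solve 2 (λ x a → x := (x :- a) :+ a) refl x a ⟩
            (x - a) + a  ≈⟨ +-congʳ (square≈0 (nonNeg-resp (flip (+-comm _ _)) (nonNeg-square y))) ⟩
            0# + a       ≈⟨ +-identityˡ a ⟩
            a            ∎)
        , square≈0 (nonNeg-resp (flip refl) (nonNeg-square (x - a))))
        where
        flip : ∀ {u v} → (x - a) * (x - a) + y * y ≈ u + v → u ≈ - v
        flip {u} {v} eq = begin
          u              ≈⟨ solve 2 (λ u v → u := (u :+ v) :- v) refl u v ⟩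
          (u + v) - v    ≈⟨ +-congʳ (trans (sym eq) w≈0) ⟩
          0# - v         ≈⟨ +-identityˡ _ ⟩
          - v            ∎

      -- That z differs from a is known only as a negation, so each component is shown to be 0 by
      -- refuting that its square is positive: a positive square would force |z - a|² = 0.
      components≈0 : component power c 0 ≈ 0# × component power s 0 ≈ 0#
      components≈0 =
        let wc≈0 , ws≈0 = component-rotating ps M k+2≡2M (power-geometric a) power-recurrent
                            rotating c-recurrent s-recurrent in
        ¬pos⇒≈0 (λ pos → distance≉0 (annihilated⇒0 wc≈0 pos)) ,
        ¬pos⇒≈0 (λ pos → distance≉0 (annihilated⇒0 ws≈0 pos))

      in-disc :
        Pos (((x - 1#) * (x - 1#) + y * y) * (square (diff ps c) 0 + square (diff ps s) 0)) →
        Pos (1# - (x * x + y * y))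
      in-disc pos =
        let comp-c≈0 , comp-s≈0 = components≈0 in
        pos-cancel
          (nonNeg-+ (lyapunov-nonneg 1<a ps M k+2≡2M 1≤ps power-recurrent comp-c≈0)
                    (lyapunov-nonneg 1<a ps M k+2≡2M 1≤ps power-recurrent comp-s≈0))
          (pos-resp (sym (lyapunov-rotating ps M k+2≡2M rotating c-recurrent s-recurrent)) pos)

    module _ (coprime : AllPairs Coprime ps) (k≢M : + length ps ≢ M) where
      open Embedding algebra
      open IntegerSequences.Descent M k+2≡2M 1≤ps coprime k≢M using (lyapunov-nonneg⇒zero)
      module ℤP = PolynomialAction ℤ-algebra
      open IntegerRecurrence

      ι-nonneg : ∀ k → NonNeg (ι k) → + 0 ℤ.≤ k
      ι-nonneg (+ n)    _  = ℤ.+≤+ z≤n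
      ι-nonneg -[1+ n ] nn = contradiction
        (pos-resp (trans (sym (ι-+ (+ suc n) -[1+ n ]))
            (trans (reflexive (≡.cong ι (ℤ.+-inverseʳ (+ suc n)))) ι-0))
          (pos-+-nonNeg (pos-ι n) nn)) ¬pos-0

      module ℤR = Shift.Recurrence ℤ-algebra ps M k+2≡2M

      annihilated⇒recurrent : ∀ {u} → (∀ n → ℤP.monicAct (pisotPolynomial ps M) u n ≡ + 0) →
        ℤR.Recurrent u
      annihilated⇒recurrent {u} annihilated n = ℤ.i-j≡0⇒i≡j _ _ (≡.trans
        (≡.sym (PisotPolynomial.pisotPolynomial-act ℤ-algebra M 1≤ps u n)) (annihilated n))

      -- If r + N X^e kills a, then (r + N S^e) w has no component along the expanding
      -- eigenvector, for every integer solution w of the recurrence.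
      no-smaller-degree : ∀ {e} (r : Vec ℤ e) {N} → N ≢ + 0 →
        evaluateAt (Vec.map ι r) (ι N) a ≈ 0# → ¬ (e ℕ.< degree ps 2)
      no-smaller-degree {e} r {N} N≢0 r≈0 e<d = N≢0 (≡.trans (≡.sym u₀≡N)
        (lyapunov-nonneg⇒zero (annihilated⇒recurrent u-annihilated) u-nonneg 0))
        where
        p = pisotPolynomial ps M
        w u : ℕ → ℤ
        -- The initial values are 0 except for a 1 at index e < deg P, so u 0 is the leading
        -- coefficient N, and u = 0 contradicts N ≠ 0.
        w = solution p (δ e)
        u = Shift.act ℤ-algebra r N w

        w-annihilated : ∀ n → ℤP.monicAct p w n ≡ + 0
        w-annihilated = solution-annihilated p (ℕ.≤-<-trans z≤n e<d) (δ e)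

        u₀≡N : u 0 ≡ N
        u₀≡N = ≡.trans
          (act-local r N 0 0 λ j j≤e → solution-initial p (δ e)
            (≡.subst (ℕ._< degree ps 2) (≡.sym (ℕ.+-identityʳ j)) (ℕ.≤-<-trans j≤e e<d)))
          (act-δ r N)

        u-annihilated : ∀ n → ℤP.monicAct p u n ≡ + 0
        u-annihilated n = ≡.trans
          (Shift.linear-act ℤ-algebra (ℤP.monicAct-linear p) r N w n)
          (Shift.null (Shift.act-linear ℤ-algebra r N) w-annihilated n)

        component≈0 : ∀ n → component power (ι ∘ u) n ≈ 0#
        component≈0 n = begin
          component power (ι ∘ u) n
            ≈⟨ resp (component-linear power) (ι-act r N w) n ⟩
          component power (act (Vec.map ι r) (ι N) (ι ∘ w)) n
            ≈⟨ linear-act (component-linear power) (Vec.map ι r) (ι N) (ι ∘ w) n ⟩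
          act (Vec.map ι r) (ι N) (component power (ι ∘ w)) n
            ≈⟨ act-geometric (Vec.map ι r) (ι N) (component-geometric (power-geometric a)
                 power-recurrent (ι-recurrent ps M k+2≡2M (annihilated⇒recurrent w-annihilated))) n ⟩
          evaluateAt (Vec.map ι r) (ι N) a * component power (ι ∘ w) n
            ≈⟨ trans (*-congʳ r≈0) (zeroˡ _) ⟩
          0# ∎

        u-nonneg : ∀ n → + 0 ℤ.≤ ℤR.lyapunov u n
        u-nonneg n = ι-nonneg _ (nonNeg-resp (sym (ι-lyapunov ps M k+2≡2M u n))
          (lyapunov-nonneg 1<a ps M k+2≡2M 1≤ps power-recurrent (component≈0 n)))

-- Rational monic polynomials with a common zero

module RationalPolynomials (A : ℤ-Algebra) where
  open ℤ-Algebra A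
  open IntegerSolver A
  open Relation.Binary.Reasoning.Setoid setoid

  module Along (φ : ℚ → Carrier) (φ-0 : φ 0ℚ ≈ 0#) (φ-1 : φ 1ℚ ≈ 1#)
    (φ-+ : ∀ p q → φ (p ℚ.+ q) ≈ φ p + φ q) (φ-* : ∀ p q → φ (p ℚ.* q) ≈ φ p * φ q) where

    monicEval lowEval : ∀ {d} → Vec ℚ d → Carrier → Carrier
    monicEval []      z = 1#
    monicEval (c ∷ p) z = φ c + z * monicEval p z
    lowEval []      z = 0#
    lowEval (c ∷ p) z = φ c + z * lowEval p z

    difference : ∀ {d} (p q : Vec ℚ d) z →
      monicEval p z ≈ monicEval q z + lowEval (Vec.zipWith ℚ._-_ p q) z
    difference []      []      z = sym (+-identityʳ 1#)
    difference (c ∷ p) (b ∷ q) z = begin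
      φ c + z * monicEval p z
        ≈⟨ +-cong (trans (reflexive (≡.cong φ c≡)) (φ-+ b (c ℚ.- b))) (*-congˡ (difference p q z)) ⟩
      (φ b + φ (c ℚ.- b)) + z * (monicEval q z + lowEval (Vec.zipWith ℚ._-_ p q) z)
        ≈⟨ solve 5 (λ z b c m l → (b :+ c) :+ z :* (m :+ l) := (b :+ z :* m) :+ (c :+ z :* l))
             refl z _ _ _ _ ⟩
      (φ b + z * monicEval q z) + (φ (c ℚ.- b) + z * lowEval (Vec.zipWith ℚ._-_ p q) z) ∎
      where
      c≡ : c ≡ b ℚ.+ (c ℚ.- b)
      c≡ = ≡.sym (≡.trans (ℚ.+-comm b (c ℚ.- b)) (≡.trans (ℚ.+-assoc c (ℚ.- b) b)
        (≡.trans (≡.cong (c ℚ.+_) (ℚ.+-inverseˡ b)) (ℚ.+-identityʳ c))))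

    MonicMultiple : ∀ {n} → Vec ℚ n → Set
    MonicMultiple {n} p = (∀ z → lowEval p z ≈ 0#) ⊎
      ∃[ e ] (e ℕ.< n × ∃[ c ] ∃[ c⁻¹ ] (c ℚ.* c⁻¹ ≡ 1ℚ × Σ (Vec ℚ e) λ s →
        ∀ z → lowEval p z ≈ φ c * monicEval s z))

    -- Decidable equality in ℚ finds the leading coefficient; its inverse is recorded because φ c
    -- has to be cancelled in a ring without division.
    makeMonic : ∀ {n} (p : Vec ℚ n) → MonicMultiple p
    makeMonic []      = inj₁ λ _ → refl
    makeMonic (c ∷ p) = extend (makeMonic p) (c ℚ.≟ 0ℚ)
      where
      extend : MonicMultiple p → Dec (c ≡ 0ℚ) → MonicMultiple (c ∷ p)
      extend (inj₁ p≈0) (yes ≡.refl) = inj₁ λ z → trans (+-cong φ-0 (trans (*-congˡ (p≈0 z)) (zeroʳ z)))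
        (+-identityˡ 0#)
      extend (inj₁ p≈0) (no c≢0) = inj₂ (0 , s≤s z≤n , c
        , ℚ.1/_ c {{ℚ.≢-nonZero c≢0}} , ℚ.*-inverseʳ c {{ℚ.≢-nonZero c≢0}} , [] , λ z →
        trans (+-congˡ (trans (*-congˡ (p≈0 z)) (zeroʳ z)))
          (solve 1 (λ c → c :+ :0 := c :* :1) refl (φ c)))
      extend (inj₂ (e , e<n , b , b⁻¹ , bb⁻¹≡1 , s , eq)) _ =
        inj₂ (suc e , s≤s e<n , b , b⁻¹ , bb⁻¹≡1 , (b⁻¹ ℚ.* c) ∷ s , λ z → begin
          φ c + z * lowEval p z
            ≈⟨ +-cong (trans (reflexive (≡.cong φ c≡)) (φ-* b (b⁻¹ ℚ.* c))) (*-congˡ (eq z)) ⟩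
          φ b * φ (b⁻¹ ℚ.* c) + z * (φ b * monicEval s z)
            ≈⟨ solve 4 (λ z b c s → b :* c :+ z :* (b :* s) := b :* (c :+ z :* s)) refl z _ _ _ ⟩
          φ b * (φ (b⁻¹ ℚ.* c) + z * monicEval s z) ∎)
        where
        c≡ : c ≡ b ℚ.* (b⁻¹ ℚ.* c)
        c≡ = ≡.sym (≡.trans (≡.sym (ℚ.*-assoc b b⁻¹ c))
          (≡.trans (≡.cong (ℚ._* c) bb⁻¹≡1) (ℚ.*-identityˡ c)))

    -- Two monic polynomials of the same degree that both kill α differ by a multiple of
    -- a monic polynomial of smaller degree killing α, unless they are equal.
    same-zeros : ∀ {d} (p q : Vec ℚ d) {α} → monicEval p α ≈ 0# → monicEval q α ≈ 0# →
      (∀ {e} (s : Vec ℚ e) → monicEval s α ≈ 0# → d ℕ.≤ e) →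
      ∀ z → monicEval q z ≈ 0# → monicEval p z ≈ 0#
    same-zeros {d} p q {α} pα≈0 qα≈0 minimal z qz≈0 = conclude (makeMonic r)
      where
      r = Vec.zipWith ℚ._-_ p q

      rα≈0 : lowEval r α ≈ 0#
      rα≈0 = begin
        lowEval r α                      ≈⟨ sym (+-identityˡ _) ⟩
        0# + lowEval r α                 ≈⟨ +-congʳ (sym qα≈0) ⟩
        monicEval q α + lowEval r α      ≈⟨ sym (difference p q α) ⟩
        monicEval p α                    ≈⟨ pα≈0 ⟩
        0#                               ∎

      conclude : MonicMultiple r → monicEval p z ≈ 0#
      conclude (inj₁ r≈0) =
        trans (difference p q z) (trans (+-cong qz≈0 (r≈0 z)) (+-identityˡ 0#))
      conclude (inj₂ (e , e<d , c , c⁻¹ , cc⁻¹≡1 , s , eq)) =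
        contradiction e<d (ℕ.≤⇒≯ (minimal s (begin
          monicEval s α
            ≈⟨ sym (*-identityˡ _) ⟩
          1# * monicEval s α
            ≈⟨ *-congʳ (trans (sym φ-1) (trans (reflexive (≡.cong φ (≡.sym cc⁻¹≡1))) (φ-* c c⁻¹))) ⟩
          φ c * φ c⁻¹ * monicEval s α
            ≈⟨ solve 3 (λ c d s → c :* d :* s := d :* (c :* s)) refl _ _ _ ⟩
          φ c⁻¹ * (φ c * monicEval s α)
            ≈⟨ *-congˡ (trans (sym (eq α)) rα≈0) ⟩
          φ c⁻¹ * 0#
            ≈⟨ zeroʳ _ ⟩
          0# ∎)))

open import Defs
open ≡ using (refl; sym; trans; cong; cong₂; subst; subst₂)

-- Real and complex numbers

toℚᵘ-ℤ→ℚ : ∀ i → toℚᵘ (ℤ→ℚ i) ℚᵘ.≃ mkℚᵘ i 0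
toℚᵘ-ℤ→ℚ i = ℚ.toℚᵘ-fromℚᵘ (mkℚᵘ i 0)

ℤ→ℚ-+ : ∀ i j → ℤ→ℚ (i ℤ.+ j) ≡ ℤ→ℚ i ℚ.+ ℤ→ℚ j
ℤ→ℚ-+ i j = ℚ.toℚᵘ-injective (begin
  toℚᵘ (ℤ→ℚ (i ℤ.+ j))                ≈⟨ toℚᵘ-ℤ→ℚ (i ℤ.+ j) ⟩
  mkℚᵘ (i ℤ.+ j) 0                     ≈⟨ *≡* (cong (ℤ._* + 1) (cong₂ ℤ._+_ (sym (ℤ.*-identityʳ i)) (sym (ℤ.*-identityʳ j)))) ⟩
  mkℚᵘ i 0 ℚᵘ.+ mkℚᵘ j 0              ≈⟨ ℚᵘ.+-cong (toℚᵘ-ℤ→ℚ i) (toℚᵘ-ℤ→ℚ j) ⟨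
  toℚᵘ (ℤ→ℚ i) ℚᵘ.+ toℚᵘ (ℤ→ℚ j)      ≈⟨ ℚ.toℚᵘ-homo-+ (ℤ→ℚ i) (ℤ→ℚ j) ⟨
  toℚᵘ (ℤ→ℚ i ℚ.+ ℤ→ℚ j)              ∎)
  where open ℚᵘ.≃-Reasoning

ℤ→ℚ-* : ∀ i j → ℤ→ℚ (i ℤ.* j) ≡ ℤ→ℚ i ℚ.* ℤ→ℚ j
ℤ→ℚ-* i j = ℚ.toℚᵘ-injective (begin
  toℚᵘ (ℤ→ℚ (i ℤ.* j))                ≈⟨ toℚᵘ-ℤ→ℚ (i ℤ.* j) ⟩
  mkℚᵘ i 0 ℚᵘ.* mkℚᵘ j 0              ≈⟨ ℚᵘ.*-cong (toℚᵘ-ℤ→ℚ i) (toℚᵘ-ℤ→ℚ j) ⟨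
  toℚᵘ (ℤ→ℚ i) ℚᵘ.* toℚᵘ (ℤ→ℚ j)      ≈⟨ ℚ.toℚᵘ-homo-* (ℤ→ℚ i) (ℤ→ℚ j) ⟨
  toℚᵘ (ℤ→ℚ i ℚ.* ℤ→ℚ j)              ∎)
  where open ℚᵘ.≃-Reasoning

ℤ→ℚ-neg : ∀ i → ℤ→ℚ (ℤ.- i) ≡ ℚ.- ℤ→ℚ i
ℤ→ℚ-neg i = ℚ.toℚᵘ-injective (begin
  toℚᵘ (ℤ→ℚ (ℤ.- i))     ≈⟨ toℚᵘ-ℤ→ℚ (ℤ.- i) ⟩
  ℚᵘ.- mkℚᵘ i 0           ≈⟨ ℚᵘ.-‿cong (toℚᵘ-ℤ→ℚ i) ⟨
  ℚᵘ.- toℚᵘ (ℤ→ℚ i)      ≈⟨ ℚ.toℚᵘ-homo‿- (ℤ→ℚ i) ⟨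
  toℚᵘ (ℚ.- ℤ→ℚ i)       ∎)
  where open ℚᵘ.≃-Reasoning

ℚ-algebra : ℤ-Algebra
ℚ-algebra = record
  { commutativeRing = ℚ.+-*-commutativeRing
  ; ι = ℤ→ℚ ; ι-+ = ℤ→ℚ-+ ; ι-* = ℤ→ℚ-* ; ι-neg = ℤ→ℚ-neg
  ; ι-0 = refl ; ι-1 = refl }

ℤ→ℚ-mono-≤ : ∀ {i j} → i ℤ.≤ j → ℤ→ℚ i ℚ.≤ ℤ→ℚ j
ℤ→ℚ-mono-≤ {i} {j} i≤j = ℚ.toℚᵘ-cancel-≤ (ℚᵘ.≤-respʳ-≃ (ℚᵘ.≃-sym (toℚᵘ-ℤ→ℚ j))
  (ℚᵘ.≤-respˡ-≃ (ℚᵘ.≃-sym (toℚᵘ-ℤ→ℚ i)) (ℚᵘ.*≤* (ℤ.*-monoʳ-≤-nonNeg (+ 1) i≤j))))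

ℤ→ℚ-mono-< : ∀ {i j} → i ℤ.< j → ℤ→ℚ i ℚ.< ℤ→ℚ j
ℤ→ℚ-mono-< {i} {j} i<j = ℚ.toℚᵘ-cancel-< (ℚᵘ.<-respʳ-≃ (ℚᵘ.≃-sym (toℚᵘ-ℤ→ℚ j))
  (ℚᵘ.<-respˡ-≃ (ℚᵘ.≃-sym (toℚᵘ-ℤ→ℚ i)) (ℚᵘ.*<* (ℤ.*-monoʳ-<-pos (+ 1) i<j))))

denominator-* : ∀ c → ℤ→ℚ (ℚ.denominator c) ℚ.* c ≡ ℤ→ℚ (ℚ.numerator c)
denominator-* c@(mkℚ n d _) = ℚ.toℚᵘ-injective (begin
  toℚᵘ (ℤ→ℚ (+ suc d) ℚ.* c)          ≈⟨ ℚ.toℚᵘ-homo-* (ℤ→ℚ (+ suc d)) c ⟩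
  toℚᵘ (ℤ→ℚ (+ suc d)) ℚᵘ.* mkℚᵘ n d  ≈⟨ ℚᵘ.*-congʳ (toℚᵘ-ℤ→ℚ (+ suc d)) ⟩
  mkℚᵘ (+ suc d) 0 ℚᵘ.* mkℚᵘ n d      ≈⟨ *≡* (sym cross) ⟩
  mkℚᵘ n 0                            ≈⟨ toℚᵘ-ℤ→ℚ n ⟨
  toℚᵘ (ℤ→ℚ n)                        ∎)
  where
  open ℚᵘ.≃-Reasoning
  cross : n ℤ.* + (1 ℕ.* suc d) ≡ + suc d ℤ.* n ℤ.* + 1
  cross = trans (cong (λ x → n ℤ.* + x) (ℕ.*-identityˡ (suc d)))
    (trans (ℤ.*-comm n (+ suc d)) (sym (ℤ.*-identityʳ (+ suc d ℤ.* n))))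

module _ where
  open IntegerSolver ℚ-algebra

  half-positive : ∀ {ε} → 0ℚ ℚ.< ε → 0ℚ ℚ.< ½ ℚ.* ε
  half-positive {ε} 0<ε = subst (ℚ._< ½ ℚ.* ε) (ℚ.*-zeroʳ ½) (ℚ.*-monoʳ-<-pos ½ 0<ε)

  half-double : ∀ ε → ½ ℚ.* ε ℚ.+ ½ ℚ.* ε ≡ ε
  half-double ε = trans (sym (ℚ.*-distribʳ-+ ε ½ ½)) (ℚ.*-identityˡ ε)

  neg-involutive : ∀ q → ℚ.- (ℚ.- q) ≡ q
  neg-involutive = solve 1 (λ q → :- (:- q) := q) refl

  neg-half-double : ∀ ε → ℚ.- (½ ℚ.* ε) ℚ.- ½ ℚ.* ε ≡ ℚ.- ε
  neg-half-double ε =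
    trans (sym (ℚ.neg-distrib-+ (½ ℚ.* ε) (½ ℚ.* ε))) (cong ℚ.-_ (half-double ε))

  half-remainder : ∀ ε → ε ℚ.- ½ ℚ.* ε ≡ ½ ℚ.* ε
  half-remainder ε = trans (cong (ℚ._- ½ ℚ.* ε) (sym (half-double ε)))
    (solve 1 (λ h → (h :+ h) :- h := h) refl (½ ℚ.* ε))

  half-< : ∀ {ε} → 0ℚ ℚ.< ε → ½ ℚ.* ε ℚ.< ε
  half-< {ε} 0<ε = subst₂ ℚ._<_ (ℚ.+-identityˡ (½ ℚ.* ε)) (half-double ε)
    (ℚ.+-monoˡ-< (½ ℚ.* ε) (half-positive 0<ε))

  *-positive : ∀ {p q} → 0ℚ ℚ.< p → 0ℚ ℚ.< q → 0ℚ ℚ.< p ℚ.* q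
  *-positive {p} {q} 0<p 0<q =
    subst (ℚ._< p ℚ.* q) (ℚ.*-zeroʳ p) (ℚ.*-monoʳ-<-pos p {{ℚ.positive 0<p}} 0<q)

  *-nonneg : ∀ {p q} → 0ℚ ℚ.≤ p → 0ℚ ℚ.≤ q → 0ℚ ℚ.≤ p ℚ.* q
  *-nonneg {p} {q} 0≤p 0≤q =
    subst (ℚ._≤ p ℚ.* q) (ℚ.*-zeroʳ p) (ℚ.*-monoˡ-≤-nonNeg p {{ℚ.nonNegative 0≤p}} 0≤q)

  square-nonneg : ∀ q → 0ℚ ℚ.≤ q ℚ.* q
  square-nonneg q with ℚ.≤-total 0ℚ q
  ... | inj₁ 0≤q = *-nonneg 0≤q 0≤q
  ... | inj₂ q≤0 = subst (0ℚ ℚ.≤_) (solve 1 (λ q → (:- q) :* (:- q) := q :* q) refl q)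
    (*-nonneg (ℚ.neg-antimono-≤ q≤0) (ℚ.neg-antimono-≤ q≤0))

  divide : ∀ {b ε} → 0ℚ ℚ.< b → 0ℚ ℚ.< ε → ∃[ δ ] (0ℚ ℚ.< δ × b ℚ.* δ ≡ ε)
  divide {b} {ε} 0<b 0<ε = b⁻¹ ℚ.* ε , *-positive (ℚ.positive⁻¹ b⁻¹ {{ℚ.1/pos⇒pos b {{b⁺}}}}) 0<ε
    , trans (sym (ℚ.*-assoc b b⁻¹ ε)) (trans (cong (ℚ._* ε) (ℚ.*-inverseʳ b)) (ℚ.*-identityˡ ε))
    where
    b⁺ = ℚ.positive 0<b
    instance
      b≢0 : ℚ.NonZero b
      b≢0 = ℚ.pos⇒nonZero b {{b⁺}}
    b⁻¹ = ℚ.1/ b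

  ∣∣<-intro : ∀ {q ε} → ℚ.- ε ℚ.< q → q ℚ.< ε → ℚ.∣ q ∣ ℚ.< ε
  ∣∣<-intro {q} {ε} -ε<q q<ε with ℚ.∣p∣≡p∨∣p∣≡-p q
  ... | inj₁ eq = subst (ℚ._< ε) (sym eq) q<ε
  ... | inj₂ eq = subst₂ ℚ._<_ (sym eq) (neg-involutive ε)
    (ℚ.neg-antimono-< -ε<q)

  p≤∣p∣ : ∀ q → q ℚ.≤ ℚ.∣ q ∣
  p≤∣p∣ q with ℚ.≤-total 0ℚ q
  ... | inj₁ 0≤q = ℚ.≤-reflexive (sym (ℚ.0≤p⇒∣p∣≡p 0≤q))
  ... | inj₂ q≤0 = ℚ.≤-trans q≤0 (ℚ.0≤∣p∣ q)

  ∣∣<-upper : ∀ {q ε} → ℚ.∣ q ∣ ℚ.< ε → q ℚ.< ε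
  ∣∣<-upper {q} = ℚ.≤-<-trans (p≤∣p∣ q)

  ∣∣-square : ∀ q → ℚ.∣ q ∣ ℚ.* ℚ.∣ q ∣ ≡ q ℚ.* q
  ∣∣-square q = trans (sym (ℚ.∣p*q∣≡∣p∣*∣q∣ q q)) (ℚ.0≤p⇒∣p∣≡p (square-nonneg q))

  Eventually : (ℕ → Set) → Set
  Eventually P = ∃[ N ] (∀ n → N ℕ.≤ n → P n)

  always : ∀ {P : ℕ → Set} → (∀ n → P n) → Eventually P
  always p = 0 , λ n _ → p n

  map₁ : ∀ {P Q : ℕ → Set} → (∀ n → P n → Q n) → Eventually P → Eventually Q
  map₁ f (N , p) = N , λ n N≤n → f n (p n N≤n)

  map₂ : ∀ {P Q R : ℕ → Set} → (∀ n → P n → Q n → R n) →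
    Eventually P → Eventually Q → Eventually R
  map₂ f (M , p) (N , q) = M ℕ.⊔ N , λ n le →
    f n (p n (ℕ.m⊔n≤o⇒m≤o M N le)) (q n (ℕ.m⊔n≤o⇒n≤o M N le))

  map₃ : ∀ {P Q R S : ℕ → Set} → (∀ n → P n → Q n → R n → S n) →
    Eventually P → Eventually Q → Eventually R → Eventually S
  map₃ f p q r = map₂ (λ n pq → f n (proj₁ pq) (proj₂ pq)) (map₂ (λ n → _,_) p q) r

  -- `x ≈ℝ y` unfolds to `Null` of the difference, so equality of real numbers reduces to rules for
  -- null sequences.
  Null : (ℕ → ℚ) → Set
  Null x = ∀ ε → 0ℚ ℚ.< ε → Eventually (λ n → ℚ.∣ x n ∣ ℚ.< ε)

  Bounded : (ℕ → ℚ) → Set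
  Bounded x = ∃[ b ] (0ℚ ℚ.< b × Eventually (λ n → ℚ.∣ x n ∣ ℚ.≤ b))

  null-resp : ∀ {x y} → (∀ n → x n ≡ y n) → Null x → Null y
  null-resp eq nx ε 0<ε = map₁ (λ n → subst (λ q → ℚ.∣ q ∣ ℚ.< ε) (eq n)) (nx ε 0<ε)

  null-0 : Null (λ _ → 0ℚ)
  null-0 ε 0<ε = always λ _ → 0<ε

  null-+ : ∀ {x y} → Null x → Null y → Null (λ n → x n ℚ.+ y n)
  null-+ {x} {y} nx ny ε 0<ε = map₂
    (λ n x<δ y<δ → ℚ.≤-<-trans (ℚ.∣p+q∣≤∣p∣+∣q∣ (x n) (y n))
      (subst (ℚ.∣ x n ∣ ℚ.+ ℚ.∣ y n ∣ ℚ.<_) (half-double ε) (ℚ.+-mono-< x<δ y<δ)))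
    (nx _ (half-positive 0<ε)) (ny _ (half-positive 0<ε))

  null-neg : ∀ {x} → Null x → Null (λ n → ℚ.- x n)
  null-neg {x} nx ε 0<ε = map₁ (λ n → subst (ℚ._< ε) (sym (ℚ.∣-p∣≡∣p∣ (x n)))) (nx ε 0<ε)

  null-* : ∀ {x y} → Bounded x → Null y → Null (λ n → x n ℚ.* y n)
  null-* {x} {y} (b , 0<b , bounded) ny ε 0<ε with divide 0<b 0<ε
  ... | δ , 0<δ , bδ≡ε = map₂ close bounded (ny δ 0<δ)
    where
    close : ∀ n → ℚ.∣ x n ∣ ℚ.≤ b → ℚ.∣ y n ∣ ℚ.< δ → ℚ.∣ x n ℚ.* y n ∣ ℚ.< ε
    close n x≤b y<δ = let open ℚ.≤-Reasoning in begin-strict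
      ℚ.∣ x n ℚ.* y n ∣         ≡⟨ ℚ.∣p*q∣≡∣p∣*∣q∣ (x n) (y n) ⟩
      ℚ.∣ x n ∣ ℚ.* ℚ.∣ y n ∣   ≤⟨ ℚ.*-monoʳ-≤-nonNeg ℚ.∣ y n ∣ {{ℚ.∣-∣-nonNeg (y n)}} x≤b ⟩
      b ℚ.* ℚ.∣ y n ∣           <⟨ ℚ.*-monoʳ-<-pos b {{ℚ.positive 0<b}} y<δ ⟩
      b ℚ.* δ                   ≡⟨ bδ≡ε ⟩
      ε                         ∎

  cauchy-bounded : ∀ {x} → Cauchy x → Bounded x
  cauchy-bounded {x} cx with cx 1ℚ (ℚ.positive⁻¹ 1ℚ)
  ... | N , close = 1ℚ ℚ.+ ℚ.∣ x N ∣ , ℚ.+-mono-<-≤ (ℚ.positive⁻¹ 1ℚ) (ℚ.0≤∣p∣ (x N))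
    , N , λ n N≤n → let open ℚ.≤-Reasoning in begin
      ℚ.∣ x n ∣                        ≡⟨ cong ℚ.∣_∣ (solve 2 (λ a b → a := (a :- b) :+ b) refl (x n) (x N)) ⟩
      ℚ.∣ (x n ℚ.- x N) ℚ.+ x N ∣      ≤⟨ ℚ.∣p+q∣≤∣p∣+∣q∣ (x n ℚ.- x N) (x N) ⟩
      ℚ.∣ x n ℚ.- x N ∣ ℚ.+ ℚ.∣ x N ∣  ≤⟨ ℚ.+-monoˡ-≤ ℚ.∣ x N ∣ (ℚ.<⇒≤ (close n N N≤n ℕ.≤-refl)) ⟩
      1ℚ ℚ.+ ℚ.∣ x N ∣                 ∎

  bounded : ∀ x → Bounded (seq x)
  bounded x = cauchy-bounded {seq x} (cauchy x)

  -- The operations on ℝ are termwise, so the ring identities of ℚ pass to ℝ without estimates.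
  ≈ℝ-pointwise : ∀ {x y} → (∀ n → seq x n ≡ seq y n) → x ≈ℝ y
  ≈ℝ-pointwise {x} {y} eq =
    null-resp (λ n → sym (trans (cong (ℚ._- seq y n) (eq n)) (ℚ.+-inverseʳ (seq y n)))) null-0

  ≈ℝ-isEquivalence : IsEquivalence _≈ℝ_
  ≈ℝ-isEquivalence = record
    { refl  = λ {x} → ≈ℝ-pointwise {x} {x} λ _ → refl
    ; sym   = λ {x} {y} eq → null-resp
        (λ n → solve 2 (λ a b → :- (a :- b) := b :- a) refl (seq x n) (seq y n))
        (null-neg eq)
    ; trans = λ {x} {y} {z} eq eq′ → null-resp
        (λ n → solve 3 (λ a b c → (a :- b) :+ (b :- c) := a :- c) refl (seq x n) (seq y n) (seq z n))
        (null-+ eq eq′)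
    }

  ≈ℝ-+ : ∀ {x y u v} → x ≈ℝ y → u ≈ℝ v → x +ℝ u ≈ℝ y +ℝ v
  ≈ℝ-+ {x} {y} {u} {v} eq eq′ = null-resp
    (λ n → solve 4 (λ a b c d → (a :- b) :+ (c :- d) := (a :+ c) :- (b :+ d)) refl
      (seq x n) (seq y n) (seq u n) (seq v n))
    (null-+ eq eq′)

  ≈ℝ-neg : ∀ {x y} → x ≈ℝ y → -ℝ x ≈ℝ -ℝ y
  ≈ℝ-neg {x} {y} eq = null-resp
    (λ n → solve 2 (λ a b → :- (a :- b) := (:- a) :- (:- b)) refl (seq x n) (seq y n))
    (null-neg eq)

  ≈ℝ-* : ∀ {x y u v} → x ≈ℝ y → u ≈ℝ v → x *ℝ u ≈ℝ y *ℝ v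
  ≈ℝ-* {x} {y} {u} {v} eq eq′ = null-resp
    (λ n → solve 4 (λ a b c d → a :* (c :- d) :+ d :* (a :- b) := a :* c :- b :* d) refl
      (seq x n) (seq y n) (seq u n) (seq v n))
    (null-+ (null-* (bounded x) eq′) (null-* (bounded v) eq))

  ℝ-isCommutativeRing : IsCommutativeRing _≈ℝ_ _+ℝ_ _*ℝ_ -ℝ_ 0ℝ 1ℝ
  ℝ-isCommutativeRing = record
    { isRing = record
      { +-isAbelianGroup = record
        { isGroup = record
          { isMonoid = record
            { isSemigroup = record
              { isMagma = record
                { isEquivalence = ≈ℝ-isEquivalence
                ; ∙-cong = λ {x} {y} {u} {v} → ≈ℝ-+ {x} {y} {u} {v} }
              ; assoc = λ x y z → ≈ℝ-pointwise {(x +ℝ y) +ℝ z} {x +ℝ (y +ℝ z)}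
                  λ n → ℚ.+-assoc (seq x n) (seq y n) (seq z n) }
            ; identity = (λ x → ≈ℝ-pointwise {0ℝ +ℝ x} {x} λ n → ℚ.+-identityˡ (seq x n))
                       , (λ x → ≈ℝ-pointwise {x +ℝ 0ℝ} {x} λ n → ℚ.+-identityʳ (seq x n)) }
          ; inverse = (λ x → ≈ℝ-pointwise { -ℝ x +ℝ x } {0ℝ} λ n → ℚ.+-inverseˡ (seq x n))
                    , (λ x → ≈ℝ-pointwise {x +ℝ -ℝ x} {0ℝ} λ n → ℚ.+-inverseʳ (seq x n))
          ; ⁻¹-cong = λ {x} {y} → ≈ℝ-neg {x} {y} }
        ; comm = λ x y → ≈ℝ-pointwise {x +ℝ y} {y +ℝ x} λ n → ℚ.+-comm (seq x n) (seq y n) }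
      ; *-cong = λ {x} {y} {u} {v} → ≈ℝ-* {x} {y} {u} {v}
      ; *-assoc = λ x y z → ≈ℝ-pointwise {(x *ℝ y) *ℝ z} {x *ℝ (y *ℝ z)}
          λ n → ℚ.*-assoc (seq x n) (seq y n) (seq z n)
      ; *-identity = (λ x → ≈ℝ-pointwise {1ℝ *ℝ x} {x} λ n → ℚ.*-identityˡ (seq x n))
                   , (λ x → ≈ℝ-pointwise {x *ℝ 1ℝ} {x} λ n → ℚ.*-identityʳ (seq x n))
      ; distrib = (λ x y z → ≈ℝ-pointwise {x *ℝ (y +ℝ z)} {x *ℝ y +ℝ x *ℝ z}
                    λ n → ℚ.*-distribˡ-+ (seq x n) (seq y n) (seq z n))
                , (λ x y z → ≈ℝ-pointwise {(y +ℝ z) *ℝ x} {y *ℝ x +ℝ z *ℝ x}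
                    λ n → ℚ.*-distribʳ-+ (seq x n) (seq y n) (seq z n)) }
    ; *-comm = λ x y → ≈ℝ-pointwise {x *ℝ y} {y *ℝ x} λ n → ℚ.*-comm (seq x n) (seq y n)
    }

  ℝ-commutativeRing : CommutativeRing 0ℓ 0ℓ
  ℝ-commutativeRing = record { isCommutativeRing = ℝ-isCommutativeRing }

  ℝ-algebra : ℤ-Algebra
  ℝ-algebra = record
    { commutativeRing = ℝ-commutativeRing
    ; ι     = λ i → fromℚ (ℤ→ℚ i)
    ; ι-+   = λ i j → ≈ℝ-pointwise {fromℚ (ℤ→ℚ (i ℤ.+ j))} {fromℚ (ℤ→ℚ i) +ℝ fromℚ (ℤ→ℚ j)}
                λ _ → ℤ→ℚ-+ i j
    ; ι-*   = λ i j → ≈ℝ-pointwise {fromℚ (ℤ→ℚ (i ℤ.* j))} {fromℚ (ℤ→ℚ i) *ℝ fromℚ (ℤ→ℚ j)}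
                λ _ → ℤ→ℚ-* i j
    ; ι-neg = λ i → ≈ℝ-pointwise {fromℚ (ℤ→ℚ (ℤ.- i))} { -ℝ fromℚ (ℤ→ℚ i)} λ _ → ℤ→ℚ-neg i
    ; ι-0   = ≈ℝ-pointwise {fromℚ (ℤ→ℚ (+ 0))} {0ℝ} λ _ → refl
    ; ι-1   = ≈ℝ-pointwise {fromℚ (ℤ→ℚ (+ 1))} {1ℝ} λ _ → refl
    }

module ℝ-ring = ℤ-Algebra ℝ-algebra

module _ where
  open IntegerSolver ℚ-algebra

  ℂ-isEquivalence : IsEquivalence _≈_
  ℂ-isEquivalence = record
    { refl  = λ {z} → ℝ-ring.refl {re z} , ℝ-ring.refl {im z}
    ; sym   = λ {z} {w} (r , i) → ℝ-ring.sym {re z} {re w} r , ℝ-ring.sym {im z} {im w} i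
    ; trans = λ {z} {w} {v} (r , i) (r′ , i′) →
        ℝ-ring.trans {re z} {re w} {re v} r r′ , ℝ-ring.trans {im z} {im w} {im v} i i′
    }

  -ℂ_ : ℂ → ℂ
  -ℂ z = (-ℝ re z) +i (-ℝ im z)

  ℂ-*-cong : ∀ {z z′ w w′} → z ≈ z′ → w ≈ w′ → z * w ≈ z′ * w′
  ℂ-*-cong {z} {z′} {w} {w′} (r , i) (r′ , i′) =
      ℝ-ring.+-cong {re z *ℝ re w} {re z′ *ℝ re w′} { -ℝ (im z *ℝ im w)} { -ℝ (im z′ *ℝ im w′)}
        (ℝ-ring.*-cong {re z} {re z′} {re w} {re w′} r r′)
        (ℝ-ring.-‿cong {im z *ℝ im w} {im z′ *ℝ im w′} (ℝ-ring.*-cong {im z} {im z′} {im w} {im w′} i i′))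
    , ℝ-ring.+-cong {re z *ℝ im w} {re z′ *ℝ im w′} {im z *ℝ re w} {im z′ *ℝ re w′}
        (ℝ-ring.*-cong {re z} {re z′} {im w} {im w′} r i′)
        (ℝ-ring.*-cong {im z} {im z′} {re w} {re w′} i r′)

  ≈-pointwise : ∀ {z w} → (∀ n → seq (re z) n ≡ seq (re w) n) →
    (∀ n → seq (im z) n ≡ seq (im w) n) → z ≈ w
  ≈-pointwise {z} {w} r i = ≈ℝ-pointwise {re z} {re w} r , ≈ℝ-pointwise {im z} {im w} i

  ℂ-*-assoc : ∀ z w v → (z * w) * v ≈ z * (w * v)
  ℂ-*-assoc z w v = ≈-pointwise {(z * w) * v} {z * (w * v)}
    (λ n → solve 6 (λ a b c d e f →
      (a :* c :- b :* d) :* e :- (a :* d :+ b :* c) :* f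
      := a :* (c :* e :- d :* f) :- b :* (c :* f :+ d :* e)) refl
      (seq (re z) n) (seq (im z) n) (seq (re w) n) (seq (im w) n) (seq (re v) n) (seq (im v) n))
    (λ n → solve 6 (λ a b c d e f →
      (a :* c :- b :* d) :* f :+ (a :* d :+ b :* c) :* e
      := a :* (c :* f :+ d :* e) :+ b :* (c :* e :- d :* f)) refl
      (seq (re z) n) (seq (im z) n) (seq (re w) n) (seq (im w) n) (seq (re v) n) (seq (im v) n))

  ℂ-*-comm : ∀ z w → z * w ≈ w * z
  ℂ-*-comm z w = ≈-pointwise {z * w} {w * z}
    (λ n → solve 4 (λ a b c d → a :* c :- b :* d := c :* a :- d :* b) refl
      (seq (re z) n) (seq (im z) n) (seq (re w) n) (seq (im w) n))
    (λ n → solve 4 (λ a b c d → a :* d :+ b :* c := c :* b :+ d :* a) refl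
      (seq (re z) n) (seq (im z) n) (seq (re w) n) (seq (im w) n))

  ℂ-distribˡ : ∀ z w v → z * (w + v) ≈ z * w + z * v
  ℂ-distribˡ z w v = ≈-pointwise {z * (w + v)} {z * w + z * v}
    (λ n → solve 6 (λ a b c d e f →
      a :* (c :+ e) :- b :* (d :+ f) := (a :* c :- b :* d) :+ (a :* e :- b :* f)) refl
      (seq (re z) n) (seq (im z) n) (seq (re w) n) (seq (im w) n) (seq (re v) n) (seq (im v) n))
    (λ n → solve 6 (λ a b c d e f →
      a :* (d :+ f) :+ b :* (c :+ e) := (a :* d :+ b :* c) :+ (a :* f :+ b :* e)) refl
      (seq (re z) n) (seq (im z) n) (seq (re w) n) (seq (im w) n) (seq (re v) n) (seq (im v) n))

  ℂ-*-identityˡ : ∀ z → 1ℂ * z ≈ z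
  ℂ-*-identityˡ z = ≈-pointwise {1ℂ * z} {z}
    (λ n → solve 2 (λ a b → :1 :* a :- :0 :* b := a) refl
      (seq (re z) n) (seq (im z) n))
    (λ n → solve 2 (λ a b → :1 :* b :+ :0 :* a := b) refl
      (seq (re z) n) (seq (im z) n))

  private
    module ℂ-Equivalence = IsEquivalence ℂ-isEquivalence

  ℂ-isCommutativeRing : IsCommutativeRing _≈_ _+_ _*_ -ℂ_ 0ℂ 1ℂ
  ℂ-isCommutativeRing = record
    { isRing = record
      { +-isAbelianGroup = record
        { isGroup = record
          { isMonoid = record
            { isSemigroup = record
              { isMagma = record
                { isEquivalence = ℂ-isEquivalence
                ; ∙-cong = λ {z} {z′} {w} {w′} (r , i) (r′ , i′) →
                    ℝ-ring.+-cong {re z} {re z′} {re w} {re w′} r r′ ,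
                    ℝ-ring.+-cong {im z} {im z′} {im w} {im w′} i i′ }
              ; assoc = λ z w v → ℝ-ring.+-assoc (re z) (re w) (re v) , ℝ-ring.+-assoc (im z) (im w) (im v) }
            ; identity = (λ z → ℝ-ring.+-identityˡ (re z) , ℝ-ring.+-identityˡ (im z))
                       , (λ z → ℝ-ring.+-identityʳ (re z) , ℝ-ring.+-identityʳ (im z)) }
          ; inverse = (λ z → ℝ-ring.-‿inverseˡ (re z) , ℝ-ring.-‿inverseˡ (im z))
                    , (λ z → ℝ-ring.-‿inverseʳ (re z) , ℝ-ring.-‿inverseʳ (im z))
          ; ⁻¹-cong = λ {z} {w} (r , i) → ℝ-ring.-‿cong {re z} {re w} r , ℝ-ring.-‿cong {im z} {im w} i }
        ; comm = λ z w → ℝ-ring.+-comm (re z) (re w) , ℝ-ring.+-comm (im z) (im w) }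
      ; *-cong = λ {z} {z′} {w} {w′} → ℂ-*-cong {z} {z′} {w} {w′}
      ; *-assoc = ℂ-*-assoc
      ; *-identity = ℂ-*-identityˡ
          , (λ z → ℂ-Equivalence.trans {z * 1ℂ} {1ℂ * z} {z} (ℂ-*-comm z 1ℂ) (ℂ-*-identityˡ z))
      ; distrib = ℂ-distribˡ
          , (λ z w v → ℂ-Equivalence.trans {(w + v) * z} {z * (w + v)} {w * z + v * z}
              (ℂ-*-comm (w + v) z)
              (ℂ-Equivalence.trans {z * (w + v)} {z * w + z * v} {w * z + v * z}
                (ℂ-distribˡ z w v)
                (ℝ-ring.+-cong {re (z * w)} {re (w * z)} {re (z * v)} {re (v * z)}
                  (proj₁ (ℂ-*-comm z w)) (proj₁ (ℂ-*-comm z v)) ,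
                 ℝ-ring.+-cong {im (z * w)} {im (w * z)} {im (z * v)} {im (v * z)}
                  (proj₂ (ℂ-*-comm z w)) (proj₂ (ℂ-*-comm z v))))) }
    ; *-comm = ℂ-*-comm
    }

ℂ-commutativeRing : CommutativeRing 0ℓ 0ℓ
ℂ-commutativeRing = record { isCommutativeRing = ℂ-isCommutativeRing }

ℂ-algebra : ℤ-Algebra
ℂ-algebra = record
  { commutativeRing = ℂ-commutativeRing
  ; ι     = λ i → ℚ→ℂ (ℤ→ℚ i)
  ; ι-+   = λ i j → ≈-pointwise {ℚ→ℂ (ℤ→ℚ (i ℤ.+ j))} {ℚ→ℂ (ℤ→ℚ i) + ℚ→ℂ (ℤ→ℚ j)}
              (λ _ → ℤ→ℚ-+ i j) (λ _ → refl)
  ; ι-*   = λ i j → ≈-pointwise {ℚ→ℂ (ℤ→ℚ (i ℤ.* j))} {ℚ→ℂ (ℤ→ℚ i) * ℚ→ℂ (ℤ→ℚ j)}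
              (λ _ → trans (ℤ→ℚ-* i j)
                (solve 2 (λ a b → a :* b := a :* b :- :0 :* :0) refl (ℤ→ℚ i) (ℤ→ℚ j)))
              (λ _ → solve 2 (λ a b → :0 := a :* :0 :+ :0 :* b) refl (ℤ→ℚ i) (ℤ→ℚ j))
  ; ι-neg = λ i → ≈-pointwise {ℚ→ℂ (ℤ→ℚ (ℤ.- i))} { -ℂ ℚ→ℂ (ℤ→ℚ i)}
              (λ _ → ℤ→ℚ-neg i) (λ _ → refl)
  ; ι-0   = ≈-pointwise {ℚ→ℂ (ℤ→ℚ (+ 0))} {0ℂ} (λ _ → refl) (λ _ → refl)
  ; ι-1   = ≈-pointwise {ℚ→ℂ (ℤ→ℚ (+ 1))} {1ℂ} (λ _ → refl) (λ _ → refl)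
  }
  where open IntegerSolver ℚ-algebra

-- The order of the real numbers

module RealOrder where
  open IntegerSolver ℚ-algebra

  NonNeg Pos : ℝ → Set
  NonNeg x = ∀ ε → 0ℚ ℚ.< ε → Eventually (λ n → ℚ.- ε ℚ.< seq x n)
  Pos x = ∃[ ε ] (0ℚ ℚ.< ε × Eventually (λ n → ε ℚ.< seq x n))

  nonNeg-resp : ∀ {x y} → x ≈ℝ y → NonNeg x → NonNeg y
  nonNeg-resp {x} {y} eq nn ε 0<ε = map₂
    (λ n close lower → subst₂ ℚ._<_
      (neg-half-double ε)
      (solve 2 (λ a b → a :+ (:- (a :- b)) := b) refl (seq x n) (seq y n))
      (ℚ.+-mono-< lower (ℚ.neg-antimono-< (∣∣<-upper close))))
    (eq _ (half-positive 0<ε)) (nn _ (half-positive 0<ε))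

  nonNeg-+ : ∀ {x y} → NonNeg x → NonNeg y → NonNeg (x +ℝ y)
  nonNeg-+ {x} {y} nx ny ε 0<ε = map₂
    (λ n lx ly → subst (ℚ._< seq x n ℚ.+ seq y n)
      (neg-half-double ε)
      (ℚ.+-mono-< lx ly))
    (nx _ (half-positive 0<ε)) (ny _ (half-positive 0<ε))

  nonNeg-pointwise : ∀ {x} → (∀ n → 0ℚ ℚ.≤ seq x n) → NonNeg x
  nonNeg-pointwise nn ε 0<ε = always λ n → ℚ.<-≤-trans (ℚ.neg-antimono-< 0<ε) (nn n)

  nonNeg-square : ∀ x → NonNeg (x *ℝ x)
  nonNeg-square x = nonNeg-pointwise {x *ℝ x} λ n → square-nonneg (seq x n)

  pos⇒nonNeg : ∀ {x} → Pos x → NonNeg x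
  pos⇒nonNeg (δ , 0<δ , lower) ε 0<ε =
    map₁ (λ n δ<x → ℚ.<-trans (ℚ.neg-antimono-< 0<ε) (ℚ.<-trans 0<δ δ<x)) lower

  pos-resp : ∀ {x y} → x ≈ℝ y → Pos x → Pos y
  pos-resp {x} {y} eq (δ , 0<δ , lower) = ½ ℚ.* δ , half-positive 0<δ , map₂
    (λ n close δ<x → subst₂ ℚ._<_
      (half-remainder δ)
      (solve 2 (λ a b → a :- (a :- b) := b) refl (seq x n) (seq y n))
      (ℚ.+-mono-< δ<x (ℚ.neg-antimono-< (∣∣<-upper close))))
    (eq _ (half-positive 0<δ)) lower

  pos-pointwise : ∀ {x δ} → 0ℚ ℚ.< δ → (∀ n → δ ℚ.< seq x n) → Pos x
  pos-pointwise {δ = δ} 0<δ lower = δ , 0<δ , always lower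

  pos-+-nonNeg : ∀ {x y} → Pos x → NonNeg y → Pos (x +ℝ y)
  pos-+-nonNeg {x} {y} (δ , 0<δ , lower) ny = ½ ℚ.* δ , half-positive 0<δ , map₂
    (λ n δ<x ly → subst (ℚ._< seq x n ℚ.+ seq y n)
      (half-remainder δ)
      (ℚ.+-mono-< δ<x ly))
    lower (ny _ (half-positive 0<δ))

  pos-* : ∀ {x y} → Pos x → Pos y → Pos (x *ℝ y)
  pos-* {x} {y} (δ , 0<δ , lx) (η , 0<η , ly) = δ ℚ.* η , *-positive 0<δ 0<η , map₂
    (λ n δ<x η<y → ℚ.<-trans (ℚ.*-monoʳ-<-pos δ {{ℚ.positive 0<δ}} η<y)
      (ℚ.*-monoˡ-<-pos (seq y n) {{ℚ.positive (ℚ.<-trans 0<η η<y)}} δ<x))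
    lx ly

  -- c y ≥ c (− δ) ≥ − b δ, where b bounds c.
  nonNeg-* : ∀ {c y} → Pos c → NonNeg y → NonNeg (c *ℝ y)
  nonNeg-* {c} {y} (η , 0<η , lc) ny ε 0<ε =
    let b , 0<b , c≤b = bounded c
        δ , 0<δ , bδ≡ε = divide 0<b 0<ε in
    map₃ (λ n → step (seq c n) (seq y n) bδ≡ε 0<δ) lc c≤b (ny δ 0<δ)
    where
    step : ∀ c y {b δ} → b ℚ.* δ ≡ ε → 0ℚ ℚ.< δ → η ℚ.< c → ℚ.∣ c ∣ ℚ.≤ b → ℚ.- δ ℚ.< y →
      ℚ.- ε ℚ.< c ℚ.* y
    step c y {b} {δ} bδ≡ε 0<δ η<c c≤b -δ<y = let open ℚ.≤-Reasoning in begin-strict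
      ℚ.- ε            ≡⟨ cong ℚ.-_ (sym bδ≡ε) ⟩
      ℚ.- (b ℚ.* δ)    ≤⟨ ℚ.neg-antimono-≤ (ℚ.*-monoʳ-≤-nonNeg δ
                            {{ℚ.pos⇒nonNeg δ {{ℚ.positive 0<δ}}}} (ℚ.≤-trans (p≤∣p∣ c) c≤b)) ⟩
      ℚ.- (c ℚ.* δ)    ≡⟨ ℚ.neg-distribʳ-* c δ ⟩
      c ℚ.* (ℚ.- δ)    <⟨ ℚ.*-monoʳ-<-pos c {{ℚ.positive (ℚ.<-trans 0<η η<c)}} -δ<y ⟩
      c ℚ.* y          ∎

  nonNeg-cancel : ∀ {c y} → Pos c → NonNeg (c *ℝ y) → NonNeg y
  nonNeg-cancel {c} {y} (η , 0<η , lc) ncy ε 0<ε = map₂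
    (λ n η<c -ηε<cy → ℚ.≰⇒> λ y≤-ε → ℚ.<-irrefl refl (let open ℚ.≤-Reasoning in begin-strict
      ℚ.- (η ℚ.* ε)            <⟨ -ηε<cy ⟩
      seq c n ℚ.* seq y n      ≤⟨ ℚ.*-monoˡ-≤-nonNeg (seq c n)
                                    {{ℚ.pos⇒nonNeg (seq c n) {{ℚ.positive (ℚ.<-trans 0<η η<c)}}}} y≤-ε ⟩
      seq c n ℚ.* (ℚ.- ε)      ≡⟨ sym (ℚ.neg-distribʳ-* (seq c n) ε) ⟩
      ℚ.- (seq c n ℚ.* ε)      <⟨ ℚ.neg-antimono-< (ℚ.*-monoˡ-<-pos ε {{ℚ.positive 0<ε}} η<c) ⟩
      ℚ.- (η ℚ.* ε)            ∎))
    lc (ncy _ (*-positive 0<η 0<ε))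

  -- If b ≤ 0 then a b = (− a)(− b) ≤ (δ / B) B, contradicting δ < a b; hence b > 0, and
  -- b > δ / A since a ≤ A.
  pos-cancel : ∀ {a b} → NonNeg a → Pos (a *ℝ b) → Pos b
  pos-cancel {a} {b} na (δ , 0<δ , lab) =
    let A , 0<A , a≤A = bounded a
        B , 0<B , b≤B = bounded b
        η , 0<η , Aη≡δ = divide 0<A 0<δ
        θ , 0<θ , Bθ≡δ = divide 0<B 0<δ in
    η , 0<η , map₂ (λ n (-θ<a , a≤A) (b≤B , δ<ab) →
        step (seq a n) (seq b n) 0<A Aη≡δ 0<θ Bθ≡δ -θ<a a≤A b≤B δ<ab)
      (map₂ (λ n → _,_) (na θ 0<θ) a≤A) (map₂ (λ n → _,_) b≤B lab)
    where
    step : ∀ x y {A B η θ} → 0ℚ ℚ.< A → A ℚ.* η ≡ δ → 0ℚ ℚ.< θ → B ℚ.* θ ≡ δ →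
      ℚ.- θ ℚ.< x → ℚ.∣ x ∣ ℚ.≤ A → ℚ.∣ y ∣ ℚ.≤ B → δ ℚ.< x ℚ.* y → η ℚ.< y
    step x y {A} {B} {η} {θ} 0<A Aη≡δ 0<θ Bθ≡δ -θ<x x≤A y≤B δ<xy = ℚ.*-cancelˡ-<-nonNeg A {{ℚ.pos⇒nonNeg A {{ℚ.positive 0<A}}}}
      (let open ℚ.≤-Reasoning in begin-strict
        A ℚ.* η   ≡⟨ Aη≡δ ⟩
        δ         <⟨ δ<xy ⟩
        x ℚ.* y   ≤⟨ ℚ.*-monoʳ-≤-nonNeg y {{ℚ.nonNegative (ℚ.<⇒≤ 0<y)}} (ℚ.≤-trans (p≤∣p∣ x) x≤A) ⟩
        A ℚ.* y   ∎)
      where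
      0<y : 0ℚ ℚ.< y
      0<y = ℚ.≰⇒> λ y≤0 → ℚ.<-irrefl refl (let open ℚ.≤-Reasoning in begin-strict
        δ                      <⟨ δ<xy ⟩
        x ℚ.* y                ≡⟨ solve 2 (λ x y → x :* y := (:- x) :* (:- y)) refl x y ⟩
        (ℚ.- x) ℚ.* (ℚ.- y)    ≤⟨ ℚ.*-monoʳ-≤-nonNeg (ℚ.- y) {{ℚ.nonNegative (ℚ.neg-antimono-≤ y≤0)}}
                                    (ℚ.<⇒≤ (subst (ℚ.- x ℚ.<_) (neg-involutive θ)
                                      (ℚ.neg-antimono-< -θ<x))) ⟩
        θ ℚ.* (ℚ.- y)          ≤⟨ ℚ.*-monoˡ-≤-nonNeg θ {{ℚ.pos⇒nonNeg θ {{ℚ.positive 0<θ}}}}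
                                    (ℚ.≤-trans (p≤∣p∣ (ℚ.- y))
                                      (subst (ℚ._≤ B) (sym (ℚ.∣-p∣≡∣p∣ y)) y≤B)) ⟩
        θ ℚ.* B                ≡⟨ ℚ.*-comm θ B ⟩
        B ℚ.* θ                ≡⟨ Bθ≡δ ⟩
        δ                      ∎)

  nonNeg-antisym : ∀ {x} → NonNeg x → NonNeg (-ℝ x) → x ≈ℝ 0ℝ
  nonNeg-antisym {x} nx n-x ε 0<ε = map₂
    (λ n lower upper → subst (λ q → ℚ.∣ q ∣ ℚ.< ε)
      (solve 1 (λ a → a := a :- :0) refl (seq x n))
      (∣∣<-intro lower (subst₂ ℚ._<_ (neg-involutive (seq x n))
        (neg-involutive ε) (ℚ.neg-antimono-< upper))))
    (nx ε 0<ε) (n-x ε 0<ε)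

  square≈0 : ∀ {x} → NonNeg (-ℝ (x *ℝ x)) → x ≈ℝ 0ℝ
  square≈0 {x} n-xx ε 0<ε = map₁
    (λ n lower → subst (λ q → ℚ.∣ q ∣ ℚ.< ε)
      (solve 1 (λ a → a := a :- :0) refl (seq x n))
      (ℚ.≰⇒> λ ε≤∣x∣ → ℚ.<-irrefl refl (let open ℚ.≤-Reasoning in begin-strict
        ε ℚ.* ε                          ≤⟨ ℚ.*-monoˡ-≤-nonNeg ε {{ℚ.pos⇒nonNeg ε {{ℚ.positive 0<ε}}}} ε≤∣x∣ ⟩
        ε ℚ.* ℚ.∣ seq x n ∣              ≤⟨ ℚ.*-monoʳ-≤-nonNeg ℚ.∣ seq x n ∣ {{ℚ.∣-∣-nonNeg (seq x n)}} ε≤∣x∣ ⟩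
        ℚ.∣ seq x n ∣ ℚ.* ℚ.∣ seq x n ∣  ≡⟨ ∣∣-square (seq x n) ⟩
        seq x n ℚ.* seq x n              <⟨ subst₂ ℚ._<_ (neg-involutive _)
                                              (neg-involutive _)
                                              (ℚ.neg-antimono-< lower) ⟩
        ε ℚ.* ε                          ∎)))
    (n-xx _ (*-positive 0<ε 0<ε))

  -- For each ε one rational comparison at a Cauchy index decides: either |x| stays below ε from
  -- there on, or x² is bounded away from 0, which is excluded.
  ¬pos⇒≈0 : ∀ {x} → ¬ Pos (x *ℝ x) → x ≈ℝ 0ℝ
  ¬pos⇒≈0 {x} ¬pos ε 0<ε = split (ℚ.∣ seq x N ∣ ℚ.<? ½ ℚ.* ε)
    where
    -- A quarter of ε: terms beyond N differ from x N by less than ε/4, so |x N| ≥ ε/2 keeps them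
    -- above ε/4.
    δ = ½ ℚ.* (½ ℚ.* ε)
    0<δ = half-positive (half-positive 0<ε)
    N = proj₁ (cauchy x δ 0<δ)
    close = proj₂ (cauchy x δ 0<δ)

    δ<∣x∣ : ¬ (ℚ.∣ seq x N ∣ ℚ.< ½ ℚ.* ε) → ∀ n → N ℕ.≤ n → δ ℚ.< ℚ.∣ seq x n ∣
    δ<∣x∣ large n N≤n = ℚ.≰⇒> λ ∣x∣≤δ → large (let open ℚ.≤-Reasoning in begin-strict
      ℚ.∣ seq x N ∣
        ≡⟨ cong ℚ.∣_∣ (solve 2 (λ a b → a := (a :- b) :+ b) refl (seq x N) (seq x n)) ⟩
      ℚ.∣ (seq x N ℚ.- seq x n) ℚ.+ seq x n ∣
        ≤⟨ ℚ.∣p+q∣≤∣p∣+∣q∣ (seq x N ℚ.- seq x n) (seq x n) ⟩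
      ℚ.∣ seq x N ℚ.- seq x n ∣ ℚ.+ ℚ.∣ seq x n ∣
        <⟨ ℚ.+-mono-<-≤ (close N n ℕ.≤-refl N≤n) ∣x∣≤δ ⟩
      δ ℚ.+ δ
        ≡⟨ half-double (½ ℚ.* ε) ⟩
      ½ ℚ.* ε ∎)

    square-large : ∀ n → δ ℚ.< ℚ.∣ seq x n ∣ → δ ℚ.* δ ℚ.< seq x n ℚ.* seq x n
    square-large n lt = subst (δ ℚ.* δ ℚ.<_) (∣∣-square (seq x n))
      (ℚ.<-trans (ℚ.*-monoʳ-<-pos δ {{ℚ.positive 0<δ}} lt)
        (ℚ.*-monoˡ-<-pos ℚ.∣ seq x n ∣ {{ℚ.positive (ℚ.<-trans 0<δ lt)}} lt))

    split : Dec (ℚ.∣ seq x N ∣ ℚ.< ½ ℚ.* ε) → Eventually (λ n → ℚ.∣ seq x n ℚ.- 0ℚ ∣ ℚ.< ε)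
    split (yes small) = N , λ n N≤n → subst (λ q → ℚ.∣ q ∣ ℚ.< ε)
      (solve 2 (λ a b → (a :- b) :+ b := a :- :0) refl (seq x n) (seq x N))
      (ℚ.≤-<-trans (ℚ.∣p+q∣≤∣p∣+∣q∣ (seq x n ℚ.- seq x N) (seq x N))
        (subst (ℚ.∣ seq x n ℚ.- seq x N ∣ ℚ.+ ℚ.∣ seq x N ∣ ℚ.<_) (half-double ε)
          (ℚ.+-mono-< (ℚ.<-trans (close n N N≤n ℕ.≤-refl) (half-< (half-positive 0<ε))) small)))
    split (no large) = contradiction
      (δ ℚ.* δ , *-positive 0<δ 0<δ , N , λ n N≤n → square-large n (δ<∣x∣ large n N≤n)) ¬pos

-- The real root

module RationalValues {z : ℚ} (1≤z : 1ℚ ℚ.≤ z) where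
  open Values ℚ-algebra z
  open IntegerSolver ℚ-algebra

  0≤1 : 0ℚ ℚ.≤ 1ℚ
  0≤1 = ℚ.<⇒≤ (ℚ.positive⁻¹ 1ℚ)

  0≤z : 0ℚ ℚ.≤ z
  0≤z = ℚ.≤-trans 0≤1 1≤z

  geoValue-nonneg : ∀ p → 0ℚ ℚ.≤ geoValue p
  geoValue-nonneg zero    = ℚ.≤-refl
  geoValue-nonneg (suc p) = ℚ.+-mono-≤ 0≤1 (*-nonneg 0≤z (geoValue-nonneg p))

  prodValue-nonneg : ∀ ps → 0ℚ ℚ.≤ prodValue ps
  prodValue-nonneg []       = 0≤1
  prodValue-nonneg (p ∷ ps) = *-nonneg (geoValue-nonneg p) (prodValue-nonneg ps)

  cofactorsValue-nonneg : ∀ ps → 0ℚ ℚ.≤ cofactorsValue ps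
  cofactorsValue-nonneg []       = ℚ.≤-refl
  cofactorsValue-nonneg (p ∷ ps) =
    ℚ.+-mono-≤ (prodValue-nonneg ps) (*-nonneg (geoValue-nonneg p) (cofactorsValue-nonneg ps))

  1≤geoValue : ∀ p → 1ℚ ℚ.≤ geoValue (suc p)
  1≤geoValue p = subst (ℚ._≤ 1ℚ ℚ.+ z ℚ.* geoValue p) (ℚ.+-identityʳ 1ℚ)
    (ℚ.+-monoʳ-≤ 1ℚ (*-nonneg 0≤z (geoValue-nonneg p)))

  2≤geoValue : ∀ {p} → 2 ℕ.≤ p → ℤ→ℚ (+ 2) ℚ.≤ geoValue p
  2≤geoValue {suc (suc p)} (s≤s (s≤s z≤n)) = ℚ.+-monoʳ-≤ 1ℚ (ℚ.≤-trans 1≤z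
    (subst (ℚ._≤ z ℚ.* geoValue (suc p)) (ℚ.*-identityʳ z)
      (ℚ.*-monoˡ-≤-nonNeg z {{ℚ.nonNegative 0≤z}} (1≤geoValue p))))

  -- For z ≥ 1 and p ≥ 2 the value [p](z) is at least 2, so each of the k cofactors is at most half
  -- the product.
  cofactorsValue-bound : ∀ {ps} → All (2 ℕ.≤_) ps →
    ℤ→ℚ (+ 2) ℚ.* cofactorsValue ps ℚ.≤ ℤ→ℚ (+ length ps) ℚ.* prodValue ps
  cofactorsValue-bound [] = ℚ.≤-refl
  cofactorsValue-bound {p ∷ ps} (2≤p ∷ 2≤ps) = let open ℚ.≤-Reasoning in begin
    ℤ→ℚ (+ 2) ℚ.* (c ℚ.+ g ℚ.* b)
      ≡⟨ solve 3 (λ c g b → :2 :* (c :+ g :* b) := :2 :* c :+ g :* (:2 :* b)) refl c g b ⟩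
    ℤ→ℚ (+ 2) ℚ.* c ℚ.+ g ℚ.* (ℤ→ℚ (+ 2) ℚ.* b)
      ≤⟨ ℚ.+-mono-≤ (ℚ.*-monoʳ-≤-nonNeg c {{ℚ.nonNegative (prodValue-nonneg ps)}} (2≤geoValue 2≤p))
           (ℚ.*-monoˡ-≤-nonNeg g {{ℚ.nonNegative (geoValue-nonneg p)}} (cofactorsValue-bound 2≤ps)) ⟩
    g ℚ.* c ℚ.+ g ℚ.* (ℤ→ℚ (+ length ps) ℚ.* c)
      ≡⟨ solve 3 (λ c g k → g :* c :+ g :* (k :* c) := (:1 :+ k) :* (g :* c)) refl c g (ℤ→ℚ (+ length ps)) ⟩
    (1ℚ ℚ.+ ℤ→ℚ (+ length ps)) ℚ.* (g ℚ.* c)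
      ≡⟨ cong (ℚ._* (g ℚ.* c)) (sym (ℤ→ℚ-+ (+ 1) (+ length ps))) ⟩
    ℤ→ℚ (+ suc (length ps)) ℚ.* (g ℚ.* c) ∎
    where
    c = prodValue ps
    g = geoValue p
    b = cofactorsValue ps

-- The denominator of ε does it: multiplied by ε it is the numerator, a positive integer.
archimedean : ∀ {ε} → 0ℚ ℚ.< ε → ∃[ k ] 1ℚ ℚ.≤ ℤ→ℚ (+ suc k) ℚ.* ε
archimedean {mkℚ (+ zero) _ _} (ℚ.*<* (ℤ.+<+ ()))
archimedean {ε@(mkℚ (+ suc n) d _)} _ = d , subst (1ℚ ℚ.≤_) (sym (denominator-* ε))
  (ℤ→ℚ-mono-≤ {+ 1} {+ suc n} (ℤ.+≤+ (s≤s z≤n)))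
archimedean {mkℚ -[1+ _ ] _ _} (ℚ.*<* ())

module Bisection (f : ℚ → ℚ) (lo : ℚ) (f-lo : f lo ℚ.≤ 0ℚ) (f-hi : 0ℚ ℚ.≤ f (lo ℚ.+ 1ℚ)) where
  open IntegerSolver ℚ-algebra
  open RealOrder

  width : ℕ → ℚ
  width zero    = 1ℚ
  width (suc n) = ½ ℚ.* width n

  record Bracket (w : ℚ) : Set where
    constructor bracket
    field
      left     : ℚ
      f-left   : f left ℚ.≤ 0ℚ
      f-right  : 0ℚ ℚ.≤ f (left ℚ.+ w)
  open Bracket

  refine : ∀ {w} (b : Bracket w) → Dec (f (left b ℚ.+ ½ ℚ.* w) ℚ.≤ 0ℚ) → Bracket (½ ℚ.* w)
  refine {w} (bracket l fl fr) (yes fm) = bracket (l ℚ.+ ½ ℚ.* w) fm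
    (subst (λ r → 0ℚ ℚ.≤ f r) (trans (cong (l ℚ.+_) (sym (half-double w)))
      (sym (ℚ.+-assoc l (½ ℚ.* w) (½ ℚ.* w)))) fr)
  refine {w} (bracket l fl fr) (no fm) = bracket l fl (ℚ.<⇒≤ (ℚ.≰⇒> fm))

  test : ∀ {w} (b : Bracket w) → Dec (f (left b ℚ.+ ½ ℚ.* w) ℚ.≤ 0ℚ)
  test b = _ ℚ.≤? 0ℚ

  brackets : ∀ n → Bracket (width n)
  brackets zero    = bracket lo f-lo f-hi
  brackets (suc n) = refine (brackets n) (test (brackets n))

  width-positive : ∀ n → 0ℚ ℚ.< width n
  width-positive zero    = ℚ.positive⁻¹ 1ℚ
  width-positive (suc n) = half-positive (width-positive n)

  width-bound : ∀ n → ℤ→ℚ (+ suc n) ℚ.* width n ℚ.≤ 1ℚ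
  width-bound zero    = ℚ.≤-refl
  width-bound (suc n) = ℚ.≤-trans (let open ℚ.≤-Reasoning in begin
    ℤ→ℚ (+ suc (suc n)) ℚ.* (½ ℚ.* w)
      ≤⟨ ℚ.*-monoʳ-≤-nonNeg (½ ℚ.* w) {{ℚ.pos⇒nonNeg (½ ℚ.* w) {{ℚ.positive (width-positive (suc n))}}}}
           (ℤ→ℚ-mono-≤ {+ suc (suc n)} {+ (suc n ℕ.+ suc n)} (ℤ.+≤+ (s≤s (ℕ.m≤n+m (suc n) n)))) ⟩
    ℤ→ℚ (+ (suc n ℕ.+ suc n)) ℚ.* (½ ℚ.* w)
      ≡⟨ cong (ℚ._* (½ ℚ.* w)) (ℤ→ℚ-+ (+ suc n) (+ suc n)) ⟩
    (ℤ→ℚ (+ suc n) ℚ.+ ℤ→ℚ (+ suc n)) ℚ.* (½ ℚ.* w)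
      ≡⟨ solve 2 (λ a h → (a :+ a) :* h := a :* (h :+ h)) refl (ℤ→ℚ (+ suc n)) (½ ℚ.* w) ⟩
    ℤ→ℚ (+ suc n) ℚ.* (½ ℚ.* w ℚ.+ ½ ℚ.* w)
      ≡⟨ cong (ℤ→ℚ (+ suc n) ℚ.*_) (half-double w) ⟩
    ℤ→ℚ (+ suc n) ℚ.* w ∎) (width-bound n)
    where w = width n

  width-small : ∀ {ε} → 0ℚ ℚ.< ε → ∃[ N ] width N ℚ.< ε
  width-small {ε} 0<ε =
    let k , 1≤kε = archimedean 0<ε in
    suc k , ℚ.<-≤-trans (half-< (width-positive k))
      (ℚ.*-cancelˡ-≤-pos (ℤ→ℚ (+ suc k)) {{ℚ.positive (ℤ→ℚ-mono-< {+ 0} {+ suc k} (ℤ.+<+ (s≤s z≤n)))}}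
        (ℚ.≤-trans (width-bound k) 1≤kε))

  left-refine : ∀ {w} (b : Bracket w) d → 0ℚ ℚ.< w → left b ℚ.≤ left (refine b d)
  left-refine {w} (bracket l _ _) (yes _) 0<w = subst (ℚ._≤ l ℚ.+ ½ ℚ.* w) (ℚ.+-identityʳ l)
    (ℚ.+-monoʳ-≤ l (ℚ.<⇒≤ (half-positive 0<w)))
  left-refine (bracket l _ _) (no _) _ = ℚ.≤-refl

  right-refine : ∀ {w} (b : Bracket w) d → 0ℚ ℚ.< w →
    left (refine b d) ℚ.+ ½ ℚ.* w ℚ.≤ left b ℚ.+ w
  right-refine {w} (bracket l _ _) (yes _) 0<w = ℚ.≤-reflexive
    (trans (ℚ.+-assoc l (½ ℚ.* w) (½ ℚ.* w)) (cong (l ℚ.+_) (half-double w)))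
  right-refine (bracket l _ _) (no _) 0<w = ℚ.+-monoʳ-≤ l (ℚ.<⇒≤ (half-< 0<w))

  lower upper : ℕ → ℚ
  lower n = left (brackets n)
  upper n = lower n ℚ.+ width n

  lower-mono : ∀ N n → lower N ℚ.≤ lower (n ℕ.+ N)
  lower-mono N zero    = ℚ.≤-refl
  lower-mono N (suc n) = ℚ.≤-trans (lower-mono N n)
    (left-refine (brackets (n ℕ.+ N)) (test (brackets (n ℕ.+ N))) (width-positive (n ℕ.+ N)))

  upper-antitone : ∀ N n → upper (n ℕ.+ N) ℚ.≤ upper N
  upper-antitone N zero    = ℚ.≤-refl
  upper-antitone N (suc n) = ℚ.≤-trans
    (right-refine (brackets (n ℕ.+ N)) (test (brackets (n ℕ.+ N))) (width-positive (n ℕ.+ N))) (upper-antitone N n)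

  lower<upper : ∀ n → lower n ℚ.< upper n
  lower<upper n = subst (ℚ._< upper n) (ℚ.+-identityʳ (lower n))
    (ℚ.+-monoʳ-< (lower n) (width-positive n))

  lower-close : ∀ N m n → N ℕ.≤ m → N ℕ.≤ n → lower m ℚ.- lower n ℚ.< width N
  lower-close N m n N≤m N≤n = subst (lower m ℚ.- lower n ℚ.<_)
    (solve 2 (λ l w → (l :+ w) :- l := w) refl (lower N) (width N))
    (ℚ.+-mono-<-≤
      (ℚ.<-≤-trans (lower<upper m) (subst (λ k → upper k ℚ.≤ upper N) (ℕ.m∸n+n≡m N≤m)
        (upper-antitone N (m ℕ.∸ N))))
      (ℚ.neg-antimono-≤ (subst (λ k → lower N ℚ.≤ lower k) (ℕ.m∸n+n≡m N≤n)
        (lower-mono N (n ℕ.∸ N)))))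

  lower-cauchy : Cauchy lower
  lower-cauchy ε 0<ε =
    let N , w<ε = width-small 0<ε in
    N , λ m n N≤m N≤n → ℚ.<-trans (∣∣<-intro
      (subst (ℚ.- width N ℚ.<_)
        (solve 2 (λ a b → :- (b :- a) := a :- b) refl (lower m) (lower n))
        (ℚ.neg-antimono-< (lower-close N n m N≤n N≤m)))
      (lower-close N m n N≤m N≤n)) w<ε

  root : ℝ
  root = mkℝ lower lower-cauchy

  width-null : Null width
  width-null ε 0<ε =
    let N , w<ε = width-small 0<ε in
    N , λ n N≤n → ∣∣<-intro (ℚ.<-trans (ℚ.neg-antimono-< 0<ε) (width-positive n))
      (ℚ.≤-<-trans (subst (λ k → width k ℚ.≤ width N) (ℕ.m∸n+n≡m N≤n) (antitone N (n ℕ.∸ N))) w<ε)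
    where
    antitone : ∀ N n → width (n ℕ.+ N) ℚ.≤ width N
    antitone N zero    = ℚ.≤-refl
    antitone N (suc n) = ℚ.≤-trans (ℚ.<⇒≤ (half-< (width-positive (n ℕ.+ N)))) (antitone N n)

  upper-cauchy : Cauchy upper
  upper-cauchy ε 0<ε =
    let M , close = lower-cauchy (½ ℚ.* ε) (half-positive 0<ε)
        N , small = width-null (½ ℚ.* (½ ℚ.* ε)) (half-positive (half-positive 0<ε)) in
    M ℕ.⊔ N , λ m n Nm Nn → subst₂ ℚ._<_
      (cong ℚ.∣_∣ (solve 4 (λ a b c d → (a :- c) :+ (b :- d) := (a :+ b) :- (c :+ d)) refl
        (lower m) (width m) (lower n) (width n)))
      (half-double ε)
      (ℚ.≤-<-trans (ℚ.∣p+q∣≤∣p∣+∣q∣ (lower m ℚ.- lower n) (width m ℚ.- width n))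
        (ℚ.+-mono-< (close m n (ℕ.m⊔n≤o⇒m≤o M N Nm) (ℕ.m⊔n≤o⇒m≤o M N Nn))
          (ℚ.≤-<-trans (ℚ.∣p-q∣≤∣p∣+∣q∣ (width m) (width n))
            (subst (ℚ.∣ width m ∣ ℚ.+ ℚ.∣ width n ∣ ℚ.<_) (half-double (½ ℚ.* ε))
              (ℚ.+-mono-< (small m (ℕ.m⊔n≤o⇒n≤o M N Nm)) (small n (ℕ.m⊔n≤o⇒n≤o M N Nn)))))))

  root⁺ : ℝ
  root⁺ = mkℝ upper upper-cauchy

  root⁺≈root : root⁺ ≈ℝ root
  root⁺≈root = null-resp
    (λ n → solve 2 (λ l w → w := (l :+ w) :- l) refl (lower n) (width n)) width-null

  root-≥ : ∀ n → lo ℚ.≤ seq root n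
  root-≥ n = subst (λ k → lo ℚ.≤ lower k) (ℕ.+-identityʳ n) (lower-mono 0 n)

  -- The left and right end points represent the same real number. F is computed termwise, so it is
  -- at most 0 on the former and at least 0 on the latter; compatibility of F with `≈ℝ` replaces a
  -- modulus of continuity.
  root-zero : ∀ (F : ℝ → ℝ) → (∀ {x y} → x ≈ℝ y → F x ≈ℝ F y) →
    (∀ x n → seq (F x) n ≡ f (seq x n)) → F root ≈ℝ 0ℝ
  root-zero F F-cong F-seq = nonNeg-antisym {F root}
    (nonNeg-resp {F root⁺} {F root} (F-cong {root⁺} {root} root⁺≈root)
      (nonNeg-pointwise {F root⁺} λ n →
        subst (0ℚ ℚ.≤_) (sym (F-seq root⁺ n)) (f-right (brackets n))))
    (nonNeg-pointwise { -ℝ F root} λ n →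
      subst (λ q → 0ℚ ℚ.≤ ℚ.- q) (sym (F-seq root n)) (ℚ.neg-antimono-≤ (f-left (brackets n))))

ℝ-ordered : OrderedAlgebra
ℝ-ordered = record
  { algebra       = ℝ-algebra
  ; NonNeg        = RealOrder.NonNeg
  ; Pos           = RealOrder.Pos
  ; nonNeg-resp   = λ {x} {y} → RealOrder.nonNeg-resp {x} {y}
  ; nonNeg-0      = RealOrder.nonNeg-pointwise {0ℝ} λ _ → ℚ.≤-refl
  ; nonNeg-+      = λ {x} {y} → RealOrder.nonNeg-+ {x} {y}
  ; nonNeg-square = RealOrder.nonNeg-square
  ; nonNeg-*      = λ {x} {y} → RealOrder.nonNeg-* {x} {y}
  ; nonNeg-cancel = λ {x} {y} → RealOrder.nonNeg-cancel {x} {y}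
  ; nonNeg-antisym = λ {x} → RealOrder.nonNeg-antisym {x}
  ; square≈0      = λ {x} → RealOrder.square≈0 {x}
  ; pos⇒nonNeg    = λ {x} → RealOrder.pos⇒nonNeg {x}
  ; pos-resp      = λ {x} {y} → RealOrder.pos-resp {x} {y}
  ; ¬pos-0        = λ (ε , 0<ε , N , lower) → ℚ.<-asym 0<ε (lower N ℕ.≤-refl)
  ; pos-1         = RealOrder.pos-pointwise {1ℝ} (ℚ.positive⁻¹ ℚ.½) λ _ → half-< (ℚ.positive⁻¹ 1ℚ)
  ; pos-+-nonNeg  = λ {x} {y} → RealOrder.pos-+-nonNeg {x} {y}
  ; pos-*         = λ {x} {y} → RealOrder.pos-* {x} {y}
  ; pos-cancel    = λ {x} {y} → RealOrder.pos-cancel {x} {y}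
  ; ¬pos⇒≈0       = λ {x} → RealOrder.¬pos⇒≈0 {x}
  }

-- Comparison of evaluations over ℚ, ℝ and ℂ; norms of complex numbers

module ℂ-ring = ℤ-Algebra ℂ-algebra
module ℝ-Vieta = Vieta ℝ-algebra
module ℚ-Vieta = Vieta ℚ-algebra
module ℂ-Vieta = Vieta ℂ-algebra

ratEval : ∀ {d} → Vec ℚ d → ℚ → ℚ
ratEval []      x = 1ℚ
ratEval (c ∷ p) x = c ℚ.+ x ℚ.* ratEval p x

module _ where
  open IntegerSolver ℚ-algebra

  eval-real : ∀ {d} (p : Vec ℚ d) x n →
    seq (re (eval p (ℝ→ℂ x))) n ≡ ratEval p (seq x n) × seq (im (eval p (ℝ→ℂ x))) n ≡ 0ℚ
  eval-real []      x n = refl , refl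
  eval-real (c ∷ p) x n = let r , i = eval-real p x n in
    trans (cong₂ (λ a b → c ℚ.+ (seq x n ℚ.* a ℚ.- 0ℚ ℚ.* b)) r i)
      (solve 3 (λ c x e → c :+ (x :* e :- :0 :* :0) := c :+ x :* e) refl c (seq x n) (ratEval p (seq x n))) ,
    trans (cong₂ (λ a b → 0ℚ ℚ.+ (seq x n ℚ.* b ℚ.+ 0ℚ ℚ.* a)) r i)
      (solve 2 (λ x e → :0 :+ (x :* :0 :+ :0 :* e) := :0) refl (seq x n) (ratEval p (seq x n)))

  ratEval-ℤ : ∀ {d} (p : Vec ℤ d) x → ratEval (Vec.map ℤ→ℚ p) x ≡ ℚ-Vieta.evaluate p x
  ratEval-ℤ []      x = refl
  ratEval-ℤ (c ∷ p) x = cong (λ e → ℤ→ℚ c ℚ.+ x ℚ.* e) (ratEval-ℤ p x)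

  evaluate-seq : ∀ {d} (p : Vec ℤ d) x n →
    seq (ℝ-Vieta.evaluate p x) n ≡ ℚ-Vieta.evaluate p (seq x n)
  evaluate-seq []      x n = refl
  evaluate-seq (c ∷ p) x n = cong (λ e → ℤ→ℚ c ℚ.+ seq x n ℚ.* e) (evaluate-seq p x n)

  ≈ℝ-via : ∀ {x y z} → (∀ n → seq x n ≡ seq y n) → y ≈ℝ z → x ≈ℝ z
  ≈ℝ-via {z = z} eq = null-resp λ n → cong (ℚ._- seq z n) (sym (eq n))

  real-root : ∀ {d} (p : Vec ℤ d) x → ℝ-Vieta.evaluate p x ≈ℝ 0ℝ →
    eval (Vec.map ℤ→ℚ p) (ℝ→ℂ x) ≈ 0ℂ
  real-root p x root =
    ≈ℝ-via {re (eval (Vec.map ℤ→ℚ p) (ℝ→ℂ x))} {ℝ-Vieta.evaluate p x} {0ℝ}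
      (λ n → trans (proj₁ (eval-real (Vec.map ℤ→ℚ p) x n))
          (trans (ratEval-ℤ p (seq x n)) (sym (evaluate-seq p x n))))
      root ,
    ≈ℝ-pointwise {im (eval (Vec.map ℤ→ℚ p) (ℝ→ℂ x))} {0ℝ} λ n →
      proj₂ (eval-real (Vec.map ℤ→ℚ p) x n)

  eval-ℤ : ∀ {d} (p : Vec ℤ d) z n →
    seq (re (eval (Vec.map ℤ→ℚ p) z)) n ≡ seq (re (ℂ-Vieta.evaluate p z)) n ×
    seq (im (eval (Vec.map ℤ→ℚ p) z)) n ≡ seq (im (ℂ-Vieta.evaluate p z)) n
  eval-ℤ []      z n = refl , refl
  eval-ℤ (c ∷ p) z n = let r , i = eval-ℤ p z n in
    cong₂ (λ a b → ℤ→ℚ c ℚ.+ (seq (re z) n ℚ.* a ℚ.- seq (im z) n ℚ.* b)) r i ,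
    cong₂ (λ a b → 0ℚ ℚ.+ (seq (re z) n ℚ.* b ℚ.+ seq (im z) n ℚ.* a)) r i

  private
    integerEval : ∀ {d} → Vec ℤ d → ℤ → ℚ → ℚ
    integerEval r N = Embedding.evaluateAt ℚ-algebra (Vec.map ℤ→ℚ r) (ℤ→ℚ N)

  integerEval-scale : ∀ {d} b (r : Vec ℤ d) N x →
    integerEval (Vec.map (b ℤ.*_) r) (b ℤ.* N) x ≡ ℤ→ℚ b ℚ.* integerEval r N x
  integerEval-scale b []      N x = ℤ→ℚ-* b N
  integerEval-scale b (c ∷ r) N x = trans
    (cong₂ (λ u v → u ℚ.+ x ℚ.* v) (ℤ→ℚ-* b c) (integerEval-scale b r N x))
    (solve 4 (λ b c x e → b :* c :+ x :* (b :* e) := b :* (c :+ x :* e)) refl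
      (ℤ→ℚ b) (ℤ→ℚ c) x _)

  -- N is the product of all denominators, and it reappears as the leading coefficient because q is
  -- monic.
  clearDenominators : ∀ {d} (q : Vec ℚ d) → ∃[ N ] (N ≢ + 0 × Σ (Vec ℤ d) λ r →
    ∀ x → integerEval r N x ≡ ℤ→ℚ N ℚ.* ratEval q x)
  clearDenominators []      = + 1 , (λ ()) , [] , λ _ → refl
  clearDenominators (c ∷ q) =
    let N , N≢0 , r , eq = clearDenominators q
        a = ℚ.numerator c
        b = ℚ.denominator c in
    b ℤ.* N
    , (λ bN≡0 → nonzero (ℤ.i*j≡0⇒i≡0∨j≡0 b bN≡0) N≢0)
    , a ℤ.* N ∷ Vec.map (b ℤ.*_) r
    , λ x → begin
      ℤ→ℚ (a ℤ.* N) ℚ.+ x ℚ.* integerEval (Vec.map (b ℤ.*_) r) (b ℤ.* N) x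
        ≡⟨ cong₂ (λ u v → u ℚ.+ x ℚ.* v)
             (trans (ℤ→ℚ-* a N) (cong (ℚ._* ℤ→ℚ N) (sym (denominator-* c))))
             (trans (integerEval-scale b r N x) (cong (ℤ→ℚ b ℚ.*_) (eq x))) ⟩
      ℤ→ℚ b ℚ.* c ℚ.* ℤ→ℚ N ℚ.+ x ℚ.* (ℤ→ℚ b ℚ.* (ℤ→ℚ N ℚ.* ratEval q x))
        ≡⟨ solve 5 (λ b c N x e → b :* c :* N :+ x :* (b :* (N :* e)) := b :* N :* (c :+ x :* e)) refl
             (ℤ→ℚ b) c (ℤ→ℚ N) x (ratEval q x) ⟩
      ℤ→ℚ b ℚ.* ℤ→ℚ N ℚ.* (c ℚ.+ x ℚ.* ratEval q x)
        ≡⟨ cong (ℚ._* (c ℚ.+ x ℚ.* ratEval q x)) (sym (ℤ→ℚ-* b N)) ⟩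
      ℤ→ℚ (b ℤ.* N) ℚ.* (c ℚ.+ x ℚ.* ratEval q x) ∎
    where
    open ≡.≡-Reasoning
    nonzero : ∀ {N} → ℚ.denominator c ≡ + 0 ⊎ N ≡ + 0 → ¬ (N ≢ + 0)
    nonzero (inj₂ N≡0) N≢0 = N≢0 N≡0

  integerEval-seq : ∀ {d} (r : Vec ℤ d) N x n →
    seq (Embedding.evaluateAt ℝ-algebra (Vec.map (λ i → fromℚ (ℤ→ℚ i)) r) (fromℚ (ℤ→ℚ N)) x) n
      ≡ integerEval r N (seq x n)
  integerEval-seq []      N x n = refl
  integerEval-seq (c ∷ r) N x n = cong (λ e → ℤ→ℚ c ℚ.+ seq x n ℚ.* e) (integerEval-seq r N x n)

  integer-multiple : ∀ {d} (q : Vec ℚ d) x → eval q (ℝ→ℂ x) ≈ 0ℂ →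
    ∃[ N ] (N ≢ + 0 × Σ (Vec ℤ d) λ r →
      Embedding.evaluateAt ℝ-algebra (Vec.map (λ i → fromℚ (ℤ→ℚ i)) r) (fromℚ (ℤ→ℚ N)) x ≈ℝ 0ℝ)
  integer-multiple q x (qx≈0 , _) =
    let N , N≢0 , r , eq = clearDenominators q in
    N , N≢0 , r , null-resp
      (λ n → sym (trans
        (cong (ℚ._- 0ℚ) (trans (integerEval-seq r N x n)
          (trans (eq (seq x n)) (cong (ℤ→ℚ N ℚ.*_) (sym (proj₁ (eval-real q x n)))))))
        (solve 2 (λ k e → k :* e :- :0 := k :* (e :- :0)) refl
          (ℤ→ℚ N) (seq (re (eval q (ℝ→ℂ x))) n))))
      (null-* (bounded (fromℚ (ℤ→ℚ N))) qx≈0)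

module _ where
  open IntegerSolver ℚ-algebra

  infix 4 _~_
  -- The two families of evaluations perform the same operations, so they agree term by term; this
  -- relation moves between them without estimates.
  _~_ : ℂ → ℂ → Set
  z ~ w = ∀ n → seq (re z) n ≡ seq (re w) n × seq (im z) n ≡ seq (im w) n

  ≈-resp-~ : ∀ {z z′ w w′} → z ~ z′ → w ~ w′ → z ≈ w → z′ ≈ w′
  ≈-resp-~ p q (r , i) =
    null-resp (λ n → cong₂ ℚ._-_ (proj₁ (p n)) (proj₁ (q n))) r ,
    null-resp (λ n → cong₂ ℚ._-_ (proj₂ (p n)) (proj₂ (q n))) i

  ~-refl : ∀ {z} → z ~ z
  ~-refl n = refl , refl

  ~-sym : ∀ {z w} → z ~ w → w ~ z
  ~-sym p n = sym (proj₁ (p n)) , sym (proj₂ (p n))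

  productℂ-fromRoots : ∀ {d} (zs : Vec ℂ d) w →
    productℂ (Vec.map (λ z → w - z) zs) ~ ℂ-Vieta.fromRoots zs w
  productℂ-fromRoots []       w n = refl , refl
  productℂ-fromRoots (z ∷ zs) w n = let r , i = productℂ-fromRoots zs w n
                                        x = seq (re w) n ℚ.- seq (re z) n
                                        y = seq (im w) n ℚ.- seq (im z) n in
    cong₂ (λ a b → x ℚ.* a ℚ.- y ℚ.* b) r i , cong₂ (λ a b → x ℚ.* b ℚ.+ y ℚ.* a) r i

  sumℂ-sum : ∀ {d} (zs : Vec ℂ d) → ℂ-Vieta.sumRoots zs ~ sumℂ zs
  sumℂ-sum []       n = refl , refl
  sumℂ-sum (z ∷ zs) n = let r , i = sumℂ-sum zs n in
    cong (seq (re z) n ℚ.+_) r , cong (seq (im z) n ℚ.+_) i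

  ℂ-torsion-free : ∀ n {t} → ℚ→ℂ (ℤ→ℚ (+ suc n)) * t ≈ 0ℂ → t ≈ 0ℂ
  ℂ-torsion-free n {t} (r , i) =
    let k = ℤ→ℚ (+ suc n)
        δ , 0<δ , kδ≡1 = divide {k} {1ℚ} (ℤ→ℚ-mono-< {+ 0} {+ suc n} (ℤ.+<+ (s≤s z≤n))) (ℚ.positive⁻¹ 1ℚ) in
    null-resp (λ m → trans
        (solve 4 (λ k δ a b → δ :* (k :* a :- :0 :* b :- :0) := k :* δ :* a) refl
          k δ (seq (re t) m) (seq (im t) m))
        (trans (cong (ℚ._* seq (re t) m) kδ≡1)
          (solve 1 (λ a → :1 :* a := a :- :0) refl (seq (re t) m))))
      (null-* (bounded (fromℚ δ)) r) ,
    null-resp (λ m → trans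
        (solve 4 (λ k δ a b → δ :* (k :* b :+ :0 :* a :- :0) := k :* δ :* b) refl
          k δ (seq (re t) m) (seq (im t) m))
        (trans (cong (ℚ._* seq (im t) m) kδ≡1)
          (solve 1 (λ a → :1 :* a := a :- :0) refl (seq (im t) m))))
      (null-* (bounded (fromℚ δ)) i)

  norm : ℂ → ℝ
  norm z = re z *ℝ re z +ℝ im z *ℝ im z

  norm-* : ∀ z w → norm (z * w) ≈ℝ norm z *ℝ norm w
  norm-* z w = ≈ℝ-pointwise {norm (z * w)} {norm z *ℝ norm w} λ n →
    solve 4 (λ a b c d →
      (a :* c :- b :* d) :* (a :* c :- b :* d) :+ (a :* d :+ b :* c) :* (a :* d :+ b :* c)
      := (a :* a :+ b :* b) :* (c :* c :+ d :* d)) refl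
      (seq (re z) n) (seq (im z) n) (seq (re w) n) (seq (im w) n)

  norm-cong : ∀ {z w} → z ≈ w → norm z ≈ℝ norm w
  norm-cong {z} {w} (r , i) = ≈ℝ-+ {re z *ℝ re z} {re w *ℝ re w} {im z *ℝ im z} {im w *ℝ im w}
    (≈ℝ-* {re z} {re w} {re z} {re w} r r) (≈ℝ-* {im z} {im w} {im z} {im w} i i)

  norm-nonneg : ∀ z → RealOrder.NonNeg (norm z)
  norm-nonneg z = RealOrder.nonNeg-pointwise {norm z} λ n →
    ℚ.+-mono-≤ (square-nonneg (seq (re z) n)) (square-nonneg (seq (im z) n))

  norm-ι-positive : ∀ n → RealOrder.Pos (norm (ℚ→ℂ (ℤ→ℚ (+ suc n))))
  norm-ι-positive n = RealOrder.pos-resp {k *ℝ k} {norm (ℚ→ℂ (ℤ→ℚ (+ suc n)))}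
    (≈ℝ-pointwise {k *ℝ k} {norm (ℚ→ℂ (ℤ→ℚ (+ suc n)))} λ _ →
      solve 1 (λ k → k :* k := k :* k :+ :0 :* :0) refl (ℤ→ℚ (+ suc n)))
    (RealOrder.pos-* {k} {k} (Ordered.pos-ι ℝ-ordered n) (Ordered.pos-ι ℝ-ordered n))
    where k = fromℚ (ℤ→ℚ (+ suc n))

  -- By multiplicativity |w|² |v|² is the fourth power of a positive integer; since |w|² ≥ 0, the
  -- other factor |v|² is positive.
  norm-factor-positive : ∀ w v n →
    w * v ≈ ℚ→ℂ (ℤ→ℚ (+ suc n)) * ℚ→ℂ (ℤ→ℚ (+ suc n)) → RealOrder.Pos (norm v)
  norm-factor-positive w v n eq = RealOrder.pos-cancel {norm w} {norm v} (norm-nonneg w)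
    (RealOrder.pos-resp {norm (k * k)} {norm w *ℝ norm v}
      (ℝ-ring.trans {norm (k * k)} {norm (w * v)} {norm w *ℝ norm v}
        (ℝ-ring.sym {norm (w * v)} {norm (k * k)} (norm-cong {w * v} {k * k} eq)) (norm-* w v))
      (RealOrder.pos-resp {norm k *ℝ norm k} {norm (k * k)}
        (ℝ-ring.sym {norm (k * k)} {norm k *ℝ norm k} (norm-* k k))
        (RealOrder.pos-* {norm k} {norm k} (norm-ι-positive n) (norm-ι-positive n))))
    where k = ℚ→ℂ (ℤ→ℚ (+ suc n))

  shifted-norm-positive : ∀ z v {a b} → re v ≈ℝ a → im v ≈ℝ b → RealOrder.Pos (norm ((z - 1ℂ) * v)) →
    RealOrder.Pos (((re z -ℝ 1ℝ) *ℝ (re z -ℝ 1ℝ) +ℝ im z *ℝ im z) *ℝ (a *ℝ a +ℝ b *ℝ b))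
  shifted-norm-positive z v {a} {b} re≈ im≈ = RealOrder.pos-resp {norm ((z - 1ℂ) * v)} {x *ℝ norm (a +i b)}
    (ℝ-ring.trans {norm ((z - 1ℂ) * v)} {x *ℝ norm v} {x *ℝ norm (a +i b)}
      (≈ℝ-pointwise {norm ((z - 1ℂ) * v)} {x *ℝ norm v} λ n →
        solve 4 (λ a b c d →
          ((a :- :1) :* c :- (b :- :0) :* d) :* ((a :- :1) :* c :- (b :- :0) :* d)
            :+ ((a :- :1) :* d :+ (b :- :0) :* c) :* ((a :- :1) :* d :+ (b :- :0) :* c)
          := ((a :- :1) :* (a :- :1) :+ b :* b) :* (c :* c :+ d :* d)) refl
          (seq (re z) n) (seq (im z) n) (seq (re v) n) (seq (im v) n))
      (≈ℝ-* {x} {x} {norm v} {norm (a +i b)} (ℝ-ring.refl {x}) (norm-cong {v} {a +i b} (re≈ , im≈))))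
    where x = (re z -ℝ 1ℝ) *ℝ (re z -ℝ 1ℝ) +ℝ im z *ℝ im z

  re-ι : ∀ i z → re (ℚ→ℂ (ℤ→ℚ i) * z) ≈ℝ fromℚ (ℤ→ℚ i) *ℝ re z
  re-ι i z = ≈ℝ-pointwise {re (ℚ→ℂ (ℤ→ℚ i) * z)} {fromℚ (ℤ→ℚ i) *ℝ re z} λ n →
    solve 3 (λ k a b → k :* a :- :0 :* b := k :* a) refl (ℤ→ℚ i) (seq (re z) n) (seq (im z) n)

  im-ι : ∀ i z → im (ℚ→ℂ (ℤ→ℚ i) * z) ≈ℝ fromℚ (ℤ→ℚ i) *ℝ im z
  im-ι i z = ≈ℝ-pointwise {im (ℚ→ℂ (ℤ→ℚ i) * z)} {fromℚ (ℤ→ℚ i) *ℝ im z} λ n →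
    solve 3 (λ k a b → k :* b :+ :0 :* a := k :* b) refl (ℤ→ℚ i) (seq (re z) n) (seq (im z) n)

module Re = AdditiveMap.Along ℂ-algebra ℝ-algebra re (ℝ-ring.refl {0ℝ})
  (λ z w → ℝ-ring.refl {re z +ℝ re w}) (λ z → ℝ-ring.refl { -ℝ re z})
module Im = AdditiveMap.Along ℂ-algebra ℝ-algebra im (ℝ-ring.refl {0ℝ})
  (λ z w → ℝ-ring.refl {im z +ℝ im w}) (λ z → ℝ-ring.refl { -ℝ im z})

-- The Pisot number

module Construction
  {p₁ : ℕ} {ps′ : List ℕ} (T : ℕ) (length≡ : length (p₁ ∷ ps′) ≡ 2 ℕ.* T ℕ.+ 4)
  (2≤ps : All (2 ℕ.≤_) (p₁ ∷ ps′)) (coprime : AllPairs Coprime (p₁ ∷ ps′)) where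

  ps : List ℕ
  ps = p₁ ∷ ps′

  m : ℕ
  m = 3 ℕ.+ T

  M : ℤ
  M = + m

  d : ℕ
  d = degree ps 2

  P : Vec ℤ d
  P = pisotPolynomial ps M

  Pℚ : Vec ℚ d
  Pℚ = Vec.map ℤ→ℚ P

  1≤ps : All (1 ℕ.≤_) ps
  1≤ps = All.map (λ 2≤p → ℕ.≤-trans (s≤s z≤n) 2≤p) 2≤ps

  k+2≡2m : length ps ℕ.+ 2 ≡ 2 ℕ.* m
  k+2≡2m = trans (cong (ℕ._+ 2) length≡)
    (solve 1 (λ t → con 2 :* t :+ con 4 :+ con 2 := con 2 :* (con 3 :+ t)) refl T)
    where open ℕSolver.+-*-Solver

  k+2≡2M : + length ps ℤ.+ + 2 ≡ + 2 ℤ.* M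
  k+2≡2M = trans (cong +_ k+2≡2m) (ℤ.pos-* 2 m)

  d-bound : d ≤ sum ps
  d-bound = ℕ.+-cancelʳ-≤ (length ps) d (sum ps) (begin
    d ℕ.+ length ps       ≡⟨ degree-sum 2 1≤ps ⟩
    2 ℕ.+ sum ps          ≡⟨ ℕ.+-comm 2 (sum ps) ⟩
    sum ps ℕ.+ 2          ≤⟨ ℕ.+-monoʳ-≤ (sum ps) 2≤k ⟩
    sum ps ℕ.+ length ps  ∎)
    where
    open ℕ.≤-Reasoning
    2≤k : 2 ≤ length ps
    2≤k = subst (2 ≤_) (sym length≡) (ℕ.≤-trans (s≤s (s≤s z≤n)) (ℕ.m≤n+m 4 (2 ℕ.* T)))

  degree-≥ : ∀ qs e → e ≤ degree qs e
  degree-≥ []       e = ℕ.≤-refl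
  degree-≥ (q ∷ qs) e = ℕ.≤-trans (ℕ.m≤n+m e (ℕ.pred q)) (degree-≥ qs (ℕ.pred q ℕ.+ e))

  0<d : 0 ℕ.< d
  0<d = ℕ.≤-trans (s≤s z≤n) (degree-≥ ps 2)

  second-P : second P ≡ + T
  second-P = begin
    second P
      ≡⟨ second-starPolynomial {ps} (M ∷ ℤ.- (M ℤ.+ + 1) ∷ []) [] (s≤s z≤n) 2≤ps ⟩
    + length ps ℤ.- (M ℤ.+ + 1)
      ≡⟨ cong (λ k → + k ℤ.- (M ℤ.+ + 1)) length≡′ ⟩
    + (T ℕ.+ (m ℕ.+ 1)) ℤ.- + (m ℕ.+ 1)
      ≡⟨ cong (ℤ._- + (m ℕ.+ 1)) (ℤ.pos-+ T (m ℕ.+ 1)) ⟩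
    (+ T ℤ.+ + (m ℕ.+ 1)) ℤ.- + (m ℕ.+ 1)
      ≡⟨ ℤ.+-assoc (+ T) (+ (m ℕ.+ 1)) (ℤ.- + (m ℕ.+ 1)) ⟩
    + T ℤ.+ (+ (m ℕ.+ 1) ℤ.- + (m ℕ.+ 1))
      ≡⟨ cong (ℤ._+_ (+ T)) (ℤ.+-inverseʳ (+ (m ℕ.+ 1))) ⟩
    + T ℤ.+ + 0
      ≡⟨ ℤ.+-identityʳ (+ T) ⟩
    + T ∎
    where
    open ≡.≡-Reasoning
    length≡′ : length ps ≡ T ℕ.+ (m ℕ.+ 1)
    length≡′ = trans length≡
      (solve 1 (λ t → con 2 :* t :+ con 4 := t :+ ((con 3 :+ t) :+ con 1)) refl T)
      where open ℕSolver.+-*-Solver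

  -- k = 2M - 2 exceeds M because M ≥ 3; this makes the constant coefficient M - k of P non-zero.
  k≢M : + length ps ≢ M
  k≢M eq = ℕ.<⇒≢ (ℕ.+-cancelʳ-< 2 m (length ps) (begin-strict
    m ℕ.+ 2          <⟨ ℕ.+-monoʳ-< m (s≤s (s≤s (s≤s z≤n))) ⟩
    m ℕ.+ m          ≡⟨ cong (m ℕ.+_) (sym (ℕ.+-identityʳ m)) ⟩
    2 ℕ.* m          ≡⟨ sym k+2≡2m ⟩
    length ps ℕ.+ 2  ∎)) (sym (ℤ.+-injective eq))
    where open ℕ.≤-Reasoning

  module _ where
    open IntegerSolver ℚ-algebra

    lo : ℚ
    lo = ℤ→ℚ M

    lo>2 : 1ℚ ℚ.+ 1ℚ ℚ.< lo
    lo>2 = ℤ→ℚ-mono-< {+ 2} {M} (ℤ.+<+ (s≤s (s≤s (s≤s z≤n))))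

    1≤lo : 1ℚ ℚ.≤ lo
    1≤lo = ℤ→ℚ-mono-≤ {+ 1} {M} (ℤ.+≤+ (s≤s z≤n))

    1≤lo+1 : 1ℚ ℚ.≤ lo ℚ.+ 1ℚ
    1≤lo+1 = ℚ.≤-trans 1≤lo (subst (ℚ._≤ lo ℚ.+ 1ℚ) (ℚ.+-identityʳ lo)
      (ℚ.+-monoʳ-≤ lo (ℚ.<⇒≤ (ℚ.positive⁻¹ 1ℚ))))

    f : ℚ → ℚ
    f = ℚ-Vieta.evaluate P

    -- At z = M the factor z - M vanishes and only the negated cofactor sum is left.
    f-lo : f lo ℚ.≤ 0ℚ
    f-lo = let p = Values.prodValue ℚ-algebra lo ps
               c = Values.cofactorsValue ℚ-algebra lo ps in
      ℚ.≤-trans (ℚ.≤-reflexive (trans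
        (PisotValues.evaluate-pisot ℚ-algebra lo {ps} M 1≤ps)
        (solve 3 (λ l p c → (l :- :1) :* (l :- l) :* p :- c := :- c) refl lo p c)))
      (ℚ.neg-antimono-≤ (RationalValues.cofactorsValue-nonneg 1≤lo ps))

    -- At z = M + 1 the factor (z - 1)(z - M) equals M, while the cofactor sum is at most k/2 ≤ M
    -- times the product.
    f-hi : 0ℚ ℚ.≤ f (lo ℚ.+ 1ℚ)
    f-hi = subst (0ℚ ℚ.≤_) (sym (trans
        (PisotValues.evaluate-pisot ℚ-algebra (lo ℚ.+ 1ℚ) {ps} M 1≤ps)
        (solve 3 (λ l p c → ((l :+ :1) :- :1) :* ((l :+ :1) :- l) :* p :- c
          := l :* p :- c) refl lo p c)))
      (subst (ℚ._≤ lo ℚ.* p ℚ.- c) (ℚ.+-inverseʳ c) (ℚ.+-monoˡ-≤ (ℚ.- c) {c} {lo ℚ.* p}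
        (ℚ.*-cancelˡ-≤-pos {c} {lo ℚ.* p} (ℤ→ℚ (+ 2)) {{ℚ.positive (ℤ→ℚ-mono-< {+ 0} {+ 2} (ℤ.+<+ (s≤s z≤n)))}} (begin
          ℤ→ℚ (+ 2) ℚ.* c
            ≤⟨ RationalValues.cofactorsValue-bound 1≤lo+1 2≤ps ⟩
          ℤ→ℚ (+ length ps) ℚ.* p
            ≤⟨ ℚ.*-monoʳ-≤-nonNeg p {{ℚ.nonNegative (RationalValues.prodValue-nonneg 1≤lo+1 ps)}}
                 (ℤ→ℚ-mono-≤ {+ length ps} {+ (2 ℕ.* m)} (ℤ.+≤+
                   (subst (length ps ≤_) k+2≡2m (ℕ.m≤m+n (length ps) 2)))) ⟩
          ℤ→ℚ (+ (2 ℕ.* m)) ℚ.* p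
            ≡⟨ cong (ℚ._* p) (trans (cong ℤ→ℚ (ℤ.pos-* 2 m)) (ℤ→ℚ-* (+ 2) M)) ⟩
          ℤ→ℚ (+ 2) ℚ.* lo ℚ.* p
            ≡⟨ ℚ.*-assoc (ℤ→ℚ (+ 2)) lo p ⟩
          ℤ→ℚ (+ 2) ℚ.* (lo ℚ.* p) ∎))))
      where
      open ℚ.≤-Reasoning
      p = Values.prodValue ℚ-algebra (lo ℚ.+ 1ℚ) ps
      c = Values.cofactorsValue ℚ-algebra (lo ℚ.+ 1ℚ) ps

  open Bisection f lo f-lo f-hi using (root-≥; root-zero) renaming (root to α) public

  α-root : ℝ-Vieta.evaluate P α ≈ℝ 0ℝ
  α-root = root-zero (ℝ-Vieta.evaluate P)
    (λ {x} {y} → PisotValues.evaluate-cong ℝ-algebra P {x} {y}) (evaluate-seq P)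

  2<α : ∀ n → 1ℚ ℚ.+ 1ℚ ℚ.< seq α n
  2<α n = ℚ.<-≤-trans lo>2 (root-≥ n)

  1<α : 1ℝ <ℝ α
  1<α = 1ℚ , ℚ.positive⁻¹ 1ℚ , always 2<α

  α-1-positive : RealOrder.Pos (α -ℝ 1ℝ)
  α-1-positive = RealOrder.pos-pointwise {α -ℝ 1ℝ} (ℚ.positive⁻¹ 1ℚ) λ n →
    ℚ.+-monoˡ-< (ℚ.- 1ℚ) (2<α n)

  Pα≈0 : eval Pℚ (ℝ→ℂ α) ≈ 0ℂ
  Pα≈0 = real-root P α α-root

  module R = Roots.AtRoot ℝ-ordered M k+2≡2M 1≤ps {α} α-1-positive α-root

  minimal : ∀ {e} (q : Monic ℚ e) → eval q (ℝ→ℂ α) ≈ 0ℂ → d ≤ e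
  minimal q qα≈0 = ℕ.≮⇒≥ (let N , N≢0 , r , r≈0 = integer-multiple q α qα≈0 in
    R.no-smaller-degree coprime k≢M r {N} N≢0 r≈0)

  P-minimal : IsMinimalPolynomial (ℝ→ℂ α) Pℚ
  P-minimal = Pα≈0 , minimal

  module ℚ→ℂ-Polynomials = RationalPolynomials.Along ℂ-algebra ℚ→ℂ
    (≈-pointwise {0ℂ} {0ℂ} (λ _ → refl) (λ _ → refl))
    (≈-pointwise {1ℂ} {1ℂ} (λ _ → refl) (λ _ → refl))
    (λ p q → ≈-pointwise {ℚ→ℂ (p ℚ.+ q)} {ℚ→ℂ p + ℚ→ℂ q} (λ _ → refl) (λ _ → refl))
    (λ p q → ≈-pointwise {ℚ→ℂ (p ℚ.* q)} {ℚ→ℂ p * ℚ→ℂ q}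
      (λ _ → sym (ℚ.+-identityʳ (p ℚ.* q)))
      (λ _ → sym (trans (cong₂ ℚ._+_ (ℚ.*-zeroʳ p) (ℚ.*-zeroˡ q)) refl)))
  open ℚ→ℂ-Polynomials using (monicEval; same-zeros)

  monicEval-eval : ∀ {e} (q : Monic ℚ e) z → monicEval q z ~ eval q z
  monicEval-eval []      z n = refl , refl
  monicEval-eval (c ∷ q) z n = let r , i = monicEval-eval q z n in
    cong₂ (λ a b → c ℚ.+ (seq (re z) n ℚ.* a ℚ.- seq (im z) n ℚ.* b)) r i ,
    cong₂ (λ a b → 0ℚ ℚ.+ (seq (re z) n ℚ.* b ℚ.+ seq (im z) n ℚ.* a)) r i

  to-monicEval : ∀ {e} (q : Monic ℚ e) z → eval q z ≈ 0ℂ → monicEval q z ≈ 0ℂ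
  to-monicEval q z = ≈-resp-~ {eval q z} {monicEval q z} {0ℂ} {0ℂ}
    (~-sym {monicEval q z} {eval q z} (monicEval-eval q z)) (~-refl {0ℂ})

  from-monicEval : ∀ {e} (q : Monic ℚ e) z → monicEval q z ≈ 0ℂ → eval q z ≈ 0ℂ
  from-monicEval q z = ≈-resp-~ {monicEval q z} {eval q z} {0ℂ} {0ℂ}
    (monicEval-eval q z) (~-refl {0ℂ})

  -- A conjugate may be certified by a minimal polynomial other than `Pℚ`. Minimality of both forces
  -- the same degree, and then `same-zeros` applies.
  conjugate-root : ∀ z → IsConjugate (ℝ→ℂ α) z → eval Pℚ z ≈ 0ℂ
  conjugate-root z (e , q , (qα≈0 , q-minimal) , qz≈0) =
    transport (ℕ.≤-antisym (minimal q qα≈0) (q-minimal Pℚ Pα≈0)) q qα≈0 qz≈0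
    where
    transport : ∀ {e} → d ≡ e → (q : Monic ℚ e) → eval q (ℝ→ℂ α) ≈ 0ℂ → eval q z ≈ 0ℂ →
      eval Pℚ z ≈ 0ℂ
    transport refl q qα≈0 qz≈0 = from-monicEval Pℚ z
      (same-zeros Pℚ q {ℝ→ℂ α} (to-monicEval Pℚ (ℝ→ℂ α) Pα≈0) (to-monicEval q (ℝ→ℂ α) qα≈0)
        (λ s sα≈0 → minimal s (from-monicEval s (ℝ→ℂ α) sα≈0))
        z (to-monicEval q z qz≈0))

  has-trace : HasTrace (ℝ→ℂ α) (ℚ→ℂ (ℤ→ℚ (ℤ.- (+ T))))
  has-trace = d , Pℚ , P-minimal , λ zs zeros →
    ≈-resp-~ {ℂ-Vieta.sumRoots zs} {sumℂ zs} { -ℂ ℚ→ℂ (ℤ→ℚ (second P))} {ℚ→ℂ (ℤ→ℚ (ℤ.- (+ T)))}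
      (sumℂ-sum zs)
      (λ _ → sym (trans (cong (λ t → ℤ→ℚ (ℤ.- t)) (sym second-P)) (ℤ→ℚ-neg (second P))) , refl)
      (ℂ-Vieta.vieta (λ n {t} → ℂ-torsion-free n {t}) P 0<d zs λ w →
        ≈-resp-~ {eval Pℚ w} {ℂ-Vieta.evaluate P w} {productℂ (Vec.map (λ z → w - z) zs)} {ℂ-Vieta.fromRoots zs w}
          (eval-ℤ P w) (productℂ-fromRoots zs w) (zeros w))

  module _ (z : ℂ) (Pz≈0 : eval Pℚ z ≈ 0ℂ) where

    root-z : ℂ-Vieta.evaluate P z ≈ 0ℂ
    root-z = ≈-resp-~ {eval Pℚ z} {ℂ-Vieta.evaluate P z} {0ℂ} {0ℂ} (eval-ℤ P z) (~-refl {0ℂ}) Pz≈0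

    powers : ℕ → ℂ
    powers = Values.power ℂ-algebra z

    module ℝS = Shift ℝ-algebra
    module ℂS = Shift ℂ-algebra
    open ℝS.Recurrence ps M k+2≡2M using (Recurrent)

    powers-recurrent : ∀ n → ℂS.diff ps powers (suc n)
      ≈ ℚ→ℂ (ℤ→ℚ M) * ℂS.diff ps powers n + ℂS.cofactors ps powers n
    powers-recurrent = PisotValues.root-recurrent ℂ-algebra {ps} M 1≤ps {z} {powers}
      (PisotValues.power-geometric ℂ-algebra z) root-z

    re-recurrent : Recurrent (re ∘ powers)
    re-recurrent = Re.map-recurrent proj₁ re-ι ps M {powers} powers-recurrent

    im-recurrent : Recurrent (im ∘ powers)
    im-recurrent = Im.map-recurrent proj₂ im-ι ps M {powers} powers-recurrent

    powers-rotating : ℝS.Rotating (re z) (im z) (re ∘ powers) (im ∘ powers)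
    powers-rotating = record
      { real = λ n → ℝ-ring.refl {re (z * powers n)}
      ; imag = λ n → ℝ-ring.refl {im (z * powers n)}
      }

    diff-norm-positive : RealOrder.Pos (norm ((z - 1ℂ) * ℂS.diff ps powers 0))
    diff-norm-positive = go (cofactorsAt1 ps) (cofactorsAt1-positive 1≤ps)
      (PisotValues.root-unit ℂ-algebra z {ps} M 1≤ps coprime root-z)
      where
      v = (z - 1ℂ) * ℂS.diff ps powers 0
      go : ∀ N → 1 ≤ N → ∃[ w ] w * v ≈ ℚ→ℂ (ℤ→ℚ (+ N)) * ℚ→ℂ (ℤ→ℚ (+ N)) →
        RealOrder.Pos (norm v)
      go (suc n) _ (w , eq) = norm-factor-positive w v n eq

    conjugate-in-disc : ¬ (z ≈ ℝ→ℂ α) → InOpenUnitDisc z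
    conjugate-in-disc z≉α = shuffle (R.in-disc {re z} {im z} {re ∘ powers} {im ∘ powers}
      powers-rotating re-recurrent im-recurrent z≉α
      (shifted-norm-positive z (ℂS.diff ps powers 0)
        {ℝS.diff ps (re ∘ powers) 0} {ℝS.diff ps (im ∘ powers) 0}
        (Re.map-diff ps powers 0) (Im.map-diff ps powers 0) diff-norm-positive))
      where
      open IntegerSolver ℚ-algebra
      shuffle : RealOrder.Pos (1ℝ -ℝ norm z) → InOpenUnitDisc z
      shuffle (ε , 0<ε , lower) = ε , 0<ε , map₁
        (λ n ε<1-r → let r = seq (norm z) n in subst₂ ℚ._<_ (ℚ.+-comm ε r)
          (solve 1 (λ r → (:1 :- r) :+ r := :1) refl r)
          (ℚ.+-monoˡ-< r ε<1-r)) lower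

  pisot : IsPisot α
  pisot = (d , P , Pα≈0) , 1<α , λ z conjugate → conjugate-in-disc z (conjugate-root z conjugate)

-- The first primes and the theorem

nthPrime-prime : ∀ n → Prime (nthPrime n)
nthPrime-prime zero    = NextPrime.isPrime (proj₂ (nextPrime 0))
nthPrime-prime (suc n) = NextPrime.isPrime (proj₂ (nextPrime (nthPrime n)))

nthPrime-< : ∀ n → nthPrime n ℕ.< nthPrime (suc n)
nthPrime-< n = NextPrime.greater (proj₂ (nextPrime (nthPrime n)))

nthPrime-mono : ∀ {i j} → i ℕ.< j → nthPrime i ℕ.< nthPrime j
nthPrime-mono {i} {suc j} (s≤s i≤j) with ℕ.m≤n⇒m<n∨m≡n i≤j
... | inj₁ i<j  = ℕ.<-trans (nthPrime-mono i<j) (nthPrime-< j)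
... | inj₂ refl = nthPrime-< i

2≤nthPrime : ∀ n → 2 ≤ nthPrime n
2≤nthPrime n = ℕ.nonTrivial⇒n>1 (nthPrime n) {{prime⇒nonTrivial (nthPrime-prime n)}}

nthPrime-coprime : ∀ {i j} → i ℕ.< j → Coprime (nthPrime i) (nthPrime j)
nthPrime-coprime {i} {j} i<j = Coprimality.sym (prime⇒coprime (nthPrime-prime j)
  {{ℕ.>-nonZero (ℕ.≤-trans (s≤s z≤n) (2≤nthPrime i))}} (nthPrime-mono i<j))

theorem2 : (T : ℕ) → 1 ≤ T →
    ∃[ α ] (IsPisot α
    × HasTrace (ℝ→ℂ α) (ℚ→ℂ (ℤ→ℚ (ℤ.- (+ T))))
    × ∃[ d ] (HasDegree (ℝ→ℂ α) d × d ≤ sumOfFirstPrimes (2 ℕ.* T ℕ.+ 4)))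
theorem2 T _ = construct primes
    (trans (List.length-map nthPrime (upTo k)) (List.length-upTo k))
    (All.map⁺ (All.applyUpTo⁺₂ id k 2≤nthPrime))
    (AllPairs.map⁺ (AllPairs.applyUpTo⁺₁ id k λ i<j _ → nthPrime-coprime i<j))
  where
  k = 2 ℕ.* T ℕ.+ 4
  primes = List.map nthPrime (upTo k)

  -- The list is abstracted so that it can be split into head and tail: `Construction` needs at
  -- least one prime, as the cofactor sum must be positive at 1.
  construct : ∀ ps → length ps ≡ k → All (2 ≤_) ps → AllPairs Coprime ps →
    ∃[ α ] (IsPisot α
    × HasTrace (ℝ→ℂ α) (ℚ→ℂ (ℤ→ℚ (ℤ.- (+ T))))
    × ∃[ d ] (HasDegree (ℝ→ℂ α) d × d ≤ sum ps))
  construct [] length≡ _ _ =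
    contradiction (ℕ.≤-trans (ℕ.m≤n+m 4 (2 ℕ.* T)) (ℕ.≤-reflexive (sym length≡))) λ ()
  construct (p ∷ ps) length≡ 2≤ps coprime =
    α , pisot , has-trace , d , (Pℚ , P-minimal) , d-bound
    where open Construction T length≡ 2≤ps coprime
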